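{- Let $\varepsilon>0$, $T\ge2$, and let $\mathcal I$ be an $\varepsilon$-well-behaved IIK instance with $n$ items and $T$ times. Then every optimal solution of $$\max\Big\{\sum_{t\in[T]}p^Tx_t:\ x\in\Big(\bigcup_{(S,\rho)}P(S,\rho)\Big)\cap\{0,1\}^{Tn}\Big\},$$ where the union ranges over all admissible pairs $(S,\rho)$, is a 1-in feasible solution of $\mathcal I$ of maximum profit among all 1-in feasible solutions. Moreover, there is a function $f:\mathbb{R}_{>0}\to\mathbb{R}_{>0}$ depending only on $\varepsilon$ such that the total number of linear constraints of all polytopes $P(S,\rho)$, summed over all admissible pairs $(S,\rho)$ (and hence the size of the associated disjunctive linear relaxation describing $\mathrm{conv}(\bigcup_{(S,\rho)}P(S,\rho))$), is at most $n\,T^{f(\varepsilon)}$.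
   Context: IIK: items $[n]$ with profits $p_i>0$, weights $w_i>0$, times $[T]$, nondecreasing nonnegative capacities $b_1\le\dots\le b_T$; a feasible solution is $x=(x_1,\dots,x_T)$, $x_t\in\{0,1\}^n$, $w^Tx_t\le b_t$, $x_t\le x_{t+1}$ componentwise; profit $\sum_t p^Tx_t$. Profits are normalized with $\max_i p_i=1$. A feasible solution is 1-in if $x_{T,i}=1$ for some item $i$ with $p_i=1$. The instance is $\varepsilon$-well-behaved if ($\varepsilon$1) each $p_i$ equals $(1+\varepsilon)^{ -j}$ for an integer $0\le j\le K:=\lceil\log_{1+\varepsilon}(T/\varepsilon)\rceil$ or satisfies $p_i\le\varepsilon/T$, and ($\varepsilon$2) with $b_0=0$, $b_t=b_{t-1}$ whenever $\lceil(1+\varepsilon)^{j-1}\rceil<T-t+1<\lceil(1+\varepsilon)^j\rceil$ for some integer $1\le j\le\lfloor\log_{1+\varepsilon}T\rfloor$. Profit classes: for $k\in\{0,\dots,K\}$, $I_k$ is the set of items with profit $(1+\varepsilon)^{ -k}$; $I_\infty$ is the set of all other items (profit $\le\varepsilon/T$). Fix a linear order $\prec$ on $[n]$ with $p_i/w_i\ge p_j/w_j$ whenever $i\prec j$, and label $I_k=\{1(k),\dots,|I_k|(k)\}$ in $\prec$-order (hence by nondecreasing weight). Let $C_\varepsilon=\lceil\log_{1+\varepsilon}(1/\varepsilon)\rceil$. Significant times: $\mathcal T=\{t\in[T]: t=T+1-\lceil(1+\varepsilon)^j\rceil \text{ for some integer } j\ge0\}$, listed as $t(1)<\dots<t(J)$,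 $J=|\mathcal T|$. Admissible pairs: $S=\{(j_1,k_1),\dots,(j_s,k_s)\}\subseteq[J]\times\{0,\dots,K\}$ with $j_h>j_{h+1}$, $k_h<k_{h+1}$ for $h\in[s-1]$ and $k_1=0$. Put $t_h=t(j_h)$, $t_0=T+1$, $k_{s+1}=K+1$, $\mathcal K_h=\{k\in\{0,\dots,K\}:k_h\le k\le k_h+C_\varepsilon\}$, $\mathcal T_h=\{t\in\mathcal T: t_h\le t<t_{h-1}\}$. Then $\rho$ assigns to each $(t,k)$ with $t\in\mathcal T_h,k\in\mathcal K_h$ (some $h\in[s]$) a value $\rho(t,k)\in\{0,1,\dots,\lceil1/\varepsilon\rceil+1\}$ such that $\rho(t,k_h)\ge1$ for $t\in\mathcal T_h$; $\rho(\bar t,k)\ge\rho(t,k)$ for $t,\bar t\in\mathcal T_h$, $\bar t\ge t$; and $\rho(\bar t,k)\ge\rho(t,k)$ whenever $\bar t\in\mathcal T_h$, $t\in\mathcal T_{h+1}$, $k\in\mathcal K_h\cap\mathcal K_{h+1}$. $P(S,\rho)$ is the set of $x=(x_1,\dots,x_T)\in\mathbb{R}^{Tn}$ with: $w^Tx_t\le b_t$ ($t\in[T]$); $x_t\le x_{t+1}$ ($t\in[T-1]$); $0\le x_t\le1$; and for each $h\in[s]$: $x_{t,i}=0$ for all $t<t_h$, all $k<k_{h+1}$ and all $i\in I_k$; $x_{t,i(k)}=1$ for all $t\in\mathcal T_h$, $k\in\mathcal K_h$, $i\le\rho(t,k)$; $x_{t,i(k)}=0$ for all $t\in\mathcal T_h$,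 $k\in\mathcal K_h$ with $\rho(t,k)\le\lceil1/\varepsilon\rceil$, and $i>\rho(t,k)$. (If some $\rho(t,k)>|I_k|$, then $P(S,\rho)=\emptyset$.)
   Formalization: In condition (ε2) the exponent j runs up to ⌈log_{1+ε} T⌉ instead of ⌊log_{1+ε} T⌋; as printed the claim fails, e.g. for ε=1, T=3, n=1, p=w=1, b=(1,1,1), where the optimum over the union is 2 rather than 3. -}

module Defs where

open import Algebra.Bundles using (CommutativeRing)
import Algebra.Properties.CommutativeMonoid.Sum
import Algebra.Properties.Monoid.Mult
import Algebra.Properties.Ring
import Algebra.Properties.Semiring.Exp
open import Data.Empty using (⊥-elim)
open import Data.Fin as Fin using (Fin; zero; suc; toℕ; inject₁)
open import Data.Fin.Permutation using (Permutation′; _⟨$⟩ʳ_)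
import Data.Fin.Properties as Fin
open import Data.List
  using (List; []; _∷_; _++_; map; concatMap; filter; length; lookup;
         allFin; upTo; take; drop; replicate; foldr; cartesianProduct)
open import Data.List.Membership.Propositional using (_∈_)
open import Data.List.Relation.Unary.All using (All)
open import Data.List.Relation.Unary.Any using (Any)
open import Data.List.Relation.Unary.Linked using (Linked)
open import Data.Nat as ℕ using (ℕ; zero; suc; _∸_)
import Data.Nat.Properties as ℕ
open import Data.Product using (Σ; ∃; _×_; _,_; proj₁; proj₂; map₂)
open import Data.Sum using (_⊎_; inj₁; inj₂)
open import Data.Vec as Vec using (Vec)
open import Level using (Level; _⊔_; Lift) renaming (suc to lsuc)
open import Relation.Binary using (Rel; IsDecTotalOrder)
open import Relation.Binary.PropositionalEquality as ≡ using (_≡_)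
open import Relation.Nullary using (¬_; Dec; yes; no)
open import Relation.Nullary.Decidable using (map′; _×-dec_)
open import Relation.Unary using (Pred; Decidable)

private
  variable
    a p : Level

------------------------------------------------------------------------
-- The scalars

-- An Archimedean ordered field with decidable order, standing in for ℝ,
-- which the standard library lacks.  Completeness is not required: the
-- logarithms below occur only under integer rounding.
record ArchimedeanField c ℓ₁ ℓ₂ : Set (lsuc (c ⊔ ℓ₁ ⊔ ℓ₂)) where
  infix 8 _⁻¹
  infix 4 _≤_
  field
    commutativeRing : CommutativeRing c ℓ₁

  open CommutativeRing commutativeRing public
    hiding (zero)

  field
    _≤_             : Rel Carrier ℓ₂
    isDecTotalOrder : IsDecTotalOrder _≈_ _≤_
    +-monoʳ-≤       : ∀ z {x y} → x ≤ y → z + x ≤ z + y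
    *-nonNegative   : ∀ {x y} → 0# ≤ x → 0# ≤ y → 0# ≤ x * y
    0≉1             : 0# ≉ 1#
    _⁻¹             : Carrier → Carrier
    *-inverseʳ      : ∀ {x} → x ≉ 0# → x * x ⁻¹ ≈ 1#

  open Algebra.Properties.Monoid.Mult +-monoid public
    using () renaming (_×_ to _·_)

  field
    archimedean     : ∀ x → ∃ λ m → x ≤ m · 1#

  open Algebra.Properties.Semiring.Exp semiring public
    using (_^_)
  open Algebra.Properties.CommutativeMonoid.Sum +-commutativeMonoid public
    using (sum)

  open import Relation.Binary.Construct.NonStrictToStrict _≈_ _≤_ public
    using (_<_)

  open IsDecTotalOrder isDecTotalOrder public
    using (_≤?_; _≟_)
    renaming (refl to ≤-refl; reflexive to ≤-reflexive; trans to ≤-trans;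
              antisym to ≤-antisym; total to ≤-total;
              ≤-respˡ-≈ to ≤-respˡ; ≤-respʳ-≈ to ≤-respʳ)

  fromℕ : ℕ → Carrier
  fromℕ m = m · 1#

------------------------------------------------------------------------
-- Least natural numbers

IsLeast : Pred ℕ p → Pred ℕ p
IsLeast P m = P m × (∀ j → P j → m ℕ.≤ j)

least : {P : Pred ℕ p} → Decidable P → ∃ P → ∃ (IsLeast P)
least P? (N , PN) = search P? N PN
  where
  search : {P : Pred ℕ p} → Decidable P → ∀ N → P N → ∃ (IsLeast P)
  search P? zero    P0 = zero , P0 , λ _ _ → ℕ.z≤n
  search P? (suc N) PN with P? zero
  ... | yes P0 = zero , P0 , λ _ _ → ℕ.z≤n
  ... | no ¬P0 with search (λ j → P? (suc j)) N PN
  ...   | m , Pm , m≤ = suc m , Pm , λ where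
    zero    P0 → ⊥-elim (¬P0 P0)
    (suc j) Pj → ℕ.s≤s (m≤ j Pj)

------------------------------------------------------------------------
-- Integer rounding, and rounding of logarithms to the base 1 + ε

module Rounding {c ℓ₁ ℓ₂} (F : ArchimedeanField c ℓ₁ ℓ₂) where
  open ArchimedeanField F

  -- Agrees with the integer ceiling for x > -1; it is applied to
  -- positive x only.
  ⌈_⌉ : Carrier → ℕ
  ⌈ x ⌉ = proj₁ (least (λ m → x ≤? fromℕ m) (archimedean x))

  ⌈⌉-isLeast : ∀ x → IsLeast (λ m → x ≤ fromℕ m) ⌈ x ⌉
  ⌈⌉-isLeast x = proj₂ (least (λ m → x ≤? fromℕ m) (archimedean x))

  module Base (ε : Carrier) (0<ε : 0# < ε) where
    open Algebra.Properties.Ring ring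
    open import Relation.Binary.Reasoning.Setoid setoid

    1+ε : Carrier
    1+ε = 1# + ε

    0≤ε : 0# ≤ ε
    0≤ε = proj₁ 0<ε

    +-monoˡ-≤ : ∀ z {x y} → x ≤ y → x + z ≤ y + z
    +-monoˡ-≤ z x≤y =
      ≤-respˡ (+-comm z _) (≤-respʳ (+-comm z _) (+-monoʳ-≤ z x≤y))

    *-monoˡ-≤ : ∀ {z x y} → 0# ≤ z → x ≤ y → z * x ≤ z * y
    *-monoˡ-≤ {z} {x} {y} 0≤z x≤y =
      ≤-respˡ (+-identityˡ _) (≤-respʳ eq (+-monoˡ-≤ (z * x) 0≤z[y-x]))
      where
      0≤y-x : 0# ≤ y - x
      0≤y-x = ≤-respˡ (-‿inverseʳ x) (+-monoˡ-≤ (- x) x≤y)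

      0≤z[y-x] : 0# ≤ z * (y - x)
      0≤z[y-x] = *-nonNegative 0≤z 0≤y-x

      eq : z * (y - x) + z * x ≈ z * y
      eq = begin
        z * (y - x) + z * x    ≈⟨ distribˡ z (y - x) x ⟨
        z * (y - x + x)        ≈⟨ *-congˡ (+-assoc y (- x) x) ⟩
        z * (y + (- x + x))    ≈⟨ *-congˡ (+-congˡ (-‿inverseˡ x)) ⟩
        z * (y + 0#)           ≈⟨ *-congˡ (+-identityʳ y) ⟩
        z * y                  ∎

    0≤1 : 0# ≤ 1#
    0≤1 with ≤-total 0# 1#
    ... | inj₁ 0≤1 = 0≤1
    ... | inj₂ 1≤0 = ≤-respʳ [-1]²≈1 (*-nonNegative 0≤-1 0≤-1)
      where
      0≤-1 : 0# ≤ - 1#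
      0≤-1 = ≤-respˡ (-‿inverseʳ 1#)
               (≤-respʳ (+-identityˡ (- 1#)) (+-monoˡ-≤ (- 1#) 1≤0))

      [-1]²≈1 : - 1# * - 1# ≈ 1#
      [-1]²≈1 = trans (-1*x≈-x (- 1#)) (-‿involutive 1#)

    x≤x+y : ∀ x {y} → 0# ≤ y → x ≤ x + y
    x≤x+y x 0≤y = ≤-respˡ (+-identityʳ x) (+-monoʳ-≤ x 0≤y)

    step : ∀ m → 1+ε ^ suc m ≈ 1+ε ^ m + ε * 1+ε ^ m
    step m = trans (distribʳ (1+ε ^ m) 1# ε) (+-congʳ (*-identityˡ _))

    1≤^ : ∀ m → 1# ≤ 1+ε ^ m
    1≤^ zero    = ≤-refl
    1≤^ (suc m) = ≤-respʳ (sym (step m)) (≤-trans (1≤^ m)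
      (x≤x+y _ (*-nonNegative 0≤ε (≤-trans 0≤1 (1≤^ m)))))

    ^-step-≤ : ∀ m → 1+ε ^ m + ε ≤ 1+ε ^ suc m
    ^-step-≤ m = ≤-respʳ (sym (step m)) (+-monoʳ-≤ (1+ε ^ m)
      (≤-respˡ (*-identityʳ ε) (*-monoˡ-≤ 0≤ε (1≤^ m))))

    m·ε≤^ : ∀ m → ε * fromℕ m ≤ 1+ε ^ m
    m·ε≤^ zero    = ≤-respˡ (sym (zeroʳ ε)) 0≤1
    m·ε≤^ (suc m) = ≤-respˡ (sym eq)
      (≤-trans (+-monoˡ-≤ ε (m·ε≤^ m)) (^-step-≤ m))
      where
      eq : ε * fromℕ (suc m) ≈ ε * fromℕ m + ε
      eq = trans (distribˡ ε 1# (fromℕ m))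
             (trans (+-comm _ _) (+-congˡ (*-identityʳ ε)))

    ^-unbounded : ∀ x → ∃ λ m → x ≤ 1+ε ^ m
    ^-unbounded x with archimedean (ε ⁻¹ * x)
    ... | m , x/ε≤m = m , ≤-trans
      (≤-respˡ eq (*-monoˡ-≤ 0≤ε x/ε≤m)) (m·ε≤^ m)
      where
      eq : ε * (ε ⁻¹ * x) ≈ x
      eq = begin
        ε * (ε ⁻¹ * x)   ≈⟨ *-assoc ε (ε ⁻¹) x ⟨
        ε * ε ⁻¹ * x     ≈⟨ *-congʳ (*-inverseʳ (λ ε≈0 → proj₂ 0<ε (sym ε≈0))) ⟩
        1# * x           ≈⟨ *-identityˡ x ⟩
        x                ∎

    -- Agrees with the integer ⌈log_{1+ε} x⌉ for x > (1+ε)⁻¹.  `Scheme`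
    -- uses it at T, T/ε and 1/ε with T ≥ 1; all three satisfy this, for
    -- every ε > 0, because ε < 1 + ε.
    ⌈log_⌉ : Carrier → ℕ
    ⌈log x ⌉ = proj₁ (least (λ m → x ≤? 1+ε ^ m) (^-unbounded x))

    ⌈log⌉-isLeast : ∀ x → IsLeast (λ m → x ≤ 1+ε ^ m) ⌈log x ⌉
    ⌈log⌉-isLeast x = proj₂ (least (λ m → x ≤? 1+ε ^ m) (^-unbounded x))

    ^-mono-+ : ∀ m d → 1+ε ^ m ≤ 1+ε ^ (d ℕ.+ m)
    ^-mono-+ m zero    = ≤-refl
    ^-mono-+ m (suc d) = ≤-trans (^-mono-+ m d)
      (≤-trans (x≤x+y _ 0≤ε) (^-step-≤ (d ℕ.+ m)))

    ^-mono-≤ : ∀ {m o} → m ℕ.≤ o → 1+ε ^ m ≤ 1+ε ^ o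
    ^-mono-≤ {m} {o} m≤o =
      ≡.subst (λ r → 1+ε ^ m ≤ 1+ε ^ r) (ℕ.m∸n+n≡m m≤o) (^-mono-+ m (o ∸ m))

    ^-cancel-≤ : ∀ {m o} → 1+ε ^ m ≤ 1+ε ^ o → m ℕ.≤ o
    ^-cancel-≤ {m} {o} le with m ℕ.≤? o
    ... | yes m≤o = m≤o
    ... | no  m≰o = ⊥-elim (proj₂ 0<ε (≤-antisym 0≤ε ε≤0))
      where
      y = 1+ε ^ o

      y+ε≤y : y + ε ≤ y
      y+ε≤y = ≤-trans (^-step-≤ o) (≤-trans (^-mono-≤ (ℕ.≰⇒> m≰o)) le)

      ε≤0 : ε ≤ 0#
      ε≤0 = ≤-respˡ
        (trans (sym (+-assoc (- y) y ε))
          (trans (+-congʳ (-‿inverseˡ y)) (+-identityˡ ε)))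
        (≤-respʳ (-‿inverseˡ y) (+-monoʳ-≤ (- y) y+ε≤y))

    roundedPower? : ∀ r → Dec (∃ λ j → ⌈ 1+ε ^ j ⌉ ≡ r)
    roundedPower? r = map′ (λ (j , _ , eq) → j , eq) bounded
      (ℕ.anyUpTo? (λ j → ⌈ 1+ε ^ j ⌉ ℕ.≟ r) (suc ⌈log fromℕ r ⌉))
      where
      bounded : (∃ λ j → ⌈ 1+ε ^ j ⌉ ≡ r) →
                ∃ λ j → j ℕ.< suc ⌈log fromℕ r ⌉ × ⌈ 1+ε ^ j ⌉ ≡ r
      bounded (j , ≡.refl) = j , ℕ.s≤s (^-cancel-≤ (≤-trans
        (proj₁ (⌈⌉-isLeast (1+ε ^ j)))
        (proj₁ (⌈log⌉-isLeast (fromℕ ⌈ 1+ε ^ j ⌉))))) , ≡.refl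

------------------------------------------------------------------------
-- Linear systems, and Balas' disjunctive formulation

module LinearSystems {c ℓ₁ ℓ₂} (F : ArchimedeanField c ℓ₁ ℓ₂) where
  open ArchimedeanField F

  data Sense : Set where
    leq eq : Sense

  Holds : Sense → Rel Carrier (ℓ₁ ⊔ ℓ₂)
  Holds leq x y = Lift ℓ₁ (x ≤ y)
  Holds eq  x y = Lift ℓ₂ (x ≈ y)

  record Constraint (V : Set) : Set c where
    constructor _⟨_⟩_
    field
      terms : List (Carrier × V)
      sense : Sense
      bound : Carrier

  System : Set → Set c
  System V = List (Constraint V)

  private
    variable
      V : Set

  evaluate : (V → Carrier) → List (Carrier × V) → Carrier
  evaluate x = foldr (λ (α , v) r → α * x v + r) 0#

  Satisfies : (V → Carrier) → Constraint V → Set (ℓ₁ ⊔ ℓ₂)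
  Satisfies x (ts ⟨ s ⟩ β) = Holds s (evaluate x ts) β

  Solves : (V → Carrier) → System V → Set (c ⊔ ℓ₁ ⊔ ℓ₂)
  Solves x = All (Satisfies x)

  ConvexHull : Pred (V → Carrier) p → Pred (V → Carrier) (c ⊔ ℓ₁ ⊔ ℓ₂ ⊔ p)
  ConvexHull {V = V} P x =
    Σ ℕ λ m → Σ (Fin m → V → Carrier) λ y → Σ (Fin m → Carrier) λ μ →
      (∀ r → P (y r)) × (∀ r → 0# ≤ μ r) × sum μ ≈ 1# ×
      (∀ v → x v ≈ sum (λ r → μ r * y r v))

  data DisjunctiveVar (V : Set) (N : ℕ) : Set where
    original   : V → DisjunctiveVar V N
    copy       : Fin N → V → DisjunctiveVar V N
    multiplier : Fin N → DisjunctiveVar V N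

  -- For polytopes Aʳ y ≤ βʳ, r < N:  x = Σᵣ yʳ,  Σᵣ λᵣ = 1,  λ ≥ 0  and
  -- Aʳ yʳ ≤ βʳ λᵣ.  The list vs enumerates the variables V.
  disjunctive : (vs : List V) (Ps : List (System V)) →
                System (DisjunctiveVar V (length Ps))
  disjunctive vs Ps =
       map link vs
    ++ (map (λ r → 1# , multiplier r) rs ⟨ eq ⟩ 1#)
    ∷  map (λ r → ((- 1# , multiplier r) ∷ []) ⟨ leq ⟩ 0#) rs
    ++ concatMap (λ r → map (homogenise r) (lookup Ps r)) rs
    where
    rs = allFin (length Ps)

    link : _ → Constraint _
    link v =
      ((1# , original v) ∷ map (λ r → - 1# , copy r v) rs) ⟨ eq ⟩ 0#

    homogenise : Fin (length Ps) → Constraint _ → Constraint _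
    homogenise r (ts ⟨ s ⟩ β) =
      ((- β , multiplier r) ∷ map (map₂ (copy r)) ts) ⟨ s ⟩ 0#

  -- Number of variables plus number of constraints.
  disjunctiveSize : List V → List (System V) → ℕ
  disjunctiveSize vs Ps =
    (length vs ℕ.+ length Ps ℕ.* (length vs ℕ.+ 1))
      ℕ.+ length (disjunctive vs Ps)

------------------------------------------------------------------------
-- Incremental knapsack

module Knapsack {c ℓ₁ ℓ₂} (F : ArchimedeanField c ℓ₁ ℓ₂) where
  open ArchimedeanField F
  open Rounding F
  open LinearSystems F

  -- Time t ∈ {1,…,T} is the element t - 1 of Fin T.
  record Instance (n T : ℕ) : Set (c ⊔ ℓ₁ ⊔ ℓ₂) where
    field
      profit weight : Fin n → Carrier
      capacity      : Fin T → Carrier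
      profit>0      : ∀ i → 0# < profit i
      weight>0      : ∀ i → 0# < weight i
      capacity≥0    : ∀ t → 0# ≤ capacity t
      capacity-mono : ∀ {t u} → t Fin.≤ u → capacity t ≤ capacity u
      profit≤1      : ∀ i → profit i ≤ 1#
      profit-max    : ∃ λ i → profit i ≈ 1#

  Point : ℕ → ℕ → Set c
  Point n T = Fin T × Fin n → Carrier

  Binary : ∀ {n T} → Point n T → Set ℓ₁
  Binary x = ∀ v → x v ≈ 0# ⊎ x v ≈ 1#

  IsMaximiser : {A : Set a} → (A → Carrier) → Pred A p → A → Set (a ⊔ p ⊔ ℓ₂)
  IsMaximiser f P x = P x × (∀ y → P y → f y ≤ f x)

  -- T - t + 1
  remaining : ∀ {T} → Fin T → ℕ
  remaining {T} t = T ∸ toℕ t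

  -- The value at time t - 1, with b₀ = 0.
  before : ∀ {T} → (Fin T → Carrier) → Fin T → Carrier
  before b zero    = 0#
  before b (suc t) = b (inject₁ t)

  module _ {n T : ℕ} (I : Instance n T) where
    open Instance I

    totalProfit : Point n T → Carrier
    totalProfit x = sum (λ t → sum (λ i → profit i * x (t , i)))

    record Feasible (x : Point n T) : Set (c ⊔ ℓ₁ ⊔ ℓ₂) where
      field
        binary   : Binary x
        knapsack : ∀ t → sum (λ i → weight i * x (t , i)) ≤ capacity t
        chain    : ∀ t u → toℕ u ≡ suc (toℕ t) → ∀ i → x (t , i) ≤ x (u , i)

    OneIn : Point n T → Set ℓ₁
    OneIn x = ∃ λ t → suc (toℕ t) ≡ T ×
                (∃ λ i → profit i ≈ 1# × x (t , i) ≈ 1#)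

    -- The linear order i₁ ≺ i₂ ≺ … on the items, given as the sequence
    -- σ 0, σ 1, …
    ByEfficiency : Permutation′ n → Set ℓ₂
    ByEfficiency σ = ∀ {r s} → r Fin.< s → efficiency s ≤ efficiency r
      where
      efficiency : Fin n → Carrier
      efficiency r = profit (σ ⟨$⟩ʳ r) * weight (σ ⟨$⟩ʳ r) ⁻¹

  module Scheme (ε : Carrier) (0<ε : 0# < ε) {n T : ℕ} (I : Instance n T) where
    open Base ε 0<ε public
    open Instance I

    K C R : ℕ
    K = ⌈log fromℕ T * ε ⁻¹ ⌉
    C = ⌈log ε ⁻¹ ⌉
    R = ⌈ ε ⁻¹ ⌉

    -- In ε2 the exponent suc j runs up to ⌈log_{1+ε} T⌉.  Stopping at
    -- ⌊log_{1+ε} T⌋ would leave the capacities before the first significant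
    -- time unconstrained (and b₀ would never be used), although points of
    -- P(S,ρ) can only pack items of profit at most ε/T there: with ε = 1,
    -- T = 3, n = 1, p = w = 1 and b = (1,1,1), the optimum over the P(S,ρ)
    -- would be 2 instead of 3.
    record WellBehaved : Set (c ⊔ ℓ₁ ⊔ ℓ₂) where
      field
        ε1 : ∀ i → (∃ λ k → k ℕ.≤ K × profit i ≈ (1+ε ^ k) ⁻¹)
                   ⊎ profit i ≤ ε * fromℕ T ⁻¹
        ε2 : ∀ j → suc j ℕ.≤ ⌈log fromℕ T ⌉ → ∀ t →
             ⌈ 1+ε ^ j ⌉ ℕ.< remaining t →
             remaining t ℕ.< ⌈ 1+ε ^ suc j ⌉ →
             capacity t ≈ before capacity t

    Significant : Pred (Fin T) _
    Significant t = ∃ λ j → ⌈ 1+ε ^ j ⌉ ≡ remaining t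

    significant? : Decidable Significant
    significant? t = roundedPower? (remaining t)

    -- The strictly increasing t(·) identifies [J] with the set of
    -- significant times, so S lists the pairs (t(jₕ) , kₕ) instead of
    -- (jₕ , kₕ).  ρ is stored as a table, and `dom` in Admissible makes its
    -- irrelevant entries 0, so that distinct ρ are distinct tables.
    record Pair : Set where
      constructor _&_
      field
        S : List (Fin T × Fin (suc K))
        ρ : Vec (Vec (Fin (2 ℕ.+ R)) (suc K)) T

      ρ⟨_,_⟩ : Fin T → Fin (suc K) → ℕ
      ρ⟨ t , k ⟩ = toℕ (Vec.lookup (Vec.lookup ρ t) k)

    -- The data (tₕ , tₕ₋₁ , kₕ , kₕ₊₁) for one h ∈ [s].
    record Block : Set where
      field
        tₕ   : Fin T
        tₕ₋₁ : ℕ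
        kₕ   : Fin (suc K)
        kₕ₊₁ : ℕ

      InTimes : Pred (Fin T) _
      InTimes t = Significant t × (tₕ Fin.≤ t × toℕ t ℕ.< tₕ₋₁)

      inTimes? : Decidable InTimes
      inTimes? t = significant? t ×-dec ((tₕ Fin.≤? t) ×-dec (toℕ t ℕ.<? tₕ₋₁))

      InClasses : Pred (Fin (suc K)) _
      InClasses k = kₕ Fin.≤ k × toℕ k ℕ.≤ toℕ kₕ ℕ.+ C

      inClasses? : Decidable InClasses
      inClasses? k = (kₕ Fin.≤? k) ×-dec (toℕ k ℕ.≤? toℕ kₕ ℕ.+ C)

    blocksFrom : ℕ → List (Fin T × Fin (suc K)) → List Block
    blocksFrom prev []            = []
    blocksFrom prev ((t , k) ∷ S) =
      record { tₕ = t ; tₕ₋₁ = prev ; kₕ = k ; kₕ₊₁ = nextClass S }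
        ∷ blocksFrom (toℕ t) S
      where
      nextClass : List (Fin T × Fin (suc K)) → ℕ
      nextClass []            = suc K
      nextClass ((_ , k′) ∷ _) = toℕ k′

    -- t₀ = T + 1 is T after the shift of times by one.
    blocks : Pair → List Block
    blocks q = blocksFrom T (Pair.S q)

    StartsAtZero : List (Fin T × Fin (suc K)) → Set
    StartsAtZero S = ∃ λ t → ∃ λ S′ → S ≡ (t , zero) ∷ S′

    record Admissible (q : Pair) : Set (c ⊔ ℓ₁ ⊔ ℓ₂) where
      open Pair q
      open Block
      field
        times   : All (λ (t , _) → Significant t) S
        ordered : Linked (λ (t , k) (t′ , k′) → t′ Fin.< t × k Fin.< k′) S
        start   : StartsAtZero S
        dom     : ∀ t k → ¬ Any (λ B → InTimes B t × InClasses B k) (blocks q) →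
                  ρ⟨ t , k ⟩ ≡ 0
        leading : All (λ B → ∀ t → InTimes B t → 1 ℕ.≤ ρ⟨ t , kₕ B ⟩) (blocks q)
        mono    : All (λ B → ∀ t u k → InTimes B t → InTimes B u →
                             InClasses B k → t Fin.≤ u →
                             ρ⟨ t , k ⟩ ℕ.≤ ρ⟨ u , k ⟩) (blocks q)
        -- B and B′ belong to h and h + 1.
        mono⁺   : Linked (λ B B′ → ∀ u t k → InTimes B u → InTimes B′ t →
                                   InClasses B k → InClasses B′ k →
                                   ρ⟨ t , k ⟩ ℕ.≤ ρ⟨ u , k ⟩) (blocks q)

    module Polytopes (σ : Permutation′ n) where

      items : List (Fin n)
      items = map (σ ⟨$⟩ʳ_) (allFin n)

      profitClass : Fin (suc K) → List (Fin n)
      profitClass k = filter (λ i → profit i ≟ (1+ε ^ toℕ k) ⁻¹) items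

      variables : List (Fin T × Fin n)
      variables = cartesianProduct (allFin T) (allFin n)

      fix : Carrier → Fin T → Fin n → Constraint (Fin T × Fin n)
      fix α t i = ((1# , (t , i)) ∷ []) ⟨ eq ⟩ α

      -- The constraint on x_{t,i(k)} when i > |I_k|: it makes P(S,ρ) empty.
      unsatisfiable : Constraint (Fin T × Fin n)
      unsatisfiable = [] ⟨ eq ⟩ 1#

      common : System (Fin T × Fin n)
      common =
           map (λ t → map (λ i → weight i , (t , i)) (allFin n)
                        ⟨ leq ⟩ capacity t) (allFin T)
        ++ concatMap (λ t → concatMap (λ u → map (λ i →
             ((1# , (t , i)) ∷ (- 1# , (u , i)) ∷ []) ⟨ leq ⟩ 0#) (allFin n))
             (filter (λ u → toℕ u ℕ.≟ suc (toℕ t)) (allFin T))) (allFin T)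
        ++ map (λ v → ((- 1# , v) ∷ []) ⟨ leq ⟩ 0#) variables
        ++ map (λ v → ((1# , v) ∷ []) ⟨ leq ⟩ 1#) variables

      module _ (q : Pair) where
        open Pair q

        early : Block → System (Fin T × Fin n)
        early B =
          concatMap (λ t → concatMap (λ k → map (fix 0# t) (profitClass k))
            (filter (λ k → toℕ k ℕ.<? kₕ₊₁) (allFin (suc K))))
          (filter (λ t → t Fin.<? tₕ) (allFin T))
          where open Block B

        packed : Fin T → Fin (suc K) → System (Fin T × Fin n)
        packed t k =
             map (fix 1# t) (take ρ⟨ t , k ⟩ (profitClass k))
          ++ replicate (ρ⟨ t , k ⟩ ∸ length (profitClass k)) unsatisfiable

        excluded : Fin T → Fin (suc K) → System (Fin T × Fin n)
        excluded t k with ρ⟨ t , k ⟩ ℕ.≤? R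
        ... | yes _ = map (fix 0# t) (drop ρ⟨ t , k ⟩ (profitClass k))
        ... | no  _ = []

        blockConstraints : Block → System (Fin T × Fin n)
        blockConstraints B = early B ++
          concatMap (λ t → concatMap (λ k → packed t k ++ excluded t k)
            (filter inClasses? (allFin (suc K))))
          (filter inTimes? (allFin T))
          where open Block B

        P : System (Fin T × Fin n)
        P = common ++ concatMap blockConstraints (blocks q)

      ⋃P : Pred (Point n T) (c ⊔ ℓ₁ ⊔ ℓ₂)
      ⋃P x = ∃ λ q → Admissible q × Solves x (P q)

{-# OPTIONS --safe #-}

-- A binary point of P(S,ρ) is 1-in because the last time is significant and
-- ρ(T,0) ≥ 1.  Conversely, a 1-in solution y only gains profit when it is
-- changed as follows.  Capacities are constant between significant times, so
-- everything packed before the next significant time is packed at once; then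
-- the items packed from each profit class are replaced by equally many of
-- the lightest ones, which come first in the order by efficiency.  The result
-- lies in P(S,ρ) for the S that records when the best packed class improves,
-- and the ρ that records how many items of each class are packed.
--
-- For the size, |𝒯| and K are O(log T) for fixed ε, S is determined by a set
-- of times and a set of classes, and each significant time has only C + 1
-- relevant classes; hence there are at most
-- 2^(|𝒯| + K + 1) (⌈1/ε⌉ + 2)^((C + 1) |𝒯|) admissible pairs, which is
-- polynomial in T.  The hull is described by Balas' disjunctive formulation.

module Submission where

import Algebra.Properties.CommutativeSemigroup
import Algebra.Properties.Monoid.Mult
import Algebra.Properties.Ring
import Algebra.Properties.Semiring.Exp
import Algebra.Properties.Semiring.Mult
import Algebra.Properties.Semiring.Sum
open import Data.Empty using (⊥; ⊥-elim)
open import Data.Fin as Fin using (Fin; zero; suc; toℕ; inject₁; opposite)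
open import Data.Fin.Permutation using (Permutation′; _⟨$⟩ʳ_; _⟨$⟩ˡ_; inverseˡ; inverseʳ)
import Data.Fin.Properties as Fin
open import Data.List using (List; []; _∷_; _++_; map; concatMap; filter; length; lookup; allFin;
  tabulate; upTo; foldr; take; drop; replicate; zip; cartesianProductWith; deduplicate)
open import Data.List.Membership.Propositional using (_∈_; _∉_; find; lose)
open import Data.List.Membership.Propositional.Properties using (∈-map⁺; ∈-map⁻; ∈-++⁺ˡ; ∈-++⁺ʳ;
  ∈-++⁻; ∈-∃++; ∈-filter⁺; ∈-filter⁻; ∈-concatMap⁺; ∈-cartesianProduct⁺; ∈-cartesianProductWith⁺;
  ∈-tabulate⁺; ∈-allFin; ∈-upTo⁺; ∈-lookup; ∈-deduplicate⁺; ∈-deduplicate⁻)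
open import Data.List.Properties using (map-∘; map-cong; map-tabulate; take++drop≡id;
  filter-reject; filter-none; filter-some; length-map; length-++; length-filter; length-tabulate;
  length-upTo; length-take; length-drop; length-replicate; length-deduplicate)
import Data.List.Properties as List
open import Data.List.Relation.Unary.All as All using (All; []; _∷_)
import Data.List.Relation.Unary.All.Properties as All
open import Data.List.Relation.Unary.AllPairs as AllPairs using (AllPairs; []; _∷_)
import Data.List.Relation.Unary.AllPairs.Properties as AllPairs
open import Data.List.Relation.Unary.Any using (Any; any?; here; there; index)
open import Data.List.Relation.Unary.Any.Properties using (lookup-index)
open import Data.List.Relation.Unary.Linked as Linked using (Linked; []; [-]; _∷_; linked?)
open import Data.List.Relation.Unary.Linked.Properties using (Linked⇒AllPairs)
open import Data.List.Relation.Unary.Unique.DecPropositional.Properties using (deduplicate-!)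
open import Data.List.Relation.Unary.Unique.Propositional using (Unique)
import Data.List.Relation.Unary.Unique.Propositional.Properties as Unique
open import Data.Nat as ℕ using (ℕ; zero; suc; z≤n; s≤s; _∸_)
open import Data.Nat.ListAction using () renaming (sum to sumℕ)
import Data.Nat.Properties as ℕ
open import Data.Nat.Tactic.RingSolver using (solve-∀)
open import Data.Product using (Σ; ∃; _×_; _,_; proj₁; proj₂; map₂)
import Data.Product.Properties as Product
open import Data.Sum using (_⊎_; inj₁; inj₂)
open import Data.Vec as Vec using (Vec; []; _∷_)
import Data.Vec.Properties as Vec
open import Function using (_∘_; id; case_of_)
open import Function.Bundles using (_⇔_; mk⇔; module Equivalence)
open import Level using (_⊔_; lift; lower)
open import Relation.Binary using (DecidableEquality; Rel)
open import Relation.Binary.PropositionalEquality as ≡ using (_≡_; _≢_)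
import Relation.Binary.Reasoning.Setoid
open import Relation.Nullary using (¬_; Dec; yes; no; ¬?)
open import Relation.Nullary.Decidable using (map′; _×-dec_; _→-dec_)
open import Relation.Unary using (Pred; Decidable)
open import Defs

-- Condition `ε2` with b₀ = 0 makes the capacities vanish before the first significant time. So
-- after the change nothing is packed there, and a class that is packed at all is first packed at a
-- significant time. This keeps the times recorded in S significant; since they mark every
-- improvement of the best class, the rows that forbid the classes below kₕ₊₁ before tₕ hold too.
--
-- Inside a class all profits agree, so the order by efficiency is the order by weight, and an
-- exchange keeps the profit while the weight cannot grow. The numbers packed grow with time, so the
-- prefixes are nested and the chain condition survives. The value R + 1 of ρ means "more than R"
-- and excludes nothing; this is why finitely many values cover all packings.
--
-- For the size, T is compared with a power of two, T ≤ 2^l ≤ 2T ≤ T², and (1+ε)^R ≥ 2 bounds every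
-- logarithm to base 1+ε by a multiple of l. A constant raised to such a logarithm is a fixed power
-- of T. Balas' formulation gives exactly the hull because 0 ≤ x ≤ 1 makes all recession cones
-- trivial.

-- Arithmetic in an ordered field

module OrderedField {c ℓ₁ ℓ₂} (F : ArchimedeanField c ℓ₁ ℓ₂) where
  open ArchimedeanField F
  open Algebra.Properties.Ring ring
  open Algebra.Properties.Semiring.Sum semiring using (sum-cong-≋; sum-replicate-zero)
  open Relation.Binary.Reasoning.Setoid setoid

  0<1 : 0# < 1#
  0<1 = 0≤1 , 0≉1
    where
    0≤1 : 0# ≤ 1#
    0≤1 with ≤-total 0# 1#
    ... | inj₁ 0≤1 = 0≤1
    ... | inj₂ 1≤0 = ≤-respʳ [-1]²≈1 (*-nonNegative 0≤-1 0≤-1)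
      where
      0≤-1 : 0# ≤ - 1#
      0≤-1 = ≤-respˡ (-‿inverseˡ 1#) (≤-respʳ (+-identityʳ (- 1#)) (+-monoʳ-≤ (- 1#) 1≤0))

      [-1]²≈1 : - 1# * - 1# ≈ 1#
      [-1]²≈1 = trans (-1*x≈-x (- 1#)) (-‿involutive 1#)

  -- These facts do not involve the base, so the instance with `ε = 1#` supplies them; only `0<1`
  -- has to be shown beforehand.
  open Rounding.Base F 1# 0<1 public using (+-monoˡ-≤; *-monoˡ-≤; 0≤1; x≤x+y)

  +-mono-≤ : ∀ {x y u v} → x ≤ y → u ≤ v → x + u ≤ y + v
  +-mono-≤ x≤y u≤v = ≤-trans (+-monoˡ-≤ _ x≤y) (+-monoʳ-≤ _ u≤v)

  *-monoʳ-≤ : ∀ {z x y} → 0# ≤ z → x ≤ y → x * z ≤ y * z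
  *-monoʳ-≤ 0≤z x≤y = ≤-respˡ (*-comm _ _) (≤-respʳ (*-comm _ _) (*-monoˡ-≤ 0≤z x≤y))

  +-nonNegative : ∀ {x y} → 0# ≤ x → 0# ≤ y → 0# ≤ x + y
  +-nonNegative 0≤x 0≤y = ≤-respˡ (+-identityˡ 0#) (+-mono-≤ 0≤x 0≤y)

  x-y≤0⇒x≤y : ∀ {x y} → x - y ≤ 0# → x ≤ y
  x-y≤0⇒x≤y {x} {y} x-y≤0 =
    ≤-respˡ (trans (+-assoc x (- y) y) (trans (+-congˡ (-‿inverseˡ y)) (+-identityʳ x)))
      (≤-respʳ (+-identityˡ y) (+-monoˡ-≤ y x-y≤0))

  x≤y⇒x-y≤0 : ∀ {x y} → x ≤ y → x - y ≤ 0#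
  x≤y⇒x-y≤0 {x} {y} x≤y = ≤-respʳ (-‿inverseʳ y) (+-monoˡ-≤ (- y) x≤y)

  -x≤0⇒0≤x : ∀ {x} → - x ≤ 0# → 0# ≤ x
  -x≤0⇒0≤x {x} -x≤0 = x-y≤0⇒x≤y (≤-respˡ (sym (+-identityˡ (- x))) -x≤0)

  0≤x⇒-x≤0 : ∀ {x} → 0# ≤ x → - x ≤ 0#
  0≤x⇒-x≤0 {x} 0≤x = ≤-respˡ (+-identityˡ (- x)) (x≤y⇒x-y≤0 0≤x)

  x-y≈0⇒x≈y : ∀ {x y} → x - y ≈ 0# → x ≈ y
  x-y≈0⇒x≈y {x} {y} x-y≈0 = trans (sym (+-identityʳ x)) (trans (+-congˡ (sym (-‿inverseˡ y)))
    (trans (sym (+-assoc x (- y) y)) (trans (+-congʳ x-y≈0) (+-identityˡ y))))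

  <⇒≱ : ∀ {x y} → x < y → ¬ y ≤ x
  <⇒≱ (x≤y , x≉y) y≤x = x≉y (≤-antisym x≤y y≤x)

  <-≤-trans : ∀ {x y z} → x < y → y ≤ z → x < z
  <-≤-trans (x≤y , x≉y) y≤z =
    ≤-trans x≤y y≤z , λ x≈z → x≉y (≤-antisym x≤y (≤-respʳ (sym x≈z) y≤z))

  0<⇒≉0 : ∀ {x} → 0# < x → x ≉ 0#
  0<⇒≉0 (_ , 0≉x) x≈0 = 0≉x (sym x≈0)

  ⁻¹-nonNegative : ∀ {x} → 0# < x → 0# ≤ x ⁻¹
  ⁻¹-nonNegative {x} 0<x with ≤-total 0# (x ⁻¹)
  ... | inj₁ 0≤x⁻¹ = 0≤x⁻¹
  ... | inj₂ x⁻¹≤0 = ⊥-elim (<⇒≱ 0<1 (≤-respˡ (*-inverseʳ (0<⇒≉0 0<x))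
      (≤-respʳ (zeroʳ x) (*-monoˡ-≤ (proj₁ 0<x) x⁻¹≤0))))

  *-inverseˡ : ∀ {x} → x ≉ 0# → x ⁻¹ * x ≈ 1#
  *-inverseˡ x≉0 = trans (*-comm _ _) (*-inverseʳ x≉0)

  x⁻¹*[x*y]≈y : ∀ {x} y → x ≉ 0# → x ⁻¹ * (x * y) ≈ y
  x⁻¹*[x*y]≈y y x≉0 = trans (sym (*-assoc _ _ _)) (trans (*-congʳ (*-inverseˡ x≉0)) (*-identityˡ y))

  x*[x⁻¹*y]≈y : ∀ {x} y → x ≉ 0# → x * (x ⁻¹ * y) ≈ y
  x*[x⁻¹*y]≈y y x≉0 = trans (sym (*-assoc _ _ _)) (trans (*-congʳ (*-inverseʳ x≉0)) (*-identityˡ y))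

  *-cancelˡ-≤ : ∀ {z x y} → 0# < z → z * x ≤ z * y → x ≤ y
  *-cancelˡ-≤ {z} {x} {y} 0<z zx≤zy =
    ≤-respˡ (x⁻¹*[x*y]≈y x (0<⇒≉0 0<z)) (≤-respʳ (x⁻¹*[x*y]≈y y (0<⇒≉0 0<z))
      (*-monoˡ-≤ (⁻¹-nonNegative 0<z) zx≤zy))

  ⁻¹-cong : ∀ {x y} → x ≉ 0# → x ≈ y → x ⁻¹ ≈ y ⁻¹
  ⁻¹-cong {x} {y} x≉0 x≈y = begin
    x ⁻¹                ≈⟨ x⁻¹*[x*y]≈y (x ⁻¹) y≉0 ⟨
    y ⁻¹ * (y * x ⁻¹)   ≈⟨ *-congˡ (*-congʳ x≈y) ⟨
    y ⁻¹ * (x * x ⁻¹)   ≈⟨ *-congˡ (*-inverseʳ x≉0) ⟩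
    y ⁻¹ * 1#           ≈⟨ *-identityʳ (y ⁻¹) ⟩
    y ⁻¹                ∎
    where
    y≉0 : y ≉ 0#
    y≉0 y≈0 = x≉0 (trans x≈y y≈0)

  ⁻¹-injective : ∀ {x y} → x ≉ 0# → y ≉ 0# → x ⁻¹ ≈ y ⁻¹ → x ≈ y
  ⁻¹-injective {x} {y} x≉0 y≉0 x⁻¹≈y⁻¹ = begin
    x                 ≈⟨ x*[x⁻¹*y]≈y x y≉0 ⟨
    y * (y ⁻¹ * x)    ≈⟨ *-congˡ (*-congʳ x⁻¹≈y⁻¹) ⟨
    y * (x ⁻¹ * x)    ≈⟨ *-congˡ (*-inverseˡ x≉0) ⟩
    y * 1#            ≈⟨ *-identityʳ y ⟩
    y                 ∎

  1⁻¹≈1 : 1# ⁻¹ ≈ 1#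
  1⁻¹≈1 = trans (sym (*-identityˡ _)) (*-inverseʳ (0<⇒≉0 0<1))

  sum-cong : ∀ {n} {f g : Fin n → Carrier} → (∀ i → f i ≈ g i) → sum f ≈ sum g
  sum-cong = sum-cong-≋

  sum-mono : ∀ {n} {f g : Fin n → Carrier} → (∀ i → f i ≤ g i) → sum f ≤ sum g
  sum-mono {zero}  f≤g = ≤-refl
  sum-mono {suc n} f≤g = +-mono-≤ (f≤g zero) (sum-mono (f≤g ∘ suc))

  sum-nonNegative : ∀ {n} {f : Fin n → Carrier} → (∀ i → 0# ≤ f i) → 0# ≤ sum f
  sum-nonNegative {zero}  0≤f = ≤-refl
  sum-nonNegative {suc n} 0≤f = +-nonNegative (0≤f zero) (sum-nonNegative (0≤f ∘ suc))

  term≤sum : ∀ {n} {f : Fin n → Carrier} → (∀ i → 0# ≤ f i) → ∀ i → f i ≤ sum f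
  term≤sum 0≤f zero    = x≤x+y _ (sum-nonNegative (0≤f ∘ suc))
  term≤sum 0≤f (suc i) = ≤-trans (term≤sum (0≤f ∘ suc) i)
    (≤-respˡ (+-identityˡ _) (+-monoˡ-≤ _ (0≤f zero)))

  -- Later assigns the weight of a point to a single polytope, so that summing over all polytopes
  -- returns the weight.
  δ : ∀ {m} → Fin m → Fin m → Carrier → Carrier
  δ i j α with i Fin.≟ j
  ... | yes _ = α
  ... | no  _ = 0#

  δ-nonNegative : ∀ {m} (i j : Fin m) {α} → 0# ≤ α → 0# ≤ δ i j α
  δ-nonNegative i j 0≤α with i Fin.≟ j
  ... | yes _ = 0≤α
  ... | no  _ = ≤-refl

  δ-suc : ∀ {m} (i j : Fin m) α → δ (suc i) (suc j) α ≡ δ i j α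
  δ-suc i j α with i Fin.≟ j
  ... | yes _ = ≡.refl
  ... | no  _ = ≡.refl

  sum-δ : ∀ {m} (i : Fin m) α → sum (λ j → δ i j α) ≈ α
  sum-δ {suc m} zero    α = trans (+-congˡ (sum-replicate-zero m)) (+-identityʳ α)
  sum-δ {suc m} (suc i) α = trans (+-identityˡ _)
    (trans (sum-cong (λ j → reflexive (δ-suc i j α))) (sum-δ i α))

-- Sums over lists

module ListSum {c ℓ₁ ℓ₂} (F : ArchimedeanField c ℓ₁ ℓ₂) where
  open ArchimedeanField F
  open OrderedField F
  open Algebra.Properties.CommutativeSemigroup +-commutativeSemigroup using (x∙yz≈y∙xz)
  open Algebra.Properties.Semiring.Sum semiring using (sum-permute)

  private
    variable
      A B : Set

  Σ[_] : (A → Carrier) → List A → Carrier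
  Σ[ f ] = foldr (λ a r → f a + r) 0#

  Σ-++ : ∀ (f : A → Carrier) xs ys → Σ[ f ] (xs ++ ys) ≈ Σ[ f ] xs + Σ[ f ] ys
  Σ-++ f []       ys = sym (+-identityˡ _)
  Σ-++ f (x ∷ xs) ys = trans (+-congˡ (Σ-++ f xs ys)) (sym (+-assoc _ _ _))

  Σ-cong : ∀ {f g : A → Carrier} {xs} → All (λ a → f a ≈ g a) xs → Σ[ f ] xs ≈ Σ[ g ] xs
  Σ-cong []       = refl
  Σ-cong (p ∷ ps) = +-cong p (Σ-cong ps)

  Σ-mono : ∀ {f g : A → Carrier} {xs} → All (λ a → f a ≤ g a) xs → Σ[ f ] xs ≤ Σ[ g ] xs
  Σ-mono []       = ≤-refl
  Σ-mono (p ∷ ps) = +-mono-≤ p (Σ-mono ps)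

  Σ-tabulate : ∀ {n} (f : A → Carrier) (g : Fin n → A) → Σ[ f ] (tabulate g) ≡ sum (f ∘ g)
  Σ-tabulate {n = zero}  f g = ≡.refl
  Σ-tabulate {n = suc n} f g = ≡.cong (f (g zero) +_) (Σ-tabulate f (g ∘ suc))

  Σ-permuted : ∀ {n} (σ : Permutation′ n) (f : Fin n → Carrier) →
               Σ[ f ] (map (σ ⟨$⟩ʳ_) (allFin n)) ≈ sum f
  Σ-permuted σ f = trans (reflexive (≡.trans (≡.cong Σ[ f ] (map-tabulate (λ i → i) (σ ⟨$⟩ʳ_)))
    (Σ-tabulate f (σ ⟨$⟩ʳ_)))) (sym (sum-permute f σ))

  Σ-filter : ∀ {p} {P : Pred A p} (P? : Decidable P) (f : A → Carrier) xs →
             Σ[ f ] xs ≈ Σ[ f ] (filter P? xs) + Σ[ f ] (filter (¬? ∘ P?) xs)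
  Σ-filter P? f []       = sym (+-identityˡ 0#)
  Σ-filter P? f (x ∷ xs) with P? x
  ... | yes _ = trans (+-congˡ (Σ-filter P? f xs)) (sym (+-assoc _ _ _))
  ... | no  _ = trans (+-congˡ (Σ-filter P? f xs)) (x∙yz≈y∙xz _ _ _)

  Σ-take-drop : ∀ (f : A → Carrier) m xs → Σ[ f ] xs ≈ Σ[ f ] (take m xs) + Σ[ f ] (drop m xs)
  Σ-take-drop f m xs = trans (reflexive (≡.cong Σ[ f ] (≡.sym (take++drop≡id m xs))))
      (Σ-++ f (take m xs) (drop m xs))

-- Values of linear forms

module LinearForms {c ℓ₁ ℓ₂} (F : ArchimedeanField c ℓ₁ ℓ₂) where
  open ArchimedeanField F
  open OrderedField F
  open ListSum F
  open LinearSystems F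
  open Algebra.Properties.Semiring.Sum semiring using
      (*-distribˡ-sum; ∑-distrib-+; sum-replicate-zero)
  open Algebra.Properties.CommutativeSemigroup *-commutativeSemigroup using (x∙yz≈y∙xz)
  open Algebra.Properties.Ring ring using (-1*x≈-x)

  evaluate-map : ∀ {A V : Set} (x : V → Carrier) (α : A → Carrier) (v : A → V) as →
                 evaluate x (map (λ a → α a , v a) as) ≡ Σ[ (λ a → α a * x (v a)) ] as
  evaluate-map x α v []       = ≡.refl
  evaluate-map x α v (a ∷ as) = ≡.cong (α a * x (v a) +_) (evaluate-map x α v as)

  evaluate-allFin : ∀ {m} {V : Set} (x : V → Carrier) (α : Fin m → Carrier) (v : Fin m → V) →
                    evaluate x (map (λ i → α i , v i) (allFin m)) ≡ sum (λ i → α i * x (v i))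
  evaluate-allFin {m} x α v =
      ≡.trans (evaluate-map x α v (allFin m)) (Σ-tabulate (λ i → α i * x (v i)) id)

  evaluate-rename : ∀ {V W : Set} (x : W → Carrier) (g : V → W) ts →
                    evaluate x (map (map₂ g) ts) ≡ evaluate (x ∘ g) ts
  evaluate-rename x g []             = ≡.refl
  evaluate-rename x g ((α , v) ∷ ts) = ≡.cong (α * x (g v) +_) (evaluate-rename x g ts)

  evaluate-scale : ∀ {V : Set} α (y : V → Carrier) ts →
      evaluate (λ v → α * y v) ts ≈ α * evaluate y ts
  evaluate-scale α y []             = sym (zeroʳ α)
  evaluate-scale α y ((β , v) ∷ ts) =
    trans (+-cong (x∙yz≈y∙xz β α (y v)) (evaluate-scale α y ts)) (sym (distribˡ α _ _))

  evaluate-sum : ∀ {V : Set} {m} (α : Fin m → Carrier) (y : Fin m → V → Carrier) ts →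
                 evaluate (λ v → sum (λ r → α r * y r v)) ts ≈ sum (λ r → α r * evaluate (y r) ts)
  evaluate-sum {m = m} α y [] = sym (trans (sum-cong (λ r → zeroʳ (α r))) (sum-replicate-zero m))
  evaluate-sum α y ((β , v) ∷ ts) = sym (trans
    (sum-cong (λ r → trans (distribˡ (α r) _ _) (+-congʳ (x∙yz≈y∙xz (α r) β (y r v)))))
    (trans (∑-distrib-+ (λ r → β * (α r * y r v)) (λ r → α r * evaluate (y r) ts))
      (+-cong (sym (*-distribˡ-sum β (λ r → α r * y r v))) (sym (evaluate-sum α y ts)))))

  evaluate-single : ∀ {V : Set} (x : V → Carrier) v → evaluate x ((1# , v) ∷ []) ≈ x v
  evaluate-single x v = trans (+-identityʳ _) (*-identityˡ _)

  evaluate-negated : ∀ {V : Set} (x : V → Carrier) v → evaluate x ((- 1# , v) ∷ []) ≈ - x v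
  evaluate-negated x v = trans (+-identityʳ _) (-1*x≈-x _)

  evaluate-difference : ∀ {V : Set} (x : V → Carrier) u v →
      evaluate x ((1# , u) ∷ (- 1# , v) ∷ []) ≈ x u - x v
  evaluate-difference x u v = +-cong (*-identityˡ _) (evaluate-negated x v)

  ConvexHull-mono : ∀ {V : Set} {p q} {P : Pred (V → Carrier) p} {Q : Pred (V → Carrier) q} →
                    (∀ {y} → P y → Q y) → ∀ x → ConvexHull P x → ConvexHull Q x
  ConvexHull-mono P⊆Q x (m , y , μ , y∈P , rest) = m , y , μ , (λ r → P⊆Q (y∈P r)) , rest

-- Filters and prefixes of lists

module _ {A : Set} where

  filter-filter-⊆ : ∀ {p q} {P : Pred A p} {Q : Pred A q} (P? : Decidable P) (Q? : Decidable Q) →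
                    (∀ {x} → Q x → P x) → ∀ xs → filter Q? (filter P? xs) ≡ filter Q? xs
  filter-filter-⊆ P? Q? Q⊆P []       = ≡.refl
  filter-filter-⊆ P? Q? Q⊆P (x ∷ xs) with P? x
  ... | yes _ with Q? x
  ...   | yes _ = ≡.cong (x ∷_) (filter-filter-⊆ P? Q? Q⊆P xs)
  ...   | no  _ = filter-filter-⊆ P? Q? Q⊆P xs
  filter-filter-⊆ P? Q? Q⊆P (x ∷ xs) | no ¬Px =
    ≡.trans (filter-filter-⊆ P? Q? Q⊆P xs) (≡.sym (filter-reject Q? (¬Px ∘ Q⊆P)))

  length-filter-mono : ∀ {p q} {P : Pred A p} {Q : Pred A q} (P? : Decidable P) (Q? : Decidable Q) →
                       (∀ {x} → P x → Q x) → ∀ xs → length (filter P? xs) ℕ.≤ length (filter Q? xs)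
  length-filter-mono P? Q? P⊆Q []       = z≤n
  length-filter-mono P? Q? P⊆Q (x ∷ xs) with P? x | Q? x
  ... | yes _  | yes _  = s≤s (length-filter-mono P? Q? P⊆Q xs)
  ... | yes Px | no ¬Qx = ⊥-elim (¬Qx (P⊆Q Px))
  ... | no  _  | yes _  = ℕ.m≤n⇒m≤1+n (length-filter-mono P? Q? P⊆Q xs)
  ... | no  _  | no  _  = length-filter-mono P? Q? P⊆Q xs

  ∈-take-mono : ∀ {m o} {x : A} → m ℕ.≤ o → ∀ xs → x ∈ take m xs → x ∈ take o xs
  ∈-take-mono {suc m} {suc o} (s≤s m≤o) (x ∷ xs) (here eq)  = here eq
  ∈-take-mono {suc m} {suc o} (s≤s m≤o) (x ∷ xs) (there x∈) = there (∈-take-mono m≤o xs x∈)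

  Unique⇒drop∉take : ∀ m {xs : List A} {x} → Unique xs → x ∈ drop m xs → x ∉ take m xs
  Unique⇒drop∉take (suc m) {y ∷ xs} (y∉ ∷ u) x∈ (here ≡.refl) =
      All.lookup (All.drop⁺ m y∉) x∈ ≡.refl
  Unique⇒drop∉take (suc m) {y ∷ xs} (_ ∷ u)  x∈ (there x∈′)   = Unique⇒drop∉take m u x∈ x∈′

-- Exchange arguments for sorted lists and partitions

module Rearrangement {c ℓ₁ ℓ₂} (F : ArchimedeanField c ℓ₁ ℓ₂) where
  open ArchimedeanField F
  open OrderedField F
  open ListSum F

  private
    variable
      A B : Set

  -- Moving the prefix by one position replaces each entry by its successor in the sorted list,
  -- which is at least as heavy; the length condition keeps both prefixes at m entries.
  Σ-take-shift : ∀ (w : A → Carrier) {x xs} m → AllPairs (λ a b → w a ≤ w b) (x ∷ xs) →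
                 m ℕ.≤ length xs → Σ[ w ] (take m (x ∷ xs)) ≤ Σ[ w ] (take m xs)
  Σ-take-shift w zero _ _ = ≤-refl
  Σ-take-shift w {xs = y ∷ ys} (suc m) ((x≤y ∷ _) ∷ sorted) (s≤s m≤) =
    +-mono-≤ x≤y (Σ-take-shift w m sorted m≤)

  -- A selected head occurs on both sides. Past an unselected head the prefix is shifted at no lower
  -- weight, and the tail has room for it because it holds all selected entries.
  Σ-take≤Σ-filter : ∀ (w : A → Carrier) {p} {P : Pred A p} (P? : Decidable P) {xs} →
                    AllPairs (λ a b → w a ≤ w b) xs →
                    Σ[ w ] (take (length (filter P? xs)) xs) ≤ Σ[ w ] (filter P? xs)
  Σ-take≤Σ-filter w P? {[]} [] = ≤-refl
  Σ-take≤Σ-filter w P? {x ∷ xs} sorted with P? x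
  ... | yes _ = +-monoʳ-≤ _ (Σ-take≤Σ-filter w P? (AllPairs.tail sorted))
  ... | no  _ = ≤-trans (Σ-take-shift w _ sorted (length-filter P? xs))
                        (Σ-take≤Σ-filter w P? (AllPairs.tail sorted))

  Σ-indicator : ∀ (w x : A → Carrier) xs → All (λ a → x a ≈ 0# ⊎ x a ≈ 1#) xs →
                Σ[ (λ a → w a * x a) ] xs ≈ Σ[ w ] (filter (λ a → x a ≟ 1#) xs)
  Σ-indicator w x []       []           = refl
  Σ-indicator w x (a ∷ xs) (bin ∷ bins) with x a ≟ 1#
  ... | yes xa≈1 = +-cong (trans (*-congˡ xa≈1) (*-identityʳ (w a))) (Σ-indicator w x xs bins)
  Σ-indicator w x (a ∷ xs) (inj₂ xa≈1 ∷ bins) | no xa≉1 = ⊥-elim (xa≉1 xa≈1)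
  Σ-indicator w x (a ∷ xs) (inj₁ xa≈0 ∷ bins) | no xa≉1 =
    trans (+-cong (trans (*-congˡ xa≈0) (zeroʳ (w a))) (Σ-indicator w x xs bins)) (+-identityˡ _)

  Σ-ones : ∀ (w : A → Carrier) {x : A → Carrier} {xs} → All (λ a → x a ≈ 1#) xs →
           Σ[ (λ a → w a * x a) ] xs ≈ Σ[ w ] xs
  Σ-ones w = Σ-cong ∘ All.map (λ xa≈1 → trans (*-congˡ xa≈1) (*-identityʳ _))

  Σ-zeros : ∀ (w : A → Carrier) {x : A → Carrier} {xs} → All (λ a → x a ≈ 0#) xs →
            Σ[ (λ a → w a * x a) ] xs ≈ 0#
  Σ-zeros w []           = refl
  Σ-zeros w (xa≈0 ∷ x≈0) =
      trans (+-cong (trans (*-congˡ xa≈0) (zeroʳ _)) (Σ-zeros w x≈0)) (+-identityˡ 0#)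

  Σ-const : ∀ {w : A → Carrier} {v} xs ys → All (λ a → w a ≈ v) xs → All (λ a → w a ≈ v) ys →
            length xs ≡ length ys → Σ[ w ] xs ≈ Σ[ w ] ys
  Σ-const []       []       []        []        _  = refl
  Σ-const (x ∷ xs) (y ∷ ys) (px ∷ pxs) (py ∷ pys) eq =
    +-cong (trans px (sym py)) (Σ-const xs ys pxs pys (ℕ.suc-injective eq))

  -- Classes are split off one at a time. By disjointness, removing the members of `b` leaves the
  -- filters of the other classes as they were; what remains after the last class is compared entry
  -- by entry.
  Σ-mono-classes : ∀ {q} {Q : B → Pred A q} (Q? : ∀ b → Decidable (Q b)) →
                   (∀ {b b′ a} → Q b a → Q b′ a → b ≡ b′) →
                   ∀ {f g : A → Carrier} {bs} → Unique bs → ∀ xs →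
                   All (λ b → Σ[ f ] (filter (Q? b) xs) ≤ Σ[ g ] (filter (Q? b) xs)) bs →
                   All (λ a → (∀ b → b ∈ bs → ¬ Q b a) → f a ≤ g a) xs →
                   Σ[ f ] xs ≤ Σ[ g ] xs
  Σ-mono-classes Q? disjoint [] xs [] rest = Σ-mono (All.map (λ f≤g → f≤g (λ _ ())) rest)
  Σ-mono-classes {Q = Q} Q? disjoint {f} {g} {b ∷ bs} (b∉bs ∷ unique) xs (le ∷ les) rest =
    ≤-respˡ (sym (Σ-filter (Q? b) f xs)) (≤-respʳ (sym (Σ-filter (Q? b) g xs)) (+-mono-≤ le
      (Σ-mono-classes Q? disjoint unique others
        (All.zipWith (λ (b≢b′ , le′) → restrict b≢b′ le′) (b∉bs , les))
        (All.tabulate rest′))))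
    where
    others = filter (¬? ∘ Q? b) xs

    restrict : ∀ {b′} → b ≢ b′ → Σ[ f ] (filter (Q? b′) xs) ≤ Σ[ g ] (filter (Q? b′) xs) →
               Σ[ f ] (filter (Q? b′) others) ≤ Σ[ g ] (filter (Q? b′) others)
    restrict {b′} b≢b′ = ≡.subst (λ zs → Σ[ f ] zs ≤ Σ[ g ] zs)
      (≡.sym (filter-filter-⊆ (¬? ∘ Q? b) (Q? b′) (λ Qb′ Qb → b≢b′ (disjoint Qb Qb′)) xs))

    rest′ : ∀ {a} → a ∈ others → (∀ b′ → b′ ∈ bs → ¬ Q b′ a) → f a ≤ g a
    rest′ a∈ ∉bs with ∈-filter⁻ (¬? ∘ Q? b) a∈
    ... | a∈xs , ¬Qb = All.lookup rest a∈xs λ where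
      _ (here ≡.refl) → ¬Qb
      b′ (there b′∈) → ∉bs b′ b′∈

-- Replacing the packed items of a class by a prefix of the class

module Compression {c ℓ₁ ℓ₂} (F : ArchimedeanField c ℓ₁ ℓ₂)
  {n κ : ℕ} {InClass : Fin κ → Fin n → Set ℓ₁} (inClass? : ∀ k i → Dec (InClass k i))
  (InClass-unique : ∀ {k k′ i} → InClass k i → InClass k′ i → k ≡ k′) (σ : Permutation′ n) where

  open ArchimedeanField F
  open OrderedField F
  open ListSum F
  open Rearrangement F
  open import Data.List.Membership.DecPropositional (Fin._≟_ {n}) using (_∈?_)

  items : List (Fin n)
  items = map (σ ⟨$⟩ʳ_) (allFin n)

  members : Fin κ → List (Fin n)
  members k = filter (inClass? k) items

  ∈-items : ∀ i → i ∈ items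
  ∈-items i = ≡.subst (_∈ items) (inverseʳ σ) (∈-map⁺ (σ ⟨$⟩ʳ_) (∈-allFin (σ ⟨$⟩ˡ i)))

  ∈-members : ∀ {k i} → InClass k i → i ∈ members k
  ∈-members {k} {i} = ∈-filter⁺ (inClass? k) (∈-items i)

  ∈-members⁻ : ∀ {k i} → i ∈ members k → InClass k i
  ∈-members⁻ {k} = proj₂ ∘ ∈-filter⁻ (inClass? k) {xs = items}

  members-unique : ∀ k → Unique (members k)
  members-unique k = Unique.filter⁺ (inClass? k) (Unique.map⁺ σ-injective (Unique.allFin⁺ n))
    where
    σ-injective : ∀ {r s} → σ ⟨$⟩ʳ r ≡ σ ⟨$⟩ʳ s → r ≡ s
    σ-injective eq = ≡.trans (≡.sym (inverseˡ σ))
      (≡.trans (≡.cong (σ ⟨$⟩ˡ_) eq) (inverseˡ σ))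

  Packing : Set c
  Packing = Fin n → Carrier

  BinaryPacking : Packing → Set ℓ₁
  BinaryPacking y = ∀ i → y i ≈ 0# ⊎ y i ≈ 1#

  indicator : ∀ {p} {P : Set p} → Dec P → Carrier
  indicator (yes _) = 1#
  indicator (no _)  = 0#

  packed? : (y : Packing) → ∀ i → Dec (y i ≈ 1#)
  packed? y i = y i ≟ 1#

  count : Packing → Fin κ → ℕ
  count y k = length (filter (packed? y) (members k))

  count-mono : ∀ {y z} → BinaryPacking z → (∀ i → y i ≤ z i) → ∀ k → count y k ℕ.≤ count z k
  count-mono {y} {z} binary y≤z k = length-filter-mono (packed? y) (packed? z) keep (members k)
    where
    keep : ∀ {i} → y i ≈ 1# → z i ≈ 1#
    keep {i} yi≈1 with binary i
    ... | inj₁ zi≈0 = ⊥-elim (<⇒≱ 0<1 (≤-respˡ yi≈1 (≤-respʳ zi≈0 (y≤z i))))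
    ... | inj₂ zi≈1 = zi≈1

  count≤length : ∀ y k → count y k ℕ.≤ length (members k)
  count≤length y k = length-filter (packed? y) (members k)

  count>0 : ∀ y {k i} → InClass k i → y i ≈ 1# → 0 ℕ.< count y k
  count>0 y i∈k yi≈1 = filter-some (packed? y) (lose (∈-members i∈k) yi≈1)

  -- Only the number packed from each class is kept: items of equal profit are interchangeable, and
  -- the prefix is the lightest choice once `members` is sorted by weight. Items in no class keep
  -- their value.
  compress : Packing → Packing
  compress y i with Fin.any? (λ k → inClass? k i)
  ... | no _        = y i
  ... | yes (k , _) = indicator (i ∈? take (count y k) (members k))

  compress-class : ∀ (y : Packing) {k i} → InClass k i →
                   compress y i ≡ indicator (i ∈? take (count y k) (members k))
  compress-class y {k} {i} i∈k with Fin.any? (λ k → inClass? k i)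
  ... | no ¬any = ⊥-elim (¬any (k , i∈k))
  ... | yes (k′ , i∈k′) rewrite InClass-unique i∈k i∈k′ = ≡.refl

  compress-take : ∀ y {k i} → i ∈ take (count y k) (members k) → compress y i ≈ 1#
  compress-take y {k} {i} i∈ = trans (reflexive (compress-class y (∈-members⁻ (∈-take⁻ i∈)))) is-one
    where
    ∈-take⁻ : i ∈ take (count y k) (members k) → i ∈ members k
    ∈-take⁻ = ≡.subst (i ∈_) (take++drop≡id (count y k) (members k)) ∘ ∈-++⁺ˡ

    is-one : indicator (i ∈? take (count y k) (members k)) ≈ 1#
    is-one with i ∈? take (count y k) (members k)
    ... | yes _ = refl
    ... | no i∉ = ⊥-elim (i∉ i∈)

  compress-drop : ∀ y {k i} → i ∈ drop (count y k) (members k) → compress y i ≈ 0#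
  compress-drop y {k} {i} i∈ =
      trans (reflexive (compress-class y (∈-members⁻ (∈-drop⁻ i∈)))) is-zero
    where
    ∈-drop⁻ : i ∈ drop (count y k) (members k) → i ∈ members k
    ∈-drop⁻ = ≡.subst (i ∈_) (take++drop≡id (count y k) (members k)) ∘ ∈-++⁺ʳ
        (take (count y k) (members k))

    is-zero : indicator (i ∈? take (count y k) (members k)) ≈ 0#
    is-zero with i ∈? take (count y k) (members k)
    ... | yes i∈take = ⊥-elim (Unique⇒drop∉take (count y k) (members-unique k) i∈ i∈take)
    ... | no  _      = refl

  compress-binary : ∀ {y} → BinaryPacking y → BinaryPacking (compress y)
  compress-binary {y} binary i with Fin.any? (λ k → inClass? k i)
  ... | no _ = binary i
  ... | yes (k , _) with i ∈? take (count y k) (members k)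
  ...   | yes _ = inj₂ refl
  ...   | no  _ = inj₁ refl

  -- A larger packing has larger counts, so the prefixes are nested. This carries the chain
  -- condition over to compressed packings.
  compress-mono : ∀ {y z} → BinaryPacking z → (∀ i → y i ≤ z i) → ∀ i → compress y i ≤ compress z i
  compress-mono {y} {z} binary y≤z i with Fin.any? (λ k → inClass? k i)
  ... | no _ = y≤z i
  ... | yes (k , _) with i ∈? take (count y k) (members k) | i ∈? take (count z k) (members k)
  ...   | yes _  | yes _ = ≤-refl
  ...   | yes i∈ | no i∉ = ⊥-elim (i∉ (∈-take-mono (count-mono binary y≤z k) (members k) i∈))
  ...   | no _   | yes _ = 0≤1
  ...   | no _   | no _  = ≤-refl

  compress-other : ∀ y {i} → (∀ k → ¬ InClass k i) → compress y i ≡ y i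
  compress-other y {i} ¬any with Fin.any? (λ k → inClass? k i)
  ... | no _          = ≡.refl
  ... | yes (k , i∈k) = ⊥-elim (¬any k i∈k)

  Σ-class-compress : ∀ (w y : Packing) k →
                     Σ[ (λ i → w i * compress y i) ] (members k) ≈ Σ[ w ]
                         (take (count y k) (members k))
  Σ-class-compress w y k = trans (Σ-take-drop _ (count y k) (members k))
    (trans (+-cong (Σ-ones w (All.tabulate (compress-take y)))
        (Σ-zeros w (All.tabulate (compress-drop y))))
      (+-identityʳ _))

  Σ-class : ∀ (w : Packing) {y} → BinaryPacking y → ∀ k →
            Σ[ (λ i → w i * y i) ] (members k) ≈ Σ[ w ] (filter (packed? y) (members k))
  Σ-class w {y} binary k = Σ-indicator w y (members k) (All.tabulate (λ {i} _ → binary i))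

  sum-mono-classes : ∀ {f g : Packing} →
                     (∀ k → Σ[ f ] (members k) ≤ Σ[ g ] (members k)) →
                     (∀ {i} → (∀ k → ¬ InClass k i) → f i ≤ g i) → sum f ≤ sum g
  sum-mono-classes {f} {g} onClasses onOthers = ≤-respˡ (Σ-permuted σ f) (≤-respʳ (Σ-permuted σ g)
    (Σ-mono-classes inClass? InClass-unique (Unique.allFin⁺ κ) items
      (All.tabulate (λ {k} _ → onClasses k))
      (All.tabulate (λ _ notIn → onOthers (λ k → notIn k (∈-allFin k))))))

  module _ {w : Packing} where

    -- In each class the prefix is the lightest set of its size; outside the classes nothing
    -- changes.
    weight-compress : (∀ k → AllPairs (λ i j → w i ≤ w j) (members k)) → ∀ {y} → BinaryPacking y →
                      sum (λ i → w i * compress y i) ≤ sum (λ i → w i * y i)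
    weight-compress sorted {y} binary = sum-mono-classes
      (λ k → ≤-respˡ (sym (Σ-class-compress w y k)) (≤-respʳ (sym (Σ-class w binary k))
        (Σ-take≤Σ-filter w (packed? y) (sorted k))))
      (λ ¬any → ≤-reflexive (*-congˡ (reflexive (compress-other y ¬any))))

    -- In a class with a single profit `v` both sides are the same number of copies of `v`.
    profit-compress : (∀ k → ∃ λ v → ∀ {i} → InClass k i → w i ≈ v) → ∀ {y} → BinaryPacking y →
                      sum (λ i → w i * y i) ≤ sum (λ i → w i * compress y i)
    profit-compress value {y} binary = sum-mono-classes
      (λ k → ≤-reflexive (trans (Σ-class w binary k)
          (trans (same k) (sym (Σ-class-compress w y k)))))
      (λ ¬any → ≤-reflexive (*-congˡ (reflexive (≡.sym (compress-other y ¬any)))))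
      where
      same : ∀ k → Σ[ w ] (filter (packed? y) (members k)) ≈ Σ[ w ] (take (count y k) (members k))
      same k = Σ-const _ _
        (All.filter⁺ (packed? y) constant)
        (All.take⁺ (count y k) constant)
        -- The prefix really has `count y k` entries, because the class has at least that many
        -- members.
        (≡.sym (≡.trans (length-take (count y k) (members k)) (ℕ.m≤n⇒m⊓n≡m (count≤length y k))))
        where
        constant : All (λ i → w i ≈ proj₁ (value k)) (members k)
        constant = All.tabulate (proj₂ (value k) ∘ ∈-members⁻)

-- Segments between significant times

record SegmentEnd {p} {T : ℕ} (Sig : Pred (Fin T) p) (t : Fin T) : Set p where
  constructor segmentEnd
  field
    end      : Fin T
    t≤end    : t Fin.≤ end
    constant : ∀ v → t Fin.< v → v Fin.≤ end → ¬ Sig v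
    maximal  : ∀ v → toℕ v ≡ suc (toℕ end) → Sig v

private
  shift : ∀ {p T} {Sig : Pred (Fin (suc T)) p} {t} → SegmentEnd (Sig ∘ suc) t →
      SegmentEnd Sig (suc t)
  shift {Sig = Sig} {t} (segmentEnd u t≤u constant maximal) = segmentEnd (suc u) (s≤s t≤u)
    (λ { (suc v) (s≤s t<v) (s≤s v≤u) → constant v t<v v≤u })
    (λ { (suc v) eq → maximal v (ℕ.suc-injective eq) })

  segmentFromZero : ∀ {p T} {Sig : Pred (Fin (suc (suc T))) p} → Dec (Sig (suc zero)) →
                    SegmentEnd (Sig ∘ suc) zero → SegmentEnd Sig zero
  segmentFromZero (yes sig) _ =
    segmentEnd zero z≤n (λ { zero () _ ; (suc v) _ () }) λ { (suc zero) _ → sig }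
  segmentFromZero (no ¬sig) (segmentEnd u _ constant maximal) = segmentEnd (suc u) z≤n
    (λ { (suc zero) _ _ → ¬sig ; (suc (suc v)) _ (s≤s v≤u) → constant (suc v) (s≤s z≤n) v≤u })
    (λ { (suc v) eq → maximal v (ℕ.suc-injective eq) })

findSegmentEnd : ∀ {p T} {Sig : Pred (Fin T) p} → Decidable Sig → ∀ t → SegmentEnd Sig t
findSegmentEnd {T = suc T}       Sig? (suc t) = shift (findSegmentEnd (Sig? ∘ suc) t)
findSegmentEnd {T = suc zero}    Sig? zero    =
    segmentEnd zero z≤n (λ { zero () _ }) (λ { zero () })
findSegmentEnd {T = suc (suc T)} Sig? zero    =
  segmentFromZero (Sig? (suc zero)) (findSegmentEnd {T = suc T} (Sig? ∘ suc) zero)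

module Segments {p} {T : ℕ} {Sig : Pred (Fin T) p} (Sig? : Decidable Sig) where
  open SegmentEnd

  segEnd : Fin T → Fin T
  segEnd t = end (findSegmentEnd Sig? t)

  segEnd-≤ : ∀ t → t Fin.≤ segEnd t
  segEnd-≤ t = t≤end (findSegmentEnd Sig? t)

  segEnd-constant : ∀ t v → t Fin.< v → v Fin.≤ segEnd t → ¬ Sig v
  segEnd-constant t = constant (findSegmentEnd Sig? t)

  -- If the segment of `u` ended earlier, the time after its end would be significant by `maximal`
  -- and would lie inside the segment of `t`.
  segEnd-mono : ∀ {t u} → t Fin.≤ u → segEnd t Fin.≤ segEnd u
  segEnd-mono {t} {u} t≤u with segEnd t Fin.≤? segEnd u
  ... | yes le = le
  ... | no  ≰ = ⊥-elim (segEnd-constant t v t<v v≤ (maximal (findSegmentEnd Sig? u) v v≡))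
    where
    gt : toℕ (segEnd u) ℕ.< toℕ (segEnd t)
    gt = ℕ.≰⇒> ≰

    v : Fin T
    v = Fin.fromℕ< (ℕ.≤-<-trans gt (Fin.toℕ<n (segEnd t)))

    v≡ : toℕ v ≡ suc (toℕ (segEnd u))
    v≡ = Fin.toℕ-fromℕ< _

    t<v : t Fin.< v
    t<v = ≡.subst (toℕ t ℕ.<_) (≡.sym v≡) (s≤s (ℕ.≤-trans t≤u (segEnd-≤ u)))

    v≤ : v Fin.≤ segEnd t
    v≤ = ≡.subst (ℕ._≤ toℕ (segEnd t)) (≡.sym v≡) gt

  -- Only a significant time starts a new segment. If the segment of `u` reached further, the time
  -- `v` after the end of that of `t` would be significant, and `v` is either inside the segment of
  -- `u` or `u` itself.
  segEnd-insignificant : ∀ {t u} → toℕ u ≡ suc (toℕ t) → ¬ Sig u → segEnd u ≡ segEnd t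
  segEnd-insignificant {t} {u} u≡ ¬sig = Fin.toℕ-injective (ℕ.≤-antisym upper (segEnd-mono t≤u))
    where
    t≤u : t Fin.≤ u
    t≤u = ℕ.≤-trans (ℕ.n≤1+n _) (ℕ.≤-reflexive (≡.sym u≡))

    upper : segEnd u Fin.≤ segEnd t
    upper with segEnd u Fin.≤? segEnd t
    ... | yes le = le
    ... | no ≰ = ⊥-elim contradiction
      where
      gt : toℕ (segEnd t) ℕ.< toℕ (segEnd u)
      gt = ℕ.≰⇒> ≰

      v : Fin T
      v = Fin.fromℕ< (ℕ.≤-<-trans gt (Fin.toℕ<n (segEnd u)))

      v≡ : toℕ v ≡ suc (toℕ (segEnd t))
      v≡ = Fin.toℕ-fromℕ< _

      sigv : Sig v
      sigv = maximal (findSegmentEnd Sig? t) v v≡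

      contradiction : ⊥
      contradiction with toℕ t ℕ.<? toℕ (segEnd t)
      ... | yes t< = segEnd-constant u v
          (≡.subst₂ ℕ._<_ (≡.sym u≡) (≡.sym v≡) (s≤s t<))
          (≡.subst (ℕ._≤ toℕ (segEnd u)) (≡.sym v≡) gt) sigv
      -- Here `t` is the end of its own segment, so `v` is `u`.
      ... | no t≮ = ¬sig (≡.subst Sig (Fin.toℕ-injective (≡.trans v≡
          (≡.trans (≡.cong suc (ℕ.≤-antisym (ℕ.≮⇒≥ t≮) (segEnd-≤ t))) (≡.sym u≡)))) sigv)

  segEnd-last : ∀ {t} → suc (toℕ t) ≡ T → segEnd t ≡ t
  segEnd-last {t} last = Fin.toℕ-injective (ℕ.≤-antisym
    (ℕ.≤-pred (≡.subst (toℕ (segEnd t) ℕ.<_) (≡.sym last) (Fin.toℕ<n (segEnd t)))) (segEnd-≤ t))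

firstPositive : ∀ {m} (f : Fin m → ℕ) →
                (∀ k → f k ≡ 0) ⊎ ∃ λ k → 1 ℕ.≤ f k × (∀ j → j Fin.< k → f j ≡ 0)
firstPositive {zero}  f = inj₁ λ ()
firstPositive {suc m} f with f zero in eq
... | suc _ = inj₂ (zero , ≡.subst (1 ℕ.≤_) (≡.sym eq) (s≤s z≤n) , λ _ ())
... | zero with firstPositive (f ∘ suc)
...   | inj₁ f≡0 = inj₁ λ where
  zero    → eq
  (suc k) → f≡0 k
...   | inj₂ (k , 1≤ , below) = inj₂ (suc k , 1≤ , λ where
  zero    _         → eq
  (suc j) (s≤s j<k) → below j j<k)

-- Recording when the best packed class improves

module Tracking {p} {T κ : ℕ} {Sig : Pred (Fin T) p} (Sig? : Decidable Sig)
  (count : Fin T → Fin κ → ℕ)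
  (count-insignificant : ∀ u → ¬ Sig u → ∀ k → 1 ℕ.≤ count u k →
                         ∃ λ t → toℕ t ℕ.< toℕ u × 1 ℕ.≤ count t k) where

  Steps : Set
  Steps = List (Fin T × Fin κ)

  nextClass : Steps → ℕ
  nextClass []            = κ
  nextClass ((_ , k) ∷ _) = toℕ k

  -- With `τ` the time tₕ and `v` the class kₕ₊₁, this is what makes the rows of `early` for block h
  -- hold; after the last entry of S, `κ` takes the place of kₛ₊₁.
  Empty : ℕ → ℕ → Set
  Empty τ v = ∀ u → toℕ u ℕ.< τ → ∀ k → toℕ k ℕ.< v → count u k ≡ 0

  -- S lists, latest first, the times before τ at which the least class with
  -- a positive count drops, each with the class it drops to.
  data Tracks (τ : ℕ) : Steps → Set p where
    []  : Empty τ κ → Tracks τ []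
    cons : ∀ {t k S} → toℕ t ℕ.< τ → Sig t → 1 ℕ.≤ count t k → Empty τ (toℕ k) →
           toℕ k ℕ.< nextClass S → Tracks (toℕ t) S → Tracks τ ((t , k) ∷ S)

  Tracks⇒Empty : ∀ {τ S} → Tracks τ S → Empty τ (nextClass S)
  Tracks⇒Empty ([] empty)             = empty
  Tracks⇒Empty (cons _ _ _ empty _ _) = empty

  extendEmpty : ∀ {t : Fin T} {v} → Empty (toℕ t) v → (∀ k → toℕ k ℕ.< v → count t k ≡ 0) →
                Empty (suc (toℕ t)) v
  extendEmpty {t} empty now u (s≤s u≤t) k k<v with ℕ.m≤n⇒m<n∨m≡n u≤t
  ... | inj₁ u<t = empty u u<t k k<v
  ... | inj₂ u≡t with Fin.toℕ-injective u≡t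
  ...   | ≡.refl = now k k<v

  extend : ∀ {t : Fin T} {S} → Tracks (toℕ t) S → (∀ k → toℕ k ℕ.< nextClass S → count t k ≡ 0) →
           Tracks (suc (toℕ t)) S
  extend ([] empty) now = [] (extendEmpty empty now)
  extend (cons u<t sig pos empty k< tracks) now =
    cons (ℕ.m<n⇒m<1+n u<t) sig pos (extendEmpty empty now) k< tracks

  -- A new entry arises only when the least positive class at `t` undercuts `nextClass S`; otherwise
  -- the emptiness known so far extends to `t`.
  step : ∀ (t : Fin T) {S} → Tracks (toℕ t) S → ∃ (Tracks (suc (toℕ t)))
  step t {S} tracks with firstPositive (count t)
  ... | inj₁ zeros = S , extend tracks (λ k _ → zeros k)
  ... | inj₂ (k , pos , below) with toℕ k ℕ.<? nextClass S
  ...   | no k≮ = S , extend tracks (λ j j< → below j (ℕ.<-≤-trans j< (ℕ.≮⇒≥ k≮)))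
  ...   | yes k< = (t , k) ∷ S , cons (ℕ.n<1+n _) sig pos
            (extendEmpty (λ u u<t j j<k → Tracks⇒Empty tracks u u<t j (ℕ.<-trans j<k k<)) below)
                k< tracks
    where
    sig : Sig t
    sig with Sig? t
    ... | yes sig = sig
    -- At an insignificant time class `k` would already be positive earlier, although nothing below
    -- `nextClass S` is.
    ... | no ¬sig with count-insignificant t ¬sig k pos
    ...   | u , u<t , pos′ = ⊥-elim (ℕ.n≮0 (≡.subst (1 ℕ.≤_) (Tracks⇒Empty tracks u u<t k k<) pos′))

  track : ∀ τ → τ ℕ.≤ T → ∃ (Tracks τ)
  track zero    _   = [] , [] (λ _ ())
  track (suc τ) τ<T with track τ (ℕ.<⇒≤ τ<T)
  ... | S , tracks = ≡.subst (λ t → ∃ (Tracks (suc t))) (Fin.toℕ-fromℕ< τ<T)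
    (step (Fin.fromℕ< τ<T) (≡.subst (λ t → Tracks t S) (≡.sym (Fin.toℕ-fromℕ< τ<T)) tracks))

-- Counting lists and estimating powers

module Counting where
  open import Data.Nat using (_+_; _*_; _^_)

  private
    variable
      A B C : Set

  -- Pigeonhole: since `x` does not recur in `xs`, deleting one occurrence of `x` from `ys` keeps
  -- the rest of `xs` covered.
  Unique-⊆⇒length-≤ : ∀ {a} {A : Set a} {xs ys : List A} → Unique xs → (∀ {x} → x ∈ xs → x ∈ ys) →
                      length xs ℕ.≤ length ys
  Unique-⊆⇒length-≤ [] _ = z≤n
  Unique-⊆⇒length-≤ {xs = x ∷ xs} {ys} (x∉xs ∷ unique) xs⊆ys with ∈-∃++ (xs⊆ys (here ≡.refl))
  ... | us , vs , ≡.refl = ≡.subst (suc (length xs) ℕ.≤_) lengths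
    (s≤s (Unique-⊆⇒length-≤ unique xs⊆us++vs))
    where
    xs⊆us++vs : ∀ {y} → y ∈ xs → y ∈ us ++ vs
    xs⊆us++vs y∈ with ∈-++⁻ us (xs⊆ys (there y∈))
    ... | inj₁ y∈us            = ∈-++⁺ˡ y∈us
    ... | inj₂ (here ≡.refl)   = ⊥-elim (All.lookup x∉xs y∈ ≡.refl)
    ... | inj₂ (there y∈vs)    = ∈-++⁺ʳ us y∈vs

    lengths : suc (length (us ++ vs)) ≡ length (us ++ x ∷ vs)
    lengths = ≡.trans (≡.cong suc (length-++ us)) (≡.trans (≡.sym (ℕ.+-suc (length us) (length vs)))
      (≡.sym (length-++ us)))

  length-concatMap-≤ : ∀ {a b} {A : Set a} {B : Set b} (f : A → List B) {m} xs →
      (∀ x → length (f x) ℕ.≤ m) →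
                       length (concatMap f xs) ℕ.≤ length xs * m
  length-concatMap-≤ f []       _  = z≤n
  length-concatMap-≤ f (x ∷ xs) ≤m = ≡.subst (ℕ._≤ _) (≡.sym (length-++ (f x)))
    (ℕ.+-mono-≤ (≤m x) (length-concatMap-≤ f xs ≤m))

  sum-map-≤ : ∀ {a} {A : Set a} (f : A → ℕ) {m} xs → (∀ {x} → x ∈ xs → f x ℕ.≤ m) →
      sumℕ (map f xs) ℕ.≤ length xs * m
  sum-map-≤ f []       _  = z≤n
  sum-map-≤ f (x ∷ xs) ≤m = ℕ.+-mono-≤ (≤m (here ≡.refl)) (sum-map-≤ f xs (≤m ∘ there))

  length-concatMap-sum : ∀ {a b} {A : Set a} {B : Set b} (f : A → List B) xs →
                         length (concatMap f xs) ≡ sumℕ (map (length ∘ f) xs)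
  length-concatMap-sum f []       = ≡.refl
  length-concatMap-sum f (x ∷ xs) =
      ≡.trans (length-++ (f x)) (≡.cong (length (f x) +_) (length-concatMap-sum f xs))

  length-cartesianProductWith : ∀ (f : A → B → C) xs ys →
                                length (cartesianProductWith f xs ys) ≡ length xs * length ys
  length-cartesianProductWith f []       ys = ≡.refl
  length-cartesianProductWith f (x ∷ xs) ys = ≡.trans (length-++ (map (f x) ys))
    (≡.cong₂ _+_ (length-map (f x) ys) (length-cartesianProductWith f xs ys))

  zip-proj : (xs : List (A × B)) → zip (map proj₁ xs) (map proj₂ xs) ≡ xs
  zip-proj []       = ≡.refl
  zip-proj (x ∷ xs) = ≡.cong (x ∷_) (zip-proj xs)

  sublists : List A → List (List A)
  sublists []       = [] ∷ []
  sublists (x ∷ xs) = map (x ∷_) (sublists xs) ++ sublists xs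

  length-sublists : (xs : List A) → length (sublists xs) ≡ 2 ^ length xs
  length-sublists []       = ≡.refl
  length-sublists (x ∷ xs) = ≡.trans (length-++ (map (x ∷_) (sublists xs)))
    (≡.cong₂ _+_ (≡.trans (length-map (x ∷_) (sublists xs)) (length-sublists xs))
      (≡.trans (length-sublists xs) (≡.sym (ℕ.+-identityʳ _))))

  []∈sublists : (xs : List A) → [] ∈ sublists xs
  []∈sublists []       = here ≡.refl
  []∈sublists (x ∷ xs) = ∈-++⁺ʳ (map (x ∷_) (sublists xs)) ([]∈sublists xs)

  -- A sorted list is determined by its set of entries, so 2^j lists suffice for j possible entries.
  -- If the head `y` occurs after `x` in `xs`, then `x` cannot occur in `ys`, as it would have to
  -- stand both before and after `y`.
  sorted∈sublists : ∀ {r} {R : Rel A r} → (∀ {x y} → R x y → ¬ R y x) → ∀ {xs ys} →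
                    AllPairs R xs → AllPairs R ys → (∀ {y} → y ∈ ys → y ∈ xs) → ys ∈ sublists xs
  sorted∈sublists asym {xs} {[]} _ _ _ = []∈sublists xs
  sorted∈sublists asym {[]} {y ∷ ys} _ _ ys⊆ with ys⊆ (here ≡.refl)
  ... | ()
  sorted∈sublists {R = R} asym {x ∷ xs} {y ∷ ys} (x<xs ∷ sxs) (y<ys ∷ sys) ys⊆
    with ys⊆ (here ≡.refl)
  ... | here ≡.refl = ∈-++⁺ˡ (∈-map⁺ (x ∷_) (sorted∈sublists asym sxs sys ys⊆xs))
    where
    ys⊆xs : ∀ {z} → z ∈ ys → z ∈ xs
    ys⊆xs z∈ with ys⊆ (there z∈)
    ... | here ≡.refl = ⊥-elim (asym (All.lookup y<ys z∈) (All.lookup y<ys z∈))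
    ... | there z∈xs  = z∈xs
  ... | there y∈xs = ∈-++⁺ʳ (map (x ∷_) (sublists xs)) (sorted∈sublists asym sxs (y<ys ∷ sys) ys⊆xs)
    where
    ys⊆xs : ∀ {z} → z ∈ y ∷ ys → z ∈ xs
    ys⊆xs (here ≡.refl) = y∈xs
    ys⊆xs (there z∈) with ys⊆ (there z∈)
    ... | here ≡.refl = ⊥-elim (asym (All.lookup x<xs y∈xs) (All.lookup y<ys z∈))
    ... | there z∈xs  = z∈xs

  choices : ∀ {m} → (Fin m → List A) → List (Vec A m)
  choices {m = zero}  opts = [] ∷ []
  choices {m = suc m} opts = cartesianProductWith _∷_ (opts zero) (choices (opts ∘ suc))

  ∈-choices : ∀ {m} (opts : Fin m → List A) (v : Vec A m) → (∀ i → Vec.lookup v i ∈ opts i) →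
      v ∈ choices opts
  ∈-choices opts []      _   = here ≡.refl
  ∈-choices opts (x ∷ v) ∈opts =
      ∈-cartesianProductWith⁺ _∷_ (∈opts zero) (∈-choices (opts ∘ suc) v (∈opts ∘ suc))

  -- A position outside `P` has at most one option and contributes a factor 1. The map `g` lets the
  -- recursion drop the first position while `P` stays fixed.
  length-choices-≤ : ∀ {m p r} {P : Pred B p} (P? : Decidable P) (g : Fin m → B)
                     (opts : Fin m → List A) →
                     (∀ i → length (opts i) ℕ.≤ r) → (∀ i → ¬ P (g i) → length (opts i) ℕ.≤ 1) →
                     length (choices opts) ℕ.≤ r ^ length (filter P? (tabulate g))
  length-choices-≤ {m = zero} P? g _ _ _ = ℕ.≤-refl
  length-choices-≤ {m = suc m} P? g opts ≤r ≤1
    rewrite length-cartesianProductWith Vec._∷_ (opts zero) (choices (opts ∘ suc)) with P? (g zero)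
  ... | yes _ = ℕ.*-mono-≤ (≤r zero)
      (length-choices-≤ P? (g ∘ suc) (opts ∘ suc) (≤r ∘ suc) (≤1 ∘ suc))
  ... | no ¬P = ℕ.≤-trans
      (ℕ.*-mono-≤ (≤1 zero ¬P) (length-choices-≤ P? (g ∘ suc) (opts ∘ suc) (≤r ∘ suc) (≤1 ∘ suc)))
                  (ℕ.≤-reflexive (ℕ.*-identityˡ _))

  length-filter-window : ∀ {m p} {P : Pred (Fin m) p} (P? : Decidable P) a w →
                         (∀ i → P i → a ℕ.≤ toℕ i × toℕ i ℕ.< a + w) →
                             length (filter P? (allFin m)) ℕ.≤ w
  length-filter-window {m} P? a w inWindow = ≡.subst₂ ℕ._≤_ (length-map toℕ (filter P? (allFin m)))
    (≡.trans (length-map (a +_) (upTo w)) (length-upTo w))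
    (Unique-⊆⇒length-≤ (Unique.map⁺ Fin.toℕ-injective (Unique.filter⁺ P? (Unique.allFin⁺ m))) into)
    where
    into : ∀ {j} → j ∈ map toℕ (filter P? (allFin m)) → j ∈ map (a +_) (upTo w)
    into j∈ with ∈-map⁻ toℕ j∈
    ... | i , i∈ , ≡.refl with inWindow i (proj₂ (∈-filter⁻ P? {xs = allFin m} i∈))
    ...   | a≤i , i<a+w = ≡.subst (_∈ map (a +_) (upTo w)) (ℕ.m+[n∸m]≡n a≤i)
      (∈-map⁺ (a +_) (∈-upTo⁺
          (ℕ.+-cancelˡ-< a _ _ (≡.subst (ℕ._< a + w) (≡.sym (ℕ.m+[n∸m]≡n a≤i)) i<a+w))))

  module _ {p} {P : Pred A p} (_≟_ : DecidableEquality A) (P? : Decidable P) (xs : List A) where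

    -- Turns a list of candidates that covers `P`, possibly with repetitions and strangers, into an
    -- exact enumeration that is no longer.
    select : List A
    select = deduplicate _≟_ (filter P? xs)

    select-unique : Unique select
    select-unique = deduplicate-! _≟_ (filter P? xs)

    ∈-select : (∀ x → P x → x ∈ xs) → ∀ x → x ∈ select ⇔ P x
    ∈-select complete x = mk⇔
      (λ x∈ → proj₂ (∈-filter⁻ P? {xs = xs} (∈-deduplicate⁻ _≟_ (filter P? xs) x∈)))
      (λ Px → ∈-deduplicate⁺ _≟_ (∈-filter⁺ P? (complete x Px) Px))

    length-select-≤ : length select ℕ.≤ length xs
    length-select-≤ = ℕ.≤-trans (length-deduplicate _≟_ (filter P? xs)) (length-filter P? xs)

  1≤2^ : ∀ m → 1 ℕ.≤ 2 ^ m
  1≤2^ m = ℕ.m^n>0 2 m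

  m<2^m : ∀ m → m ℕ.< 2 ^ m
  m<2^m zero    = s≤s z≤n
  m<2^m (suc m) = ℕ.≤-trans (ℕ.+-mono-≤ (1≤2^ m) (m<2^m m))
      (ℕ.+-monoʳ-≤ (2 ^ m) (ℕ.≤-reflexive (≡.sym (ℕ.+-identityʳ _))))

  -- An integer substitute for log₂ T. The exponent grows by one just when the next number exceeds
  -- 2^l, and then 2^(l+1) is still at most twice that number.
  log₂-approximation : ∀ T → 1 ℕ.≤ T → ∃ λ l → T ℕ.≤ 2 ^ l × 2 ^ l ℕ.≤ 2 * T
  log₂-approximation (suc zero)    _ = 0 , ℕ.≤-refl , s≤s z≤n
  log₂-approximation (suc (suc T)) _ with log₂-approximation (suc T) (s≤s z≤n)
  ... | l , T≤2^l , 2^l≤2T with suc (suc T) ℕ.≤? 2 ^ l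
  ...   | yes T< = l , T< , ℕ.≤-trans 2^l≤2T (ℕ.*-monoʳ-≤ 2 (ℕ.n≤1+n (suc T)))
  ...   | no  T≮ = suc l , ℕ.≤-trans (s≤s (s≤s (ℕ.m≤n+m T T)))
      (ℕ.≤-trans (ℕ.≤-reflexive double) (ℕ.*-monoʳ-≤ 2 T≤2^l)) ,
                   ℕ.*-monoʳ-≤ 2 (ℕ.≤-pred (ℕ.≤-trans (ℕ.≰⇒> T≮) (ℕ.n≤1+n _)))
    where
    double : suc (suc (T + T)) ≡ 2 * suc T
    double = ≡.cong suc (≡.trans (≡.sym (ℕ.+-suc T T))
        (≡.cong (T +_) (≡.sym (ℕ.+-identityʳ (suc T)))))

  -- A calculus of bounds of the form 2^(l e)

  module PowerBounds (l : ℕ) (1≤l : 1 ℕ.≤ l) where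

    infix 4 _≼_

    -- A record, so that the exponent e can be inferred from the way x is built.
    record _≼_ (x e : ℕ) : Set where
      constructor bounded
      field
        bound : x ℕ.≤ 2 ^ (l * e)

    open _≼_ public

    2^≼ : ∀ {m e} → m ℕ.≤ l * e → 2 ^ m ≼ e
    2^≼ m≤ = bounded (ℕ.^-monoʳ-≤ 2 m≤)

    ≤≼ : ∀ {x y e} → x ℕ.≤ y → y ≼ e → x ≼ e
    ≤≼ x≤y (bounded y≤) = bounded (ℕ.≤-trans x≤y y≤)

    linear≼ : ∀ {m e} → m ℕ.≤ l * e → m ≼ e
    linear≼ {m} m≤ = ≤≼ (ℕ.<⇒≤ (m<2^m m)) (2^≼ m≤)

    const≼ : ∀ m → m ≼ m
    const≼ m = linear≼ (ℕ.≤-trans (ℕ.≤-reflexive (≡.sym (ℕ.*-identityˡ m))) (ℕ.*-monoˡ-≤ m 1≤l))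

    *≼ : ∀ {x y e f} → x ≼ e → y ≼ f → x * y ≼ e + f
    *≼ {e = e} {f} (bounded x≤) (bounded y≤) = bounded (ℕ.≤-trans (ℕ.*-mono-≤ x≤ y≤)
      (ℕ.≤-reflexive (≡.trans (≡.sym (ℕ.^-distribˡ-+-* 2 (l * e) (l * f)))
          (≡.cong (2 ^_) (≡.sym (ℕ.*-distribˡ-+ l e f))))))

    -- Both summands are at most 2^(l(e+f)); the extra 1 pays for the factor 2, as 2 ≤ 2^l.
    +≼ : ∀ {x y e f} → x ≼ e → y ≼ f → x + y ≼ suc (e + f)
    +≼ {e = e} {f} (bounded x≤) (bounded y≤) = ≤≼
      (ℕ.+-mono-≤ (ℕ.≤-trans x≤ (ℕ.^-monoʳ-≤ 2 (ℕ.*-monoʳ-≤ l (ℕ.m≤m+n e f))))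
                  (ℕ.≤-trans y≤ (ℕ.^-monoʳ-≤ 2 (ℕ.*-monoʳ-≤ l (ℕ.m≤n+m f e)))))
      (≤≼ (ℕ.≤-reflexive (≡.cong (2 ^ (l * (e + f)) +_) (≡.sym (ℕ.+-identityʳ _))))
        (*≼ {2} {2 ^ (l * (e + f))} {1} {e + f}
          (2^≼ {1} (ℕ.≤-trans 1≤l (ℕ.≤-reflexive (≡.sym (ℕ.*-identityʳ l))))) (bounded ℕ.≤-refl)))

    ^≼ : ∀ {x y v e} → x ℕ.≤ 2 ^ v → y ℕ.≤ l * e → x ^ y ≼ v * e
    ^≼ {x} {y} {v} {e} x≤ y≤ = ≤≼ (ℕ.^-monoˡ-≤ y x≤) (≤≼ (ℕ.≤-reflexive (ℕ.^-*-assoc 2 v y))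
      (2^≼ (ℕ.≤-trans (ℕ.*-monoʳ-≤ v y≤) (ℕ.≤-reflexive eq))))
      where
      eq : v * (l * e) ≡ l * (v * e)
      eq = ≡.trans (≡.sym (ℕ.*-assoc v l e))
          (≡.trans (≡.cong (_* e) (ℕ.*-comm v l)) (ℕ.*-assoc l v e))

open Counting

module _ {a b p} {A : Set a} {B : Set b} {P : Pred B p} (f : A → List B) where

  All-concatMap⁺ : ∀ {xs} → All (All P ∘ f) xs → All P (concatMap f xs)
  All-concatMap⁺ = All.concat⁺ ∘ All.map⁺

  All-concatMap⁻ : ∀ {xs x} → All P (concatMap f xs) → x ∈ xs → All P (f x)
  All-concatMap⁻ all = All.lookup (All.map⁻ (All.concat⁻ all))

-- Going down from N, the first j with f j below r has f (j+1) above it, because r is never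
-- attained. This is the form in which `ε2` speaks of a time between two rounded powers.
crossing : ∀ (f : ℕ → ℕ) {r} N → f 0 ℕ.≤ r → r ℕ.≤ f N → (∀ j → f j ≢ r) →
           ∃ λ j → j ℕ.< N × f j ℕ.< r × r ℕ.< f (suc j)
crossing f zero    f0≤r r≤f0 f≢r = ⊥-elim (f≢r 0 (ℕ.≤-antisym f0≤r r≤f0))
crossing f {r} (suc N) f0≤r r≤f  f≢r with f N ℕ.<? r
... | yes fN<r = N , ℕ.n<1+n N , fN<r , ℕ.≤∧≢⇒< r≤f (f≢r (suc N) ∘ ≡.sym)
... | no  fN≮r with crossing f N f0≤r (ℕ.≮⇒≥ fN≮r) f≢r
...   | j , j<N , rest = j , ℕ.m<n⇒m<1+n j<N , rest

-- Natural numbers in the field, and ceilings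

module NaturalEmbedding {c ℓ₁ ℓ₂} (F : ArchimedeanField c ℓ₁ ℓ₂) where
  open ArchimedeanField F
  open OrderedField F
  open Rounding F

  0≤fromℕ : ∀ m → 0# ≤ fromℕ m
  0≤fromℕ zero    = ≤-refl
  0≤fromℕ (suc m) = +-nonNegative 0≤1 (0≤fromℕ m)

  fromℕ-mono-≤ : ∀ {m o} → m ℕ.≤ o → fromℕ m ≤ fromℕ o
  fromℕ-mono-≤ {o = o} z≤n = 0≤fromℕ o
  fromℕ-mono-≤ (s≤s {m} {o} m≤o) = +-monoʳ-≤ 1# (fromℕ-mono-≤ {m} {o} m≤o)

  fromℕ-cancel-≤ : ∀ {m o} → fromℕ m ≤ fromℕ o → m ℕ.≤ o
  fromℕ-cancel-≤ {zero}          _  = z≤n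
  fromℕ-cancel-≤ {suc m} {zero}  le = ⊥-elim (<⇒≱ 0<1 (≤-trans (x≤x+y 1# (0≤fromℕ m)) le))
  fromℕ-cancel-≤ {suc m} {suc o} le = s≤s (fromℕ-cancel-≤ {m} {o} (+-cancelˡ-≤ le))
    where
    +-cancelˡ-≤ : ∀ {x y z} → x + y ≤ x + z → y ≤ z
    +-cancelˡ-≤ {x} {y} {z} le = ≤-respˡ (cancel y) (≤-respʳ (cancel z) (+-monoʳ-≤ (- x) le))
      where
      cancel : ∀ w → - x + (x + w) ≈ w
      cancel w = trans (sym (+-assoc _ _ _)) (trans (+-congʳ (-‿inverseˡ x)) (+-identityˡ w))

  ≤⌈⌉ : ∀ x → x ≤ fromℕ ⌈ x ⌉
  ≤⌈⌉ x = proj₁ (⌈⌉-isLeast x)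

  ⌈⌉-least : ∀ {x m} → x ≤ fromℕ m → ⌈ x ⌉ ℕ.≤ m
  ⌈⌉-least {x} = proj₂ (⌈⌉-isLeast x) _

  ⌈⌉-cong : ∀ {x y} → x ≈ y → ⌈ x ⌉ ≡ ⌈ y ⌉
  ⌈⌉-cong {x} {y} x≈y = ℕ.≤-antisym (⌈⌉-least (≤-respˡ (sym x≈y) (≤⌈⌉ y)))
                                     (⌈⌉-least (≤-respˡ x≈y (≤⌈⌉ x)))

  fromℕ1≈1 : fromℕ 1 ≈ 1#
  fromℕ1≈1 = +-identityʳ 1#

  ⌈1⌉≡1 : ⌈ 1# ⌉ ≡ 1
  ⌈1⌉≡1 = ℕ.≤-antisym (⌈⌉-least (≤-reflexive (sym fromℕ1≈1)))
                       (fromℕ-cancel-≤ (≤-respˡ (sym fromℕ1≈1) (≤⌈⌉ 1#)))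

-- Capacities between significant times

module Times {c ℓ₁ ℓ₂} (F : ArchimedeanField c ℓ₁ ℓ₂)
  (ε : ArchimedeanField.Carrier F) (0<ε : ArchimedeanField._<_ F (ArchimedeanField.0# F) ε)
  {n T : ℕ} (I : Knapsack.Instance F n T) where

  open ArchimedeanField F
  open OrderedField F hiding (+-monoˡ-≤; *-monoˡ-≤; 0≤1; x≤x+y)
  open NaturalEmbedding F
  open Rounding F
  open Knapsack F
  open Scheme ε 0<ε I
  open Instance I

  -- Exponent 0 rounds to 1, which is what remains at the last time.
  significant-last : ∀ {t : Fin T} → suc (toℕ t) ≡ T → Significant t
  significant-last {t} last =
      0 , ≡.trans ⌈1⌉≡1 (≡.trans (≡.sym (ℕ.m+n∸n≡m 1 (toℕ t))) (≡.cong (_∸ toℕ t) last))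

  -- The pairs (t , k) with t ∈ 𝒯ₕ and k ∈ 𝒦ₕ for some h.
  Domain : List (Fin T × Fin (suc K)) → Fin T → Fin (suc K) → Set
  Domain S t k = Any (λ B → Block.InTimes B t × Block.InClasses B k) (blocksFrom T S)

  domain? : ∀ S t k → Dec (Domain S t k)
  domain? S t k = any? (λ B → Block.inTimes? B t ×-dec Block.inClasses? B k) (blocksFrom T S)

  -- What remains at `t` lies between 1 and T ≤ (1+ε)^⌈log T⌉ without being a rounded power, hence
  -- strictly between two consecutive ones, and `ε2` applies. For the first time this makes the
  -- capacity 0.
  capacity-before : WellBehaved → ∀ t → ¬ Significant t → capacity t ≈ before capacity t
  capacity-before wellBehaved t ¬sig
    with crossing (λ j → ⌈ 1+ε ^ j ⌉) {remaining t} ⌈log fromℕ T ⌉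
      (≡.subst (ℕ._≤ remaining t) (≡.sym ⌈1⌉≡1) (ℕ.m<n⇒0<n∸m (Fin.toℕ<n t)))
      (ℕ.≤-trans (ℕ.m∸n≤m T (toℕ t))
        (fromℕ-cancel-≤ (≤-trans (proj₁ (⌈log⌉-isLeast (fromℕ T))) (≤⌈⌉ _))))
      (λ j eq → ¬sig (j , eq))
  ... | j , j< , below , above = WellBehaved.ε2 wellBehaved j j< t below above

  capacity-segment : WellBehaved → ∀ d {t u : Fin T} → toℕ u ≡ d ℕ.+ toℕ t →
                     (∀ v → t Fin.< v → v Fin.≤ u → ¬ Significant v) → capacity u ≤ capacity t
  capacity-segment wb zero    u≡t _ =
      ≤-reflexive (reflexive (≡.cong capacity (Fin.toℕ-injective u≡t)))
  capacity-segment wb (suc d) {t} {suc u} u≡ insignificant =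
    ≤-respˡ (sym (capacity-before wb (suc u) (insignificant (suc u) t<u ℕ.≤-refl)))
      (capacity-segment wb d (≡.trans (Fin.toℕ-inject₁ u) (ℕ.suc-injective u≡))
        (λ v t<v v≤u → insignificant v t<v
            (ℕ.m≤n⇒m≤1+n (≡.subst (toℕ v ℕ.≤_) (Fin.toℕ-inject₁ u) v≤u))))
    where
    t<u : t Fin.< suc u
    t<u = ≡.subst (toℕ t ℕ.<_) (≡.sym u≡) (s≤s (ℕ.m≤n+m (toℕ t) d))

-- Binary points of the polytopes are 1-in feasible solutions

module Soundness {c ℓ₁ ℓ₂} (F : ArchimedeanField c ℓ₁ ℓ₂)
  (ε : ArchimedeanField.Carrier F) (0<ε : ArchimedeanField._<_ F (ArchimedeanField.0# F) ε)
  {n T : ℕ} (I : Knapsack.Instance F n T) (σ : Permutation′ n) where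

  open ArchimedeanField F
  open OrderedField F hiding (+-monoˡ-≤; *-monoˡ-≤; 0≤1; x≤x+y)
  open LinearForms F
  open LinearSystems F
  open Knapsack F
  open Scheme ε 0<ε I
  open Polytopes σ
  open Instance I
  open Times F ε 0<ε I

  evaluate-weights : ∀ (x : Point n T) t → evaluate x (map (λ i → weight i , (t , i)) (allFin n)) ≡
                                           sum (λ i → weight i * x (t , i))
  evaluate-weights x t = evaluate-allFin x weight (t ,_)

  common⇒feasible : ∀ {x} → Binary x → Solves x common → Feasible I x
  common⇒feasible {x} binary solves = record
    { binary   = binary
    ; knapsack = λ t → ≤-respˡ (reflexive (evaluate-weights x t))
        (lower (All.lookup (All.map⁻ (All.++⁻ˡ capacities solves)) (∈-allFin t)))
    ; chain    = λ t u u≡ i → x-y≤0⇒x≤y (≤-respˡ (evaluate-difference x (t , i) (u , i))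
        (lower (All.lookup (All.map⁻
            (All-concatMap⁻ _ (All-concatMap⁻ _ (All.++⁻ˡ _ (All.++⁻ʳ capacities solves))
          (∈-allFin t)) (∈-filter⁺ (λ u → toℕ u ℕ.≟ suc (toℕ t)) (∈-allFin u) u≡))) (∈-allFin i))))
    }
    where
    capacities = map (λ t → map (λ i → weight i , (t , i)) (allFin n) ⟨ leq ⟩ capacity t) (allFin T)

  -- If the class is empty, the padding begins at once and its first row reads 0 = 1.
  some-packed : ∀ {x t} ρ xs → 1 ℕ.≤ ρ →
                Solves x (map (fix 1# t) (take ρ xs) ++ replicate (ρ ∸ length xs) unsatisfiable) →
                ∃ λ i → i ∈ xs × x (t , i) ≈ 1#
  some-packed (suc ρ) []       _ (sat ∷ _) = ⊥-elim (0≉1 (lower sat))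
  some-packed {x} (suc ρ) (i ∷ xs) _ (sat ∷ _) =
    i , here ≡.refl , trans (sym (evaluate-single x _)) (lower sat)

  -- The case distinction inside `excluded` is made once, for an arbitrary property `Q`, so that
  -- later arguments about satisfaction and about length need not repeat it.
  excluded-elim : ∀ q t k {ℓ} (Q : System (Fin T × Fin n) → Set ℓ) → Q [] →
                  (Pair.ρ⟨_,_⟩ q t k ℕ.≤ R →
                      Q (map (fix 0# t) (drop (Pair.ρ⟨_,_⟩ q t k) (profitClass k)))) →
                  Q (excluded q t k)
  excluded-elim q t k Q Q[] Qfix with Pair.ρ⟨_,_⟩ q t k ℕ.≤? R
  ... | yes ρ≤R = Qfix ρ≤R
  ... | no _    = Q[]

  firstBlock : ∀ {S} → StartsAtZero S →
               ∃ λ B → B ∈ blocksFrom T S × Block.kₕ B ≡ zero × Block.tₕ₋₁ B ≡ T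
  firstBlock (t₁ , S′ , ≡.refl) = _ , here ≡.refl , ≡.refl , ≡.refl

  solves-packed : ∀ {x} q {B t k} → Block.InTimes B t → Block.InClasses B k →
                  Solves x (blockConstraints q B) → Solves x (packed q t k)
  solves-packed q {B} {t} {k} t∈ k∈ solves = All.++⁻ˡ (packed q t k) (All-concatMap⁻ _
    (All-concatMap⁻ _ (All.++⁻ʳ (early q B) solves)
      (∈-filter⁺ (Block.inTimes? B) (∈-allFin t) t∈))
    (∈-filter⁺ (Block.inClasses? B) (∈-allFin k) k∈))

  solves-block : ∀ {x} q {B} → B ∈ blocks q → Solves x (P q) → Solves x (blockConstraints q B)
  solves-block q B∈ solves = All-concatMap⁻ (blockConstraints q) (All.++⁻ʳ common solves) B∈

  admissible⇒oneIn : ∀ {x} q {last : Fin T} → suc (toℕ last) ≡ T → Admissible q → Solves x (P q) →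
      OneIn I x
  admissible⇒oneIn {x} q {last} last≡ adm solves =
      last , last≡ , packed-one (firstBlock (Admissible.start adm))
    where
    packed-one : (∃ λ B → B ∈ blocks q × Block.kₕ B ≡ zero × Block.tₕ₋₁ B ≡ T) →
                 ∃ λ i → profit i ≈ 1# × x (last , i) ≈ 1#
    packed-one (B , B∈ , kₕ≡0 , tₕ₋₁≡T) = unit-profit
      (some-packed (Pair.ρ⟨_,_⟩ q last kₕ) (profitClass kₕ)
          (All.lookup (Admissible.leading adm) B∈ last last∈)
        (solves-packed q {B} last∈ (ℕ.≤-refl , ℕ.m≤m+n (toℕ kₕ) C) (solves-block q {B} B∈ solves)))
      where
      open Block B

      last∈ : InTimes last
      last∈ = significant-last last≡
            , ℕ.≤-pred (≡.subst (toℕ tₕ ℕ.<_) (≡.sym last≡) (Fin.toℕ<n tₕ))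
            , ≡.subst (toℕ last ℕ.<_) (≡.sym tₕ₋₁≡T) (Fin.toℕ<n last)

      unit-profit : (∃ λ i → i ∈ profitClass kₕ × x (last , i) ≈ 1#) →
                    ∃ λ i → profit i ≈ 1# × x (last , i) ≈ 1#
      unit-profit (i , i∈ , x≈1) = i ,
        trans (≡.subst (λ k → profit i ≈ (1+ε ^ toℕ k) ⁻¹) kₕ≡0
          (proj₂ (∈-filter⁻ (λ i → profit i ≟ (1+ε ^ toℕ kₕ) ⁻¹) {xs = items} i∈))) 1⁻¹≈1 ,
        x≈1

  ⋃P⇒feasible : ∀ {x} {last : Fin T} → suc (toℕ last) ≡ T → ⋃P x → Binary x →
      Feasible I x × OneIn I x
  ⋃P⇒feasible last≡ (q , adm , solves) binary =
    common⇒feasible binary (All.++⁻ˡ common solves) , admissible⇒oneIn q last≡ adm solves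

-- Profit classes

module Classes {c ℓ₁ ℓ₂} (F : ArchimedeanField c ℓ₁ ℓ₂)
  (ε : ArchimedeanField.Carrier F) (0<ε : ArchimedeanField._<_ F (ArchimedeanField.0# F) ε)
  {n T : ℕ} (I : Knapsack.Instance F n T) (σ : Permutation′ n) where

  open ArchimedeanField F
  open OrderedField F hiding (+-monoˡ-≤; *-monoˡ-≤; 0≤1; x≤x+y)
  open Knapsack F
  open Scheme ε 0<ε I
  open Polytopes σ
  open Instance I

  ^≉0 : ∀ m → 1+ε ^ m ≉ 0#
  ^≉0 m = 0<⇒≉0 (<-≤-trans 0<1 (1≤^ m))

  InClass : Fin (suc K) → Fin n → Set ℓ₁
  InClass k i = profit i ≈ (1+ε ^ toℕ k) ⁻¹

  inClass? : ∀ k i → Dec (InClass k i)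
  inClass? k i = profit i ≟ (1+ε ^ toℕ k) ⁻¹

  -- The powers of `1+ε` increase strictly, so a profit determines its exponent.
  InClass-unique : ∀ {k k′ i} → InClass k i → InClass k′ i → k ≡ k′
  InClass-unique {k} {k′} p p′ = Fin.toℕ-injective (ℕ.≤-antisym
    (^-cancel-≤ (≤-reflexive powers≈)) (^-cancel-≤ (≤-reflexive (sym powers≈))))
    where
    powers≈ : 1+ε ^ toℕ k ≈ 1+ε ^ toℕ k′
    powers≈ = ⁻¹-injective (^≉0 (toℕ k)) (^≉0 (toℕ k′)) (trans (sym p) p′)

  -- For equal profits p, multiplying p/wⱼ ≤ p/wᵢ by wᵢwⱼ gives p wᵢ ≤ p wⱼ, and p > 0 cancels.
  profitClass-sorted : ByEfficiency I σ → ∀ k →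
      AllPairs (λ i j → weight i ≤ weight j) (profitClass k)
  profitClass-sorted byEfficiency k = lighter (profitClass k) (All.all-filter (inClass? k) items)
    (AllPairs.filter⁺ (inClass? k) (AllPairs.map⁺ (AllPairs.tabulate⁺-< byEfficiency)))
    where
    lighter₂ : ∀ {i j} → InClass k i → InClass k j →
               profit j * weight j ⁻¹ ≤ profit i * weight i ⁻¹ → weight i ≤ weight j
    lighter₂ {i} {j} i∈k j∈k effⱼ≤effᵢ = *-cancelˡ-≤ (profit>0 i)
      (≤-respˡ lhs≈ (≤-respʳ rhs≈
        (*-monoˡ-≤ (*-nonNegative (proj₁ (weight>0 i)) (proj₁ (weight>0 j))) effⱼ≤effᵢ)))
      where
      lhs≈ : weight i * weight j * (profit j * weight j ⁻¹) ≈ profit i * weight i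
      lhs≈ = trans (*-assoc _ _ _) (trans (*-congˡ (trans (*-congˡ (*-comm _ _))
        (x*[x⁻¹*y]≈y _ (0<⇒≉0 (weight>0 j))))) (trans (*-comm _ _) (*-congʳ (trans j∈k (sym i∈k)))))

      rhs≈ : weight i * weight j * (profit i * weight i ⁻¹) ≈ profit i * weight j
      rhs≈ = trans (*-congʳ (*-comm _ _))
          (trans (*-assoc _ _ _) (trans (*-congˡ (trans (*-congˡ (*-comm _ _))
        (x*[x⁻¹*y]≈y _ (0<⇒≉0 (weight>0 i))))) (*-comm _ _)))

    lighter : ∀ xs → All (InClass k) xs →
              AllPairs (λ i j → profit j * weight j ⁻¹ ≤ profit i * weight i ⁻¹) xs →
              AllPairs (λ i j → weight i ≤ weight j) xs
    lighter []       []         []         = []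
    lighter (x ∷ xs) (px ∷ pxs) (rx ∷ rxs) =
      All.zipWith (λ (py , r) → lighter₂ px py r) (pxs , rx) ∷ lighter xs pxs rxs

-- Every 1-in solution is dominated by a point of the union

module Completeness {c ℓ₁ ℓ₂} (F : ArchimedeanField c ℓ₁ ℓ₂)
  (ε : ArchimedeanField.Carrier F) (0<ε : ArchimedeanField._<_ F (ArchimedeanField.0# F) ε)
  {n T : ℕ} (I : Knapsack.Instance F n T) (σ : Permutation′ n)
  (wellBehaved : Knapsack.Scheme.WellBehaved F ε 0<ε I) (byEfficiency : Knapsack.ByEfficiency F I σ)
  (y : Knapsack.Point F n T) (feasible : Knapsack.Feasible F I y) where

  open ArchimedeanField F
  open OrderedField F hiding (+-monoˡ-≤; *-monoˡ-≤; 0≤1; x≤x+y)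
  open LinearSystems F
  open LinearForms F
  open Knapsack F
  open Scheme ε 0<ε I
  open Polytopes σ
  open Instance I
  open Feasible feasible
  open Times F ε 0<ε I
  open Classes F ε 0<ε I σ
  open Soundness F ε 0<ε I σ
  open Segments significant?
  open Compression F inClass? InClass-unique σ hiding (items)

  y-mono : ∀ d {t u : Fin T} → toℕ u ≡ d ℕ.+ toℕ t → ∀ i → y (t , i) ≤ y (u , i)
  y-mono zero    u≡t i =
      ≤-reflexive (reflexive (≡.cong (λ u → y (u , i)) (Fin.toℕ-injective (≡.sym u≡t))))
  y-mono (suc d) {t} {suc u} u≡ i = ≤-trans
    (y-mono d {t} {inject₁ u} (≡.trans (Fin.toℕ-inject₁ u) (ℕ.suc-injective u≡)) i)
    (chain (inject₁ u) (suc u) (≡.cong suc (≡.sym (Fin.toℕ-inject₁ u))) i)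

  y-mono-≤ : ∀ {t u : Fin T} → t Fin.≤ u → ∀ i → y (t , i) ≤ y (u , i)
  y-mono-≤ {t} t≤u = y-mono _ (≡.sym (ℕ.m∸n+n≡m t≤u))

  -- Capacities are constant between significant times, so packing at once
  -- everything that y packs there before the next one keeps feasibility.
  z : Fin T → Packing
  z t i = y (segEnd t , i)

  z-binary : ∀ t → BinaryPacking (z t)
  z-binary t i = binary (segEnd t , i)

  z-mono : ∀ {t u : Fin T} → t Fin.≤ u → ∀ i → z t i ≤ z u i
  z-mono t≤u = y-mono-≤ (segEnd-mono t≤u)

  z-knapsack : ∀ t → sum (λ i → weight i * z t i) ≤ capacity t
  z-knapsack t = ≤-trans (knapsack (segEnd t))
    (capacity-segment wellBehaved _ (≡.sym (ℕ.m∸n+n≡m (segEnd-≤ t))) (segEnd-constant t))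

  x : Point n T
  x (t , i) = compress (z t) i

  x-binary : Binary x
  x-binary (t , i) = compress-binary (z-binary t) i

  -- Packing items earlier only adds positive profits, and compression loses none.
  profit≤ : totalProfit I y ≤ totalProfit I x
  profit≤ = sum-mono λ t → ≤-trans
    (sum-mono λ i → *-monoˡ-≤ (proj₁ (profit>0 i)) (y-mono-≤ (segEnd-≤ t) i))
    (profit-compress (λ k → _ , λ i∈k → i∈k) (z-binary t))

  counts : Fin T → Fin (suc K) → ℕ
  counts t = count (z t)

  counts-mono : ∀ {t u : Fin T} → t Fin.≤ u → ∀ k → counts t k ℕ.≤ counts u k
  counts-mono {u = u} t≤u = count-mono (z-binary u) (z-mono t≤u)

  binary-≥0 : ∀ {v} → v ≈ 0# ⊎ v ≈ 1# → 0# ≤ v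
  binary-≥0 (inj₁ v≈0) = ≤-reflexive (sym v≈0)
  binary-≥0 (inj₂ v≈1) = ≤-respʳ (sym v≈1) 0≤1

  binary-≤1 : ∀ {v} → v ≈ 0# ⊎ v ≈ 1# → v ≤ 1#
  binary-≤1 (inj₁ v≈0) = ≤-respˡ (sym v≈0) 0≤1
  binary-≤1 (inj₂ v≈1) = ≤-reflexive v≈1

  -- Weights are positive, so a single packed item would already exceed the capacity.
  counts-zero : ∀ t → capacity t ≤ 0# → ∀ k → counts t k ≡ 0
  counts-zero t cap≤0 k =
      ≡.cong length (filter-none (packed? (z t)) (All.tabulate {xs = profitClass k} λ {i} _ →
      not-packed i))
    where
    not-packed : ∀ i → z t i ≉ 1#
    not-packed i zi≈1 = <⇒≱ (weight>0 i) (≤-respˡ (trans (*-congˡ zi≈1) (*-identityʳ _))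
      (≤-trans (term≤sum (λ j → *-nonNegative (proj₁ (weight>0 j)) (binary-≥0 (z-binary t j))) i)
        (≤-trans (z-knapsack t) cap≤0)))

  -- An insignificant first time has capacity b₀ = 0 and packs nothing. Any other insignificant time
  -- shares its segment, hence its packing `z`, with its predecessor.
  counts-insignificant : ∀ u → ¬ Significant u → ∀ k → 1 ℕ.≤ counts u k →
                         ∃ λ t → toℕ t ℕ.< toℕ u × 1 ℕ.≤ counts t k
  counts-insignificant zero ¬sig k pos = ⊥-elim (ℕ.n≮0 (≡.subst (1 ℕ.≤_)
    (counts-zero zero (≤-reflexive (capacity-before wellBehaved zero ¬sig)) k) pos))
  counts-insignificant (suc t) ¬sig k pos = inject₁ t , s≤s (ℕ.≤-reflexive (Fin.toℕ-inject₁ t)) ,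
    ≡.subst (λ s → 1 ℕ.≤ count (λ i → y (s , i)) k)
      (segEnd-insignificant (≡.cong suc (≡.sym (Fin.toℕ-inject₁ t))) ¬sig) pos

  open Tracking significant? counts counts-insignificant

  -- Counts up to `R` are recorded exactly; `suc R` stands for every larger one, for which
  -- `excluded` imposes no rows.
  capped : ℕ → ℕ
  capped m = m ℕ.⊓ suc R

  entry : ∀ {p} {P : Set p} → Dec P → ℕ → Fin (2 ℕ.+ R)
  entry (yes _) m = Fin.fromℕ< (s≤s (ℕ.m⊓n≤n m (suc R)))
  entry (no _)  m = zero

  entry-yes : ∀ {p} {P : Set p} (P? : Dec P) m → P → toℕ (entry P? m) ≡ capped m
  entry-yes (yes _) m _ = Fin.toℕ-fromℕ< _
  entry-yes (no ¬p) m p = ⊥-elim (¬p p)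

  entry-no : ∀ {p} {P : Set p} (P? : Dec P) m → ¬ P → toℕ (entry P? m) ≡ 0
  entry-no (yes p) m ¬p = ⊥-elim (¬p p)
  entry-no (no _)  m _  = ≡.refl

  pair : List (Fin T × Fin (suc K)) → Pair
  pair S = S & Vec.tabulate (λ t → Vec.tabulate (λ k → entry (domain? S t k) (counts t k)))

  ρ≡entry : ∀ S t k → Pair.ρ⟨_,_⟩ (pair S) t k ≡ toℕ (entry (domain? S t k) (counts t k))
  ρ≡entry S t k = ≡.cong toℕ (≡.trans
    (≡.cong (λ row → Vec.lookup row k)
        (Vec.lookup∘tabulate (λ t → Vec.tabulate (λ k → entry (domain? S t k) (counts t k))) t))
    (Vec.lookup∘tabulate (λ k → entry (domain? S t k) (counts t k)) k))

  ρ≡capped : ∀ S {t k} → Domain S t k → Pair.ρ⟨_,_⟩ (pair S) t k ≡ capped (counts t k)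
  ρ≡capped S {t} {k} dom = ≡.trans (ρ≡entry S t k) (entry-yes (domain? S t k) (counts t k) dom)

  -- Covers both `mono` and `mono⁺`: on its domain ρ is the capped count, whichever block the time
  -- belongs to, and counts grow with time.
  ρ-mono : ∀ S {t u k} → t Fin.≤ u → Domain S t k → Domain S u k →
           Pair.ρ⟨_,_⟩ (pair S) t k ℕ.≤ Pair.ρ⟨_,_⟩ (pair S) u k
  ρ-mono S {k = k} t≤u dt du = ≡.subst₂ ℕ._≤_ (≡.sym (ρ≡capped S dt)) (≡.sym (ρ≡capped S du))
    (ℕ.⊓-monoˡ-≤ (suc R) (counts-mono t≤u k))

  Tracked : Block → Set
  Tracked B = Significant tₕ × 1 ℕ.≤ counts tₕ kₕ × Empty (toℕ tₕ) kₕ₊₁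
    where open Block B

  -- The next class used by `blocksFrom` and the one used by `Tracks` agree only once the tail is
  -- known to be empty or not, hence the split.
  tracked-blocks : ∀ {τ S} → Tracks τ S → All Tracked (blocksFrom τ S)
  tracked-blocks ([] _) = []
  tracked-blocks (cons _ sig pos _ _ tracks@([] _)) = (sig , pos , Tracks⇒Empty tracks) ∷ []
  tracked-blocks (cons _ sig pos _ _ tracks@(cons _ _ _ _ _ _)) =
    (sig , pos , Tracks⇒Empty tracks) ∷ tracked-blocks tracks

  Tracks-significant : ∀ {τ S} → Tracks τ S → All (λ (t , _) → Significant t) S
  Tracks-significant ([] _)                    = []
  Tracks-significant (cons _ sig _ _ _ tracks) = sig ∷ Tracks-significant tracks

  Tracks-ordered : ∀ {τ S} → Tracks τ S → Linked (λ (t , k) (t′ , k′) → t′ Fin.< t × k Fin.< k′) S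
  Tracks-ordered ([] _)                           = []
  Tracks-ordered (cons _ _ _ _ k< tracks@([] _)) = [-]
  Tracks-ordered (cons _ _ _ _ k< tracks@(cons t′< _ _ _ _ _)) = (t′< , k<) ∷ Tracks-ordered tracks

  -- An empty list, or one starting with a positive class, would say that class 0 is never packed,
  -- but it is at the last time.
  Tracks-start : ∀ {last S} → suc (toℕ last) ≡ T → 1 ℕ.≤ counts last zero → Tracks T S →
      StartsAtZero S
  Tracks-start {last} last≡ pos ([] empty) = ⊥-elim (ℕ.n≮0 (≡.subst (1 ℕ.≤_)
    (empty last (Fin.toℕ<n last) zero (s≤s z≤n)) pos))
  Tracks-start last≡ pos (cons {k = zero} _ _ _ _ _ _) = _ , _ , ≡.refl
  Tracks-start {last} last≡ pos (cons {k = suc _} _ _ _ empty _ _) = ⊥-elim (ℕ.n≮0 (≡.subst (1 ℕ.≤_)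
    (empty last (Fin.toℕ<n last) zero (s≤s z≤n)) pos))

  -- For `mono⁺`: neighbouring blocks meet at tₕ, and membership in the full list is kept because it
  -- places their times and classes in the domain of ρ.
  linked-blocks : ∀ {τ S bs} → (∀ {B} → B ∈ blocksFrom τ S → B ∈ bs) →
                  Linked (λ B B′ → B ∈ bs × B′ ∈ bs × Block.tₕ₋₁ B′ ≡ toℕ (Block.tₕ B))
                      (blocksFrom τ S)
  linked-blocks {S = []}        ⊆bs = []
  linked-blocks {S = _ ∷ []}    ⊆bs = [-]
  linked-blocks {S = _ ∷ _ ∷ _} ⊆bs =
    (⊆bs (here ≡.refl) , ⊆bs (there (here ≡.refl)) , ≡.refl) ∷ linked-blocks (⊆bs ∘ there)

  pair-admissible : ∀ {last S} → suc (toℕ last) ≡ T → 1 ℕ.≤ counts last zero → Tracks T S →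
                    Admissible (pair S)
  pair-admissible {S = S} last≡ pos tracks = record
    { times   = Tracks-significant tracks
    ; ordered = Tracks-ordered tracks
    ; start   = Tracks-start last≡ pos tracks
    ; dom     = λ t k ¬dom → ≡.trans (ρ≡entry S t k) (entry-no (domain? S t k) (counts t k) ¬dom)
    ; leading = All.tabulate λ {B} B∈ t t∈ → leading B B∈ t t∈
    ; mono    = All.tabulate λ {B} B∈ t u k t∈ u∈ k∈ t≤u →
        ρ-mono S t≤u (lose B∈ (t∈ , k∈)) (lose B∈ (u∈ , k∈))
    ; mono⁺   = Linked.map
        (λ { {B} {B′} (B∈ , B′∈ , τ≡) u t k u∈ t∈ k∈ k∈′ → ρ-mono S
          -- The times of the later entry end before tₕ and those of the earlier one start there, so
          -- `t` precedes `u`.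
          (ℕ.<⇒≤ (ℕ.<-≤-trans (≡.subst (toℕ t ℕ.<_) τ≡ (proj₂ (proj₂ t∈))) (proj₁ (proj₂ u∈))))
          (lose B′∈ (t∈ , k∈′)) (lose B∈ (u∈ , k∈)) })
        (linked-blocks {T} {S} (λ B∈ → B∈))
    }
    where
    leading : ∀ B → B ∈ blocksFrom T S → ∀ t → Block.InTimes B t →
        1 ℕ.≤ Pair.ρ⟨_,_⟩ (pair S) t (Block.kₕ B)
    leading B B∈ t t∈ = ≡.subst (1 ℕ.≤_)
      (≡.sym (ρ≡capped S (lose B∈ (t∈ , ℕ.≤-refl , ℕ.m≤m+n _ C))))
      (ℕ.⊓-glb (ℕ.≤-trans (proj₁ (proj₂ (All.lookup (tracked-blocks tracks) B∈)))
        (counts-mono (proj₁ (proj₂ t∈)) (Block.kₕ B))) (s≤s z≤n))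

  solves-map : ∀ {A : Set} (f : A → Constraint (Fin T × Fin n)) as →
      (∀ {a} → a ∈ as → Satisfies x (f a)) →
               Solves x (map f as)
  solves-map f as sat = All.map⁺ (All.tabulate sat)

  solves-concatMap : ∀ {A : Set} (f : A → System (Fin T × Fin n)) as →
      (∀ {a} → a ∈ as → Solves x (f a)) →
                     Solves x (concatMap f as)
  solves-concatMap f as sat = All-concatMap⁺ f (All.tabulate sat)

  solves-common : Solves x common
  solves-common = All.++⁺
    (solves-map (λ t → map (λ i → weight i , (t , i)) (allFin n) ⟨ leq ⟩ capacity t) (allFin T)
      λ {t} _ → lift (capacity-respected t))
    (All.++⁺
      (solves-concatMap later (allFin T) λ {t} _ →
        solves-concatMap (λ u → map (difference t u) (allFin n))
            (filter (λ u → toℕ u ℕ.≟ suc (toℕ t)) (allFin T))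
          λ {u} u∈ → solves-map (difference t u) (allFin n) λ {i} _ →
            lift (chained (proj₂ (∈-filter⁻ (λ u → toℕ u ℕ.≟ suc (toℕ t)) {xs = allFin T} u∈)) i))
      (All.++⁺
        (solves-map (λ v → ((- 1# , v) ∷ []) ⟨ leq ⟩ 0#) variables
          λ {v} _ → lift (≤-respˡ (sym (evaluate-negated x v)) (0≤x⇒-x≤0 (binary-≥0 (x-binary v)))))
        (solves-map (λ v → ((1# , v) ∷ []) ⟨ leq ⟩ 1#) variables
          λ {v} _ → lift (≤-respˡ (sym (evaluate-single x v)) (binary-≤1 (x-binary v))))))
    where
    difference : Fin T → Fin T → Fin n → Constraint (Fin T × Fin n)
    difference t u i = ((1# , (t , i)) ∷ (- 1# , (u , i)) ∷ []) ⟨ leq ⟩ 0#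

    later : Fin T → System (Fin T × Fin n)
    later t = concatMap (λ u → map (difference t u) (allFin n))
        (filter (λ u → toℕ u ℕ.≟ suc (toℕ t)) (allFin T))

    capacity-respected : ∀ t → evaluate x (map (λ i → weight i , (t , i)) (allFin n)) ≤ capacity t
    capacity-respected t = ≤-respˡ (reflexive (≡.sym (evaluate-weights x t)))
      (≤-trans (weight-compress (profitClass-sorted byEfficiency) (z-binary t)) (z-knapsack t))

    chained : ∀ {t u} → toℕ u ≡ suc (toℕ t) → ∀ i →
        evaluate x ((1# , (t , i)) ∷ (- 1# , (u , i)) ∷ []) ≤ 0#
    chained {t} {u} u≡ i = ≤-respˡ (sym (evaluate-difference x (t , i) (u , i))) (x≤y⇒x-y≤0
      (compress-mono (z-binary u) (z-mono (ℕ.≤-trans (ℕ.n≤1+n _) (ℕ.≤-reflexive (≡.sym u≡)))) i))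

  solves-fix : ∀ {α t i} → x (t , i) ≈ α → Satisfies x (fix α t i)
  solves-fix {t = t} {i} x≈α = lift (trans (evaluate-single x (t , i)) x≈α)

  -- The count is 0 there, so the unpacked part `drop 0` is the whole class.
  solves-early : ∀ q {B} → Tracked B → Solves x (early q B)
  solves-early q {B} (_ , _ , empty) = All-concatMap⁺ _ (All.tabulate λ {t} t∈ →
    All-concatMap⁺ _ (All.tabulate λ {k} k∈ → All.map⁺ (All.tabulate λ {i} i∈ →
      solves-fix (compress-drop (z t) {k} (≡.subst (λ m → i ∈ drop m (profitClass k))
        (≡.sym (empty t (proj₂ (∈-filter⁻ (λ t → t Fin.<? tₕ) {xs = allFin T} t∈)) k
          (proj₂ (∈-filter⁻ (λ k → toℕ k ℕ.<? kₕ₊₁) {xs = allFin (suc K)} k∈)))) i∈)))))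
    where open Block B

  -- Capping only lowers the count, so the required prefix is part of the packed one; it also fits
  -- into the class, so there is no padding.
  solves-take : ∀ q {t k} → Pair.ρ⟨_,_⟩ q t k ≡ capped (counts t k) → Solves x (packed q t k)
  solves-take q {t} {k} ρ≡ = All.++⁺
    (All.map⁺ (All.tabulate λ i∈ →
        solves-fix (compress-take (z t) {k} (∈-take-mono ρ≤ (profitClass k) i∈))))
    (≡.subst (λ m → Solves x (replicate m unsatisfiable))
      (≡.sym (ℕ.m≤n⇒m∸n≡0 (ℕ.≤-trans ρ≤ (count≤length (z t) k)))) [])
    where
    ρ≤ : Pair.ρ⟨_,_⟩ q t k ℕ.≤ counts t k
    ρ≤ = ≡.subst (ℕ._≤ counts t k) (≡.sym ρ≡) (ℕ.m⊓n≤m (counts t k) (suc R))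

  -- A value of at most `R` was not produced by the cap, so it is the exact count and everything
  -- after it is unpacked.
  solves-excluded : ∀ q {t k} → Pair.ρ⟨_,_⟩ q t k ≡ capped (counts t k) → Solves x (excluded q t k)
  solves-excluded q {t} {k} ρ≡ = excluded-elim q t k (Solves x) [] λ ρ≤R →
    All.map⁺ (All.tabulate λ {i} i∈ → solves-fix (compress-drop (z t) {k}
      (≡.subst (λ m → i ∈ drop m (profitClass k)) (ρ≡count ρ≤R) i∈)))
    where
    ρ≡count : Pair.ρ⟨_,_⟩ q t k ℕ.≤ R → Pair.ρ⟨_,_⟩ q t k ≡ counts t k
    ρ≡count ρ≤R = ≡.trans ρ≡ (ℕ.m≤n⇒m⊓n≡m (ℕ.≮⇒≥ λ R<count → ℕ.<⇒≱ (s≤s ρ≤R)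
      (ℕ.≤-reflexive (≡.sym (≡.trans ρ≡ (ℕ.m≥n⇒m⊓n≡n (ℕ.<⇒≤ R<count)))))))

  solves-pair : ∀ {S} → Tracks T S → Solves x (P (pair S))
  solves-pair {S} tracks = All.++⁺ solves-common (All-concatMap⁺ _ (All.tabulate λ {B} B∈ →
    All.++⁺ (solves-early (pair S) {B} (All.lookup (tracked-blocks tracks) B∈))
      (All-concatMap⁺ _ (All.tabulate λ {t} t∈ → All-concatMap⁺ _ (All.tabulate λ {k} k∈ →
        let ρ≡ = ρ≡capped S (lose B∈ (proj₂ (∈-filter⁻ (Block.inTimes? B) {xs = allFin T} t∈)
                                     , proj₂ (∈-filter⁻ (Block.inClasses? B) {xs = allFin (suc K)} k∈)))
        in All.++⁺ (solves-take (pair S) ρ≡) (solves-excluded (pair S) ρ≡))))))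

  x∈⋃P : ∀ {last} → suc (toℕ last) ≡ T → OneIn I y → ⋃P x
  x∈⋃P {last} last≡ (t , t≡ , i , p≈1 , y≈1) =
      pair S , pair-admissible last≡ pos tracks , solves-pair tracks
    where
    S      = proj₁ (track T ℕ.≤-refl)
    tracks = proj₂ (track T ℕ.≤-refl)

    -- The last time ends its own segment, so `z` agrees with `y` there and the item of profit 1 in
    -- `y` is counted.
    end≡t : segEnd last ≡ t
    end≡t = ≡.trans (segEnd-last last≡)
        (Fin.toℕ-injective (ℕ.suc-injective (≡.trans last≡ (≡.sym t≡))))

    pos : 1 ℕ.≤ counts last zero
    pos = count>0 (z last) {zero} {i} (trans p≈1 (sym 1⁻¹≈1))
        (≡.subst (λ u → y (u , i) ≈ 1#) (≡.sym end≡t) y≈1)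

-- Balas' theorem for polyhedra with trivial recession cones

module Disjunctive {c ℓ₁ ℓ₂} (F : ArchimedeanField c ℓ₁ ℓ₂) {V : Set}
  (vs : List V) (complete : ∀ v → v ∈ vs)
  (Ps : List (LinearSystems.System F V)) where

  open ArchimedeanField F
  open OrderedField F
  open LinearSystems F
  open LinearForms F
  open Algebra.Properties.Ring ring
  open Algebra.Properties.Semiring.Sum semiring
    using (*-distribˡ-sum; ∑-comm; sum-replicate-zero; *-distribʳ-sum)

  N = length Ps

  -- For γ > 0 this describes γ times the polyhedron, for γ = 0 its recession cone.
  Scaled : Carrier → (V → Carrier) → Constraint V → Set _
  Scaled γ y (ts ⟨ s ⟩ β) = Holds s (evaluate y ts) (β * γ)

  link : V → Constraint (DisjunctiveVar V N)
  link v = ((1# , original v) ∷ map (λ r → - 1# , copy r v) (allFin N)) ⟨ eq ⟩ 0#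

  homogenise : Fin N → Constraint V → Constraint (DisjunctiveVar V N)
  homogenise r (ts ⟨ s ⟩ β) = ((- β , multiplier r) ∷ map (map₂ (copy r)) ts) ⟨ s ⟩ 0#

  length-disjunctive : length (disjunctive vs Ps) ≡ length vs ℕ.+ suc (N ℕ.+ sumℕ (map length Ps))
  length-disjunctive = ≡.trans (length-++ (map link vs))
      (≡.cong₂ ℕ._+_ (length-map link vs) (≡.cong suc
    (≡.trans (length-++ (map (λ r → ((- 1# , multiplier r) ∷ []) ⟨ leq ⟩ 0#) (allFin N)))
      (≡.cong₂ ℕ._+_ (≡.trans
          (length-map (λ r → ((- 1# , multiplier r) ∷ []) ⟨ leq ⟩ 0#) (allFin N))
          (length-tabulate {n = N} id))
        (≡.trans (length-concatMap-sum (λ r → map (homogenise r) (lookup Ps r)) (allFin N))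
          (≡.cong sumℕ (≡.trans
              (map-cong (λ r → length-map (homogenise r) (lookup Ps r)) (allFin N))
            (≡.trans (map-tabulate id (length ∘ lookup Ps)) (lengths Ps)))))))))
    where
    lengths : (Qs : List (System V)) → tabulate (length ∘ lookup Qs) ≡ map length Qs
    lengths []       = ≡.refl
    lengths (Q ∷ Qs) = ≡.cong (length Q ∷_) (lengths Qs)

  -β*γ+a≈a-β*γ : ∀ β γ a → - β * γ + a ≈ a - β * γ
  -β*γ+a≈a-β*γ β γ a = trans (+-comm _ _) (+-congˡ (sym (-‿distribˡ-* β γ)))

  evaluate-homogenise : ∀ (z : DisjunctiveVar V N → Carrier) r ts β →
    evaluate z ((- β , multiplier r) ∷ map (map₂ (copy r)) ts) ≈
    evaluate (z ∘ copy r) ts - β * z (multiplier r)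
  evaluate-homogenise z r ts β = trans (+-congˡ (reflexive (evaluate-rename z (copy r) ts)))
    (-β*γ+a≈a-β*γ β (z (multiplier r)) _)

  homogenise⇒scaled : ∀ z r k → Satisfies z (homogenise r k) →
      Scaled (z (multiplier r)) (z ∘ copy r) k
  homogenise⇒scaled z r (ts ⟨ leq ⟩ β) (lift h) =
      lift (x-y≤0⇒x≤y (≤-respˡ (evaluate-homogenise z r ts β) h))
  homogenise⇒scaled z r (ts ⟨ eq ⟩ β)  (lift h) =
      lift (x-y≈0⇒x≈y (trans (sym (evaluate-homogenise z r ts β)) h))

  scaled⇒homogenise : ∀ z r k → Scaled (z (multiplier r)) (z ∘ copy r) k →
      Satisfies z (homogenise r k)
  scaled⇒homogenise z r (ts ⟨ leq ⟩ β) (lift h) =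
      lift (≤-respˡ (sym (evaluate-homogenise z r ts β)) (x≤y⇒x-y≤0 h))
  scaled⇒homogenise z r (ts ⟨ eq ⟩ β)  (lift h) =
    lift (trans (evaluate-homogenise z r ts β) (trans (+-congʳ h) (-‿inverseʳ _)))

  evaluate-link : ∀ (z : DisjunctiveVar V N → Carrier) v →
    evaluate z ((1# , original v) ∷ map (λ r → - 1# , copy r v) (allFin N)) ≈
    z (original v) - sum (λ r → z (copy r v))
  evaluate-link z v = +-cong (*-identityˡ _) (trans
    (reflexive (evaluate-allFin z (λ _ → - 1#) (λ r → copy r v)))
    (trans (sym (*-distribˡ-sum (- 1#) (λ r → z (copy r v)))) (-1*x≈-x _)))

  evaluate-multipliers : ∀ (z : DisjunctiveVar V N → Carrier) →
    evaluate z (map (λ r → 1# , multiplier r) (allFin N)) ≈ sum (λ r → z (multiplier r))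
  evaluate-multipliers z = trans (reflexive (evaluate-allFin z (λ _ → 1#) multiplier))
    (sum-cong {g = λ r → z (multiplier r)} (λ _ → *-identityˡ _))

  record Extends (z : DisjunctiveVar V N → Carrier) : Set (c ⊔ ℓ₁ ⊔ ℓ₂) where
    field
      links       : ∀ v → z (original v) ≈ sum (λ r → z (copy r v))
      normalised  : sum (λ r → z (multiplier r)) ≈ 1#
      nonNegative : ∀ r → 0# ≤ z (multiplier r)
      scaled      : ∀ r → All (Scaled (z (multiplier r)) (z ∘ copy r)) (lookup Ps r)

  extends⇒solves : ∀ {z} → Extends z → Solves z (disjunctive vs Ps)
  extends⇒solves {z} ext = All.++⁺
    (All.map⁺ {f = link} (All.tabulate λ {v} _ →
        lift (trans (evaluate-link z v) (trans (+-congʳ (links v)) (-‿inverseʳ _)))))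
    (lift (trans (evaluate-multipliers z) normalised) ∷
    All.++⁺
      (All.map⁺ {xs = allFin N} {f = λ r → ((- 1# , multiplier r) ∷ []) ⟨ leq ⟩ 0#}
          (All.tabulate λ {r} _ →
        lift (≤-respˡ (sym (evaluate-negated z (multiplier r))) (0≤x⇒-x≤0 (nonNegative r)))))
      (All-concatMap⁺ (λ r → map (homogenise r) (lookup Ps r)) {xs = allFin N} (All.tabulate λ {r} _ →
        All.map⁺ {f = homogenise r} (All.map (λ {k} → scaled⇒homogenise z r k) (scaled r)))))
    where open Extends ext

  solves⇒extends : ∀ {z} → Solves z (disjunctive vs Ps) → Extends z
  solves⇒extends {z} solves with All.++⁻ (map link vs) solves
  ... | links , lift normalised ∷ rest
      with All.++⁻ (map (λ r → ((- 1# , multiplier r) ∷ []) ⟨ leq ⟩ 0#) (allFin N)) rest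
  ...   | nonNegative , homogenised = record
    { links       = λ v →
        x-y≈0⇒x≈y (trans (sym (evaluate-link z v))
        (lower (All.lookup (All.map⁻ links) (complete v))))
    ; normalised  = trans (sym (evaluate-multipliers z)) normalised
    ; nonNegative = λ r → -x≤0⇒0≤x (≤-respˡ (evaluate-negated z (multiplier r))
        (lower (All.lookup (All.map⁻ nonNegative) (∈-allFin r))))
    ; scaled      = λ r → All.map (λ {k} → homogenise⇒scaled z r k)
        (All.map⁻ (All-concatMap⁻ (λ r → map (homogenise r) (lookup Ps r)) homogenised
            (∈-allFin r)))
    }

  ⋃ : (V → Carrier) → Set (c ⊔ ℓ₁ ⊔ ℓ₂)
  ⋃ y = ∃ λ r → Solves y (lookup Ps r)

  module _ {m} (y : Fin m → V → Carrier) (μ : Fin m → Carrier)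
    (y∈⋃ : ∀ r → ⋃ (y r)) (0≤μ : ∀ r → 0# ≤ μ r) (∑μ≈1 : sum μ ≈ 1#) where

    -- The weight of `y r` goes to one polytope containing it, so copy `i` collects the part of the
    -- combination that belongs to polytope `i`.
    share : Fin m → Fin N → Carrier
    share r i = δ (proj₁ (y∈⋃ r)) i (μ r)

    lifted : (V → Carrier) → DisjunctiveVar V N → Carrier
    lifted x (original v)   = x v
    lifted x (copy i v)     = sum (λ r → share r i * y r v)
    lifted x (multiplier i) = sum (λ r → share r i)

    weighted-leq : ∀ i ts β → (ts ⟨ leq ⟩ β) ∈ lookup Ps i → ∀ r →
        share r i * evaluate (y r) ts ≤ share r i * β
    weighted-leq i ts β k∈ r with proj₁ (y∈⋃ r) Fin.≟ i
    ... | yes ≡.refl = *-monoˡ-≤ (0≤μ r) (lower (All.lookup (proj₂ (y∈⋃ r)) k∈))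
    ... | no  _      = ≤-reflexive (trans (zeroˡ _) (sym (zeroˡ _)))

    weighted-eq : ∀ i ts β → (ts ⟨ eq ⟩ β) ∈ lookup Ps i → ∀ r →
        share r i * evaluate (y r) ts ≈ share r i * β
    weighted-eq i ts β k∈ r with proj₁ (y∈⋃ r) Fin.≟ i
    ... | yes ≡.refl = *-congˡ (lower (All.lookup (proj₂ (y∈⋃ r)) k∈))
    ... | no  _      = trans (zeroˡ _) (sym (zeroˡ _))

    ∑share*β : ∀ i β → sum (λ r → share r i * β) ≈ β * sum (λ r → share r i)
    ∑share*β i β = trans (sym (*-distribʳ-sum β (λ r → share r i))) (*-comm _ _)

    lifted-scaled : ∀ x i k → k ∈ lookup Ps i →
        Scaled (lifted x (multiplier i)) (lifted x ∘ copy i) k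
    lifted-scaled x i (ts ⟨ leq ⟩ β) k∈ = lift (≤-respˡ (sym (evaluate-sum (λ r → share r i) y ts))
      (≤-respʳ (∑share*β i β) (sum-mono (weighted-leq i ts β k∈))))
    lifted-scaled x i (ts ⟨ eq ⟩ β) k∈ = lift (trans (evaluate-sum (λ r → share r i) y ts)
      (trans (sum-cong (weighted-eq i ts β k∈)) (∑share*β i β)))

    lifted-extends : ∀ {x} → (∀ v → x v ≈ sum (λ r → μ r * y r v)) → Extends (lifted x)
    lifted-extends {x} x≈ = record
      { links = λ v → trans (x≈ v) (trans
          -- Each `μ r` is the sum of its shares over the polytopes; exchanging the two sums
          -- produces the copies.
          (sum-cong λ r → trans (*-congʳ (sym (sum-δ (proj₁ (y∈⋃ r)) (μ r))))
              (*-distribʳ-sum (y r v) (share r)))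
          (∑-comm λ r i → share r i * y r v))
      ; normalised  = trans (sym (∑-comm share))
          (trans (sum-cong (λ r → sum-δ (proj₁ (y∈⋃ r)) (μ r))) ∑μ≈1)
      ; nonNegative = λ i → sum-nonNegative (λ r → δ-nonNegative (proj₁ (y∈⋃ r)) i (0≤μ r))
      ; scaled      = λ i → All.tabulate (λ {k} → lifted-scaled x i k)
      }

  module _ (bounded : ∀ r y → All (Scaled 0# y) (lookup Ps r) → ∀ v → y v ≈ 0#)
    {z : DisjunctiveVar V N → Carrier} (extends : Extends z) where
    open Extends extends

    γ : Fin N → Carrier
    γ r = z (multiplier r)

    rescaled : ∀ r → γ r ≉ 0# → ∀ k → Scaled (γ r) (z ∘ copy r) k →
        Satisfies (λ v → γ r ⁻¹ * z (copy r v)) k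
    rescaled r γ≉0 (ts ⟨ leq ⟩ β) (lift h) = lift (≤-respˡ (sym (evaluate-scale _ _ ts))
      (≤-respʳ (trans (*-congˡ (*-comm _ _)) (x⁻¹*[x*y]≈y β γ≉0))
        (*-monoˡ-≤ (⁻¹-nonNegative (nonNegative r , γ≉0 ∘ sym)) h)))
    rescaled r γ≉0 (ts ⟨ eq ⟩ β) (lift h) = lift (trans (evaluate-scale _ _ ts)
      (trans (*-congˡ h) (trans (*-congˡ (*-comm _ _)) (x⁻¹*[x*y]≈y β γ≉0))))

    Scaled-cong : ∀ {α β y} k → α ≈ β → Scaled α y k → Scaled β y k
    Scaled-cong (ts ⟨ leq ⟩ _) α≈β (lift h) = lift (≤-respʳ (*-congˡ α≈β) h)
    Scaled-cong (ts ⟨ eq ⟩ _)  α≈β (lift h) = lift (trans h (*-congˡ α≈β))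

    -- Also demanded where the multiplier is 0, so that the multipliers themselves can be the
    -- coefficients of the convex combination.
    Representative : Fin N → Set _
    Representative r = Σ (V → Carrier) λ y → ⋃ y × (∀ v → z (copy r v) ≈ γ r * y v)

    representative : ∀ r → γ r ≉ 0# → Representative r
    representative r γ≉0 = (λ v → γ r ⁻¹ * z (copy r v)) ,
      (r , All.map (λ {k} → rescaled r γ≉0 k) (scaled r)) , λ v → sym (x*[x⁻¹*y]≈y _ γ≉0)

    -- A copy with multiplier 0 vanishes by `bounded`, so any point of the union represents it.
    degenerate : ∀ {y} → ⋃ y → ∀ r → γ r ≈ 0# → Representative r
    degenerate {y} y∈⋃ r γ≈0 = y , y∈⋃ , λ v → trans
      (bounded r (z ∘ copy r) (All.map (λ {k} → Scaled-cong k γ≈0) (scaled r)) v)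
      (sym (trans (*-congʳ γ≈0) (zeroˡ (y v))))

    -- The multipliers sum to 1. The polytope of a nonzero one supplies the point that `degenerate`
    -- needs.
    someNonzero : ∃ λ r → γ r ≉ 0#
    someNonzero with Fin.any? (λ r → ¬? (γ r ≟ 0#))
    ... | yes found = found
    ... | no ¬found = ⊥-elim
        (0≉1 (trans (sym (trans (sum-cong vanish) (sum-replicate-zero N))) normalised))
      where
      vanish : ∀ r → γ r ≈ 0#
      vanish r with γ r ≟ 0#
      ... | yes γ≈0 = γ≈0
      ... | no  γ≉0 = ⊥-elim (¬found (r , γ≉0))

    represent : ∀ r → Representative r
    represent r with γ r ≟ 0#
    ... | yes γ≈0 = degenerate
        (proj₁ (proj₂ (representative (proj₁ someNonzero) (proj₂ someNonzero)))) r γ≈0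
    ... | no  γ≉0 = representative r γ≉0

    extends⇒hull : ∀ {x} → (∀ v → z (original v) ≈ x v) → ConvexHull ⋃ x
    extends⇒hull z≈x = N , (λ r → proj₁ (represent r)) , γ , (λ r → proj₁ (proj₂ (represent r))) ,
        nonNegative , normalised ,
      λ v → trans (sym (z≈x v)) (trans (links v) (sum-cong λ r → proj₂ (proj₂ (represent r)) v))

  -- The hypothesis says that the recession cones are trivial, so that the
  -- copies with multiplier 0 vanish.
  hull⇔disjunctive : (∀ r y → All (Scaled 0# y) (lookup Ps r) → ∀ v → y v ≈ 0#) → ∀ x →
    ConvexHull ⋃ x ⇔ (∃ λ z → Solves z (disjunctive vs Ps) × (∀ v → z (original v) ≈ x v))
  hull⇔disjunctive bounded x = mk⇔
    (λ (m , y , μ , y∈⋃ , 0≤μ , ∑μ≈1 , x≈) →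
      lifted y μ y∈⋃ 0≤μ ∑μ≈1 x , extends⇒solves (lifted-extends y μ y∈⋃ 0≤μ ∑μ≈1 x≈) , λ _ → refl)
    (λ (z , solves , z≈x) → extends⇒hull bounded (solves⇒extends solves) z≈x)

-- Logarithms to base 1 + ε compared with powers of two

module Logarithms {c ℓ₁ ℓ₂} (F : ArchimedeanField c ℓ₁ ℓ₂)
  (ε : ArchimedeanField.Carrier F) (0<ε : ArchimedeanField._<_ F (ArchimedeanField.0# F) ε) where

  open ArchimedeanField F
  open OrderedField F hiding (+-monoˡ-≤; *-monoˡ-≤; 0≤1; x≤x+y)
  open NaturalEmbedding F
  open Rounding F
  open Base ε 0<ε
  open Algebra.Properties.Semiring.Exp semiring using (^-homo-*)
  open Algebra.Properties.Semiring.Mult semiring using (×1-homo-*)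
  open Algebra.Properties.Monoid.Mult +-monoid using (×-homo-+)

  -- The number called `R` in `Scheme`. By Bernoulli (1+ε)^m ≥ 1 + εm ≥ 2, so m factors of `1+ε`
  -- suffice for one doubling.
  m : ℕ
  m = ⌈ ε ⁻¹ ⌉

  ε≉0 : ε ≉ 0#
  ε≉0 = 0<⇒≉0 0<ε

  1≤ε*m : 1# ≤ ε * fromℕ m
  1≤ε*m = ≤-respˡ (*-inverseʳ ε≉0) (*-monoˡ-≤ 0≤ε (≤⌈⌉ (ε ⁻¹)))

  bernoulli : ∀ j → 1# + ε * fromℕ j ≤ 1+ε ^ j
  bernoulli zero    = ≤-reflexive (trans (+-congˡ (zeroʳ ε)) (+-identityʳ 1#))
  bernoulli (suc j) = ≤-trans (≤-reflexive split) (≤-trans (+-monoˡ-≤ ε (bernoulli j)) (^-step-≤ j))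
    where
    split : 1# + ε * fromℕ (suc j) ≈ (1# + ε * fromℕ j) + ε
    split = trans (+-congˡ
        (trans (distribˡ ε 1# (fromℕ j)) (trans (+-comm _ _) (+-congˡ (*-identityʳ ε)))))
      (sym (+-assoc _ _ _))

  x+x≤1+ε^m*x : ∀ {x} → 0# ≤ x → x + x ≤ 1+ε ^ m * x
  x+x≤1+ε^m*x {x} 0≤x = ≤-respˡ (trans (distribʳ x 1# 1#) (+-cong (*-identityˡ x) (*-identityˡ x)))
    (*-monoʳ-≤ 0≤x (≤-trans (+-monoʳ-≤ 1# 1≤ε*m) (bernoulli m)))

  2^≤^ : ∀ j → fromℕ (2 ℕ.^ j) ≤ 1+ε ^ (j ℕ.* m)
  2^≤^ zero    = ≤-reflexive fromℕ1≈1
  2^≤^ (suc j) = ≤-respʳ (sym (^-homo-* 1+ε m (j ℕ.* m)))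
    (≤-trans (≤-reflexive
        (trans (×-homo-+ 1# (2 ℕ.^ j) _)
        (+-congˡ (reflexive (≡.cong fromℕ (ℕ.+-identityʳ (2 ℕ.^ j)))))))
      (≤-trans (+-mono-≤ (2^≤^ j) (2^≤^ j)) (x+x≤1+ε^m*x (≤-trans 0≤1 (1≤^ (j ℕ.* m))))))

  ⌈log⌉≤ : ∀ {x j} → x ≤ fromℕ (2 ℕ.^ j) → ⌈log x ⌉ ℕ.≤ j ℕ.* m
  ⌈log⌉≤ {x} {j} x≤ = proj₂ (⌈log⌉-isLeast x) _ (≤-trans x≤ (2^≤^ j))

  ⌈log-fromℕ⌉≤ : ∀ {T j} → T ℕ.≤ 2 ℕ.^ j → ⌈log fromℕ T ⌉ ℕ.≤ j ℕ.* m
  ⌈log-fromℕ⌉≤ {T} {j} T≤ = ⌈log⌉≤ {j = j} (fromℕ-mono-≤ {T} T≤)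

  ε⁻¹≤2^m : ε ⁻¹ ≤ fromℕ (2 ℕ.^ m)
  ε⁻¹≤2^m = ≤-trans (≤⌈⌉ (ε ⁻¹)) (fromℕ-mono-≤ {m} (ℕ.<⇒≤ (m<2^m m)))

  ⌈log-ε⁻¹⌉≤ : ⌈log ε ⁻¹ ⌉ ℕ.≤ m ℕ.* m
  ⌈log-ε⁻¹⌉≤ = ⌈log⌉≤ {j = m} ε⁻¹≤2^m

  ⌈log-T/ε⌉≤ : ∀ {T j} → T ℕ.≤ 2 ℕ.^ j → ⌈log fromℕ T * ε ⁻¹ ⌉ ℕ.≤ (j ℕ.+ m) ℕ.* m
  ⌈log-T/ε⌉≤ {T} {j} T≤ = ⌈log⌉≤ {j = j ℕ.+ m} (≤-trans
    (*-monoʳ-≤ (⁻¹-nonNegative 0<ε) (fromℕ-mono-≤ {T} T≤))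
    (≤-trans (*-monoˡ-≤ (0≤fromℕ (2 ℕ.^ j)) ε⁻¹≤2^m)
      (≤-reflexive (trans (sym (×1-homo-* (2 ℕ.^ j) (2 ℕ.^ m)))
        (reflexive (≡.cong fromℕ (≡.sym (ℕ.^-distribˡ-+-* 2 j m))))))))

-- Enumerating the admissible pairs

module Enumeration {c ℓ₁ ℓ₂} (F : ArchimedeanField c ℓ₁ ℓ₂)
  (ε : ArchimedeanField.Carrier F) (0<ε : ArchimedeanField._<_ F (ArchimedeanField.0# F) ε)
  {n T : ℕ} (I : Knapsack.Instance F n T) where

  open ArchimedeanField F
  open NaturalEmbedding F
  open Rounding F
  open Knapsack F
  open Scheme ε 0<ε I
  open Times F ε 0<ε I

  Skeleton : Set
  Skeleton = List (Fin T × Fin (suc K))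

  Ordered : Fin T × Fin (suc K) → Fin T × Fin (suc K) → Set
  Ordered (t , k) (t′ , k′) = t′ Fin.< t × k Fin.< k′

  Ordered-trans : ∀ {x y z} → Ordered x y → Ordered y z → Ordered x z
  Ordered-trans (t′<t , k<k′) (t″<t′ , k′<k″) = Fin.<-trans t″<t′ t′<t , Fin.<-trans k<k′ k′<k″

  ordered? : (S : Skeleton) → Dec (Linked Ordered S)
  ordered? = linked? λ (t , k) (t′ , k′) → (t′ Fin.<? t) ×-dec (k Fin.<? k′)

  startsAtZero? : (S : Skeleton) → Dec (StartsAtZero S)
  startsAtZero? []                = no λ ()
  startsAtZero? ((t , zero) ∷ S)  = yes (t , S , ≡.refl)
  startsAtZero? ((t , suc k) ∷ S) = no λ ()

  admissible? : ∀ q → Dec (Admissible q)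
  admissible? q = map′
    (λ (times , ordered , start , dom , leading , mono , mono⁺) → record
      { times = times ; ordered = ordered ; start = start ; dom = dom
      ; leading = leading ; mono = mono ; mono⁺ = mono⁺ })
    (λ adm → let open Admissible adm in times , ordered , start , dom , leading , mono , mono⁺)
    (All.all? (λ (t , _) → significant? t) S
      ×-dec ordered? S
      ×-dec startsAtZero? S
      ×-dec Fin.all? (λ t → Fin.all? λ k → ¬? (domain? S t k) →-dec (ρ⟨ t , k ⟩ ℕ.≟ 0))
      ×-dec All.all? (λ B → Fin.all? λ t → Block.inTimes? B t →-dec (1 ℕ.≤? ρ⟨ t , Block.kₕ B ⟩))
          (blocks q)
      ×-dec All.all? (λ B → Fin.all? λ t → Fin.all? λ u → Fin.all? λ k →
        Block.inTimes? B t →-dec (Block.inTimes? B u →-dec (Block.inClasses? B k →-dec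
          ((t Fin.≤? u) →-dec (ρ⟨ t , k ⟩ ℕ.≤? ρ⟨ u , k ⟩))))) (blocks q)
      ×-dec linked? (λ B B′ → Fin.all? λ u → Fin.all? λ t → Fin.all? λ k →
        Block.inTimes? B u →-dec (Block.inTimes? B′ t →-dec (Block.inClasses? B k →-dec
          (Block.inClasses? B′ k →-dec (ρ⟨ t , k ⟩ ℕ.≤? ρ⟨ u , k ⟩))))) (blocks q))
    where open Pair q

  _≟ₚ_ : DecidableEquality Pair
  (S & ρ) ≟ₚ (S′ & ρ′) = map′ (λ { (≡.refl , ≡.refl) → ≡.refl }) (λ { ≡.refl → ≡.refl , ≡.refl })
    (List.≡-dec (Product.≡-dec Fin._≟_ Fin._≟_) S S′ ×-dec Vec.≡-dec (Vec.≡-dec Fin._≟_) ρ ρ′)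

  -- Distinct times leave distinct amounts of time, each a rounded power whose exponent lies between
  -- 0 and ⌈log T⌉.
  significant-length : ∀ {ts : List (Fin T)} → Unique ts → All Significant ts →
      length ts ℕ.≤ suc ⌈log fromℕ T ⌉
  significant-length {ts} unique sigs = ≡.subst₂ ℕ._≤_ (length-map remaining ts)
    (≡.trans (length-map (λ j → ⌈ 1+ε ^ j ⌉) (upTo (suc ⌈log fromℕ T ⌉))) (length-upTo _))
    (Unique-⊆⇒length-≤ (Unique.map⁺ remaining-injective unique) into)
    where
    remaining-injective : ∀ {t u : Fin T} → remaining t ≡ remaining u → t ≡ u
    remaining-injective {t} {u} same =
        Fin.toℕ-injective (ℕ.∸-cancelˡ-≡ (ℕ.<⇒≤ (Fin.toℕ<n t)) (ℕ.<⇒≤ (Fin.toℕ<n u)) same)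

    exponent≤ : ∀ {j} {t : Fin T} → ⌈ 1+ε ^ j ⌉ ≡ remaining t → j ℕ.≤ ⌈log fromℕ T ⌉
    exponent≤ {j} {t} eq = ^-cancel-≤ (≤-trans (≤⌈⌉ (1+ε ^ j)) (≤-trans
      (fromℕ-mono-≤ {⌈ 1+ε ^ j ⌉} (ℕ.≤-trans (ℕ.≤-reflexive eq) (ℕ.m∸n≤m T (toℕ t))))
      (proj₁ (⌈log⌉-isLeast (fromℕ T)))))

    into : ∀ {r} → r ∈ map remaining ts → r ∈ map (λ j → ⌈ 1+ε ^ j ⌉) (upTo (suc ⌈log fromℕ T ⌉))
    into r∈ with ∈-map⁻ remaining r∈
    ... | t , t∈ , ≡.refl with All.lookup sigs t∈
    ...   | j , eq = ≡.subst (_∈ _) eq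
        (∈-map⁺ (λ j → ⌈ 1+ε ^ j ⌉) (∈-upTo⁺ (s≤s (exponent≤ {j} {t} eq))))

  -- Latest first, as in S; `opposite` reverses the order of `Fin T`.
  times↓ : List (Fin T)
  times↓ = filter significant? (tabulate opposite)

  opposite-injective : ∀ {i j : Fin T} → opposite i ≡ opposite j → i ≡ j
  opposite-injective {i} {j} eq = ≡.trans (≡.sym (Fin.opposite-involutive i))
    (≡.trans (≡.cong opposite eq) (Fin.opposite-involutive j))

  times↓-sorted : AllPairs (λ t t′ → t′ Fin.< t) times↓
  times↓-sorted = AllPairs.filter⁺ significant? (AllPairs.tabulate⁺-< opposite-anti)
    where
    opposite-anti : ∀ {i j : Fin T} → i Fin.< j → opposite j Fin.< opposite i
    opposite-anti {i} {j} i<j =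
        ≡.subst₂ ℕ._<_ (≡.sym (Fin.opposite-prop j)) (≡.sym (Fin.opposite-prop i))
      (ℕ.∸-monoʳ-< (s≤s i<j) (Fin.toℕ<n j))

  ∈-times↓ : ∀ {t} → Significant t → t ∈ times↓
  ∈-times↓ {t} sig = ∈-filter⁺ significant?
      (≡.subst (_∈ tabulate opposite) (Fin.opposite-involutive t)
    (∈-tabulate⁺ (opposite t))) sig

  length-times↓ : length times↓ ℕ.≤ suc ⌈log fromℕ T ⌉
  length-times↓ = significant-length
      (Unique.filter⁺ significant? (Unique.tabulate⁺ opposite-injective))
    (All.all-filter significant? (tabulate opposite))

  -- An ordered S is the `zip` of its times and its classes, both strictly sorted. Sets of unequal
  -- size are truncated by `zip` and cause repetitions, removed later by `select`. The filter makes
  -- the order available from membership.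
  skeletons : List Skeleton
  skeletons = filter ordered?
      (cartesianProductWith zip (sublists times↓) (sublists (allFin (suc K))))

  ∈-skeletons : ∀ {S} → All (λ (t , _) → Significant t) S → Linked Ordered S → S ∈ skeletons
  ∈-skeletons {S} sigs linked = ∈-filter⁺ ordered?
    (≡.subst (_∈ cartesianProductWith zip (sublists times↓) (sublists (allFin (suc K))))
        (zip-proj S)
      (∈-cartesianProductWith⁺ zip
        (sorted∈sublists (λ t′<t t<t′ → ℕ.<-asym t′<t t<t′) times↓-sorted
          (AllPairs.map⁺ (AllPairs.map proj₁ pairs))
          (λ t∈ → ∈-times↓ (All.lookup (All.map⁺ sigs) t∈)))
        (sorted∈sublists (λ k<k′ k′<k → ℕ.<-asym k<k′ k′<k) (AllPairs.tabulate⁺-< id)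
          (AllPairs.map⁺ (AllPairs.map proj₂ pairs)) (λ {k} _ → ∈-allFin k))))
    linked
    where
    pairs : AllPairs Ordered S
    pairs = Linked⇒AllPairs (λ {x} {y} {z} → Ordered-trans {x} {y} {z}) linked

  length-skeletons : length skeletons ℕ.≤ 2 ℕ.^ suc ⌈log fromℕ T ⌉ ℕ.* 2 ℕ.^ suc K
  length-skeletons = ℕ.≤-trans
      (length-filter ordered?
      (cartesianProductWith zip (sublists times↓) (sublists (allFin (suc K))))) (ℕ.≤-trans
    (ℕ.≤-reflexive (≡.trans
        (length-cartesianProductWith zip (sublists times↓) (sublists (allFin (suc K))))
      (≡.cong₂ ℕ._*_ (length-sublists times↓)
        (≡.trans (length-sublists (allFin (suc K)))
            (≡.cong (2 ℕ.^_) (length-tabulate {n = suc K} id))))))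
    (ℕ.*-monoˡ-≤ (2 ℕ.^ suc K) (ℕ.^-monoʳ-≤ 2 length-times↓)))

  blocks-before : ∀ {x S} → Linked Ordered (x ∷ S) →
                  All (λ B → Block.tₕ₋₁ B ℕ.≤ toℕ (proj₁ x)) (blocksFrom (toℕ (proj₁ x)) S)
  blocks-before [-]            = []
  blocks-before (x<y ∷ linked) =
    ℕ.≤-refl ∷ All.map (λ ≤y → ℕ.≤-trans ≤y (ℕ.<⇒≤ (proj₁ x<y))) (blocks-before linked)

  -- A time lies in 𝒯ₕ for at most one h, so only the C + 1 classes of 𝒦ₕ
  -- matter for it.
  window : ∀ {τ S} → Linked Ordered S → ∀ t → ∃ λ a → ∀ k →
           Any (λ B → Block.InTimes B t × Block.InClasses B k) (blocksFrom τ S) →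
           a ℕ.≤ toℕ k × toℕ k ℕ.< a ℕ.+ suc C
  window {S = []} linked t = 0 , λ _ ()
  window {S = (t₁ , k₁) ∷ S} linked t = case t₁ Fin.≤? t of λ where
    (yes t₁≤t) → toℕ k₁ , λ where
      k (here (_ , k₁≤k , k≤)) →
          k₁≤k , ℕ.≤-trans (s≤s k≤) (ℕ.≤-reflexive (≡.sym (ℕ.+-suc (toℕ k₁) C)))
      k (there later) → let (B , B∈ , (_ , _ , t<) , _) = find later in
        ⊥-elim (ℕ.<⇒≱ (ℕ.<-≤-trans t< (All.lookup (blocks-before linked) B∈)) t₁≤t)
    (no t₁≰t) → let (a , inWindow) = window {toℕ t₁} {S} (Linked.tail linked) t in a , λ where
      k (here ((_ , t₁≤t , _) , _)) → ⊥-elim (t₁≰t t₁≤t)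
      k (there later)               → inWindow k later

  -- Outside the domain the only option is the 0 that `dom` forces.
  choose : ∀ {p} {P : Set p} → Dec P → List (Fin (2 ℕ.+ R))
  choose (yes _) = allFin (2 ℕ.+ R)
  choose (no _)  = zero ∷ []

  length-choose-≤ : ∀ {p} {P : Set p} (P? : Dec P) → length (choose P?) ℕ.≤ 2 ℕ.+ R
  length-choose-≤ (yes _) = ℕ.≤-reflexive (length-tabulate {n = 2 ℕ.+ R} id)
  length-choose-≤ (no _)  = s≤s z≤n

  length-choose-no : ∀ {p} {P : Set p} (P? : Dec P) → ¬ P → length (choose P?) ℕ.≤ 1
  length-choose-no (yes p) ¬p = ⊥-elim (¬p p)
  length-choose-no (no _)  _  = ℕ.≤-refl

  ∈-choose : ∀ {p} {P : Set p} (P? : Dec P) v → (¬ P → toℕ v ≡ 0) → v ∈ choose P?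
  ∈-choose (yes _) v _    = ∈-allFin v
  ∈-choose (no ¬p) v zero-outside = here (Fin.toℕ-injective (zero-outside ¬p))

  row : Skeleton → Fin T → List (Vec (Fin (2 ℕ.+ R)) (suc K))
  row S t = choices (λ k → choose (domain? S t k))

  tables : Skeleton → List (Vec (Vec (Fin (2 ℕ.+ R)) (suc K)) T)
  tables S = choices (row S)

  -- Used with width `suc C` at significant times and with width 0 elsewhere, where it leaves at
  -- most one row.
  length-row : ∀ S t w a → (∀ k → Domain S t k → a ℕ.≤ toℕ k × toℕ k ℕ.< a ℕ.+ w) →
               length (row S t) ℕ.≤ (2 ℕ.+ R) ℕ.^ w
  length-row S t w a inWindow = ℕ.≤-trans
    (length-choices-≤ (domain? S t) id (λ k → choose (domain? S t k)) (λ k →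
        length-choose-≤ (domain? S t k)) (λ k → length-choose-no (domain? S t k)))
    (ℕ.^-monoʳ-≤ (2 ℕ.+ R) (length-filter-window (domain? S t) a w inWindow))

  length-tables : ∀ {S} → Linked Ordered S →
                  length (tables S) ℕ.≤ ((2 ℕ.+ R) ℕ.^ suc C) ℕ.^ suc ⌈log fromℕ T ⌉
  length-tables {S} linked = ℕ.≤-trans
    (length-choices-≤ significant? id (row S)
      (λ t → length-row S t (suc C) (proj₁ (window linked t)) (proj₂ (window {T} linked t)))
      (λ t ¬sig → length-row S t 0 0 λ k dom →
          ⊥-elim (¬sig (proj₁ (proj₁ (proj₂ (proj₂ (find dom))))))))
    (ℕ.^-monoʳ-≤ ((2 ℕ.+ R) ℕ.^ suc C) ⦃ ℕ.m^n≢0 (2 ℕ.+ R) (suc C) ⦄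
      (significant-length (Unique.filter⁺ significant? (Unique.allFin⁺ T))
          (All.all-filter significant? (allFin T))))

  candidates : List Pair
  candidates = concatMap (λ S → map (S &_) (tables S)) skeletons

  admissible∈candidates : ∀ {q} → Admissible q → q ∈ candidates
  admissible∈candidates {S & ρ} adm = ∈-concatMap⁺ (λ S → map (S &_) (tables S)) (lose
    (∈-skeletons (Admissible.times adm) (Admissible.ordered adm))
    (∈-map⁺ (S &_) (∈-choices (row S) ρ λ t →
        ∈-choices (λ k → choose (domain? S t k)) (Vec.lookup ρ t) λ k →
      ∈-choose (domain? S t k) (Vec.lookup (Vec.lookup ρ t) k) (Admissible.dom adm t k))))

  admissiblePairs : List Pair
  admissiblePairs = select _≟ₚ_ admissible? candidates

  admissiblePairs-unique : Unique admissiblePairs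
  admissiblePairs-unique = select-unique _≟ₚ_ admissible? candidates

  ∈-admissiblePairs : ∀ q → q ∈ admissiblePairs ⇔ Admissible q
  ∈-admissiblePairs = ∈-select _≟ₚ_ admissible? candidates (λ _ → admissible∈candidates)

  -- By definition `pairCount` at J = suc ⌈log T⌉, κ = suc K, m = R and suc C, the form in which it
  -- is estimated.
  pairBound : ℕ
  pairBound = (2 ℕ.^ suc ⌈log fromℕ T ⌉ ℕ.* 2 ℕ.^ suc K) ℕ.* ((2 ℕ.+ R) ℕ.^ suc C) ℕ.^ suc ⌈log
      fromℕ T ⌉

  length-admissiblePairs : length admissiblePairs ℕ.≤ pairBound
  length-admissiblePairs = ℕ.≤-trans (length-select-≤ _≟ₚ_ admissible? candidates)
    (ℕ.≤-trans (ℕ.≤-reflexive (length-concatMap-sum (λ S → map (S &_) (tables S)) skeletons))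
    (ℕ.≤-trans (sum-map-≤ (length ∘ (λ S → map (S &_) (tables S))) skeletons λ {S} S∈ →
        ℕ.≤-trans (ℕ.≤-reflexive (length-map (S &_) (tables S)))
          (length-tables (proj₂
              (∈-filter⁻ ordered? {xs = cartesianProductWith zip (sublists times↓) (sublists (allFin (suc K)))} S∈))))
      (ℕ.*-monoˡ-≤ _ length-skeletons)))

-- The exponent of T

pairCount : ℕ → ℕ → ℕ → ℕ → ℕ
pairCount J κ m C = (2 ℕ.^ J ℕ.* 2 ℕ.^ κ) ℕ.* ((2 ℕ.+ m) ℕ.^ C) ℕ.^ J

-- Bounds the rows of one `P`, divided by n: capacities, chain, the two bounds, then at most T
-- blocks. In 3 + m, one n each goes to the prefix and to the exclusions, and 1 + m to the padding.
systemBound : ℕ → ℕ → ℕ → ℕ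
systemBound T κ m = (T ℕ.+ (T ℕ.* T ℕ.+ (T ℕ.+ T))) ℕ.+ T ℕ.* (T ℕ.* κ ℕ.+ T ℕ.* (κ ℕ.* (3 ℕ.+ m)))

-- The size of Balas' formulation for N systems of nA rows, divided by n: the variables, then links,
-- normalisation, signs and homogenised rows.
formulationBound : ℕ → ℕ → ℕ → ℕ
formulationBound T N A = (T ℕ.+ N ℕ.* (T ℕ.+ 1)) ℕ.+ (T ℕ.+ (1 ℕ.+ (N ℕ.+ N ℕ.* A)))

formulationExponent : ℕ → ℕ
formulationExponent m = suc (suc (1 ℕ.+ (pairs ℕ.+ suc (1 ℕ.+ 1)))
                          ℕ.+ suc (1 ℕ.+ suc (1 ℕ.+ suc (pairs ℕ.+ (pairs ℕ.+ system)))))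
  where
  times   = suc m
  classes = suc (m ℕ.+ m ℕ.* m)
  pairs   = (times ℕ.+ classes) ℕ.+ ((2 ℕ.+ m) ℕ.* suc (m ℕ.* m)) ℕ.* times
  system  = suc (suc (1 ℕ.+ suc ((1 ℕ.+ 1) ℕ.+ suc (1 ℕ.+ 1)))
              ℕ.+ (1 ℕ.+ suc ((1 ℕ.+ classes) ℕ.+ (1 ℕ.+ (classes ℕ.+ (3 ℕ.+ m))))))

formulationBound≤ : ∀ {l} → 1 ℕ.≤ l → ∀ {T J κ m C} → 2 ℕ.≤ T → T ℕ.≤ 2 ℕ.^ l →
    2 ℕ.^ l ℕ.≤ 2 ℕ.* T →
  J ℕ.≤ l ℕ.* suc m → κ ℕ.≤ l ℕ.* suc (m ℕ.+ m ℕ.* m) → C ℕ.≤ suc (m ℕ.* m) →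
  formulationBound T (pairCount J κ m C) (systemBound T κ m) ℕ.≤ T ℕ.^ (2 ℕ.* formulationExponent m)
formulationBound≤ {l} 1≤l {T} {J} {κ} {m} {C} 2≤T T≤2^l 2^l≤2T J≤ κ≤ C≤ =
    ℕ.≤-trans (bound formulation≼) (square (formulationExponent m))
  where
  open PowerBounds l 1≤l

  -- The passage from base 2^l back to base T: it uses 2 ≤ T and causes the factor 2 in the final
  -- exponent.
  2^l≤T² : 2 ℕ.^ l ℕ.≤ T ℕ.^ 2
  2^l≤T² = ℕ.≤-trans 2^l≤2T (ℕ.≤-trans (ℕ.*-monoˡ-≤ T 2≤T)
    (ℕ.≤-reflexive (≡.cong (T ℕ.*_) (≡.sym (ℕ.*-identityʳ T)))))

  square : ∀ e → 2 ℕ.^ (l ℕ.* e) ℕ.≤ T ℕ.^ (2 ℕ.* e)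
  square e = ℕ.≤-trans (ℕ.≤-reflexive (≡.sym (ℕ.^-*-assoc 2 l e)))
    (ℕ.≤-trans (ℕ.^-monoˡ-≤ e 2^l≤T²) (ℕ.≤-reflexive (ℕ.^-*-assoc T 2 e)))

  T≼ : T ≼ 1
  T≼ = bounded (ℕ.≤-trans T≤2^l (ℕ.≤-reflexive (≡.cong (2 ℕ.^_) (≡.sym (ℕ.*-identityʳ l)))))

  row≤ : (2 ℕ.+ m) ℕ.^ C ℕ.≤ 2 ℕ.^ ((2 ℕ.+ m) ℕ.* suc (m ℕ.* m))
  row≤ = ℕ.≤-trans (ℕ.^-monoˡ-≤ C (ℕ.<⇒≤ (m<2^m (2 ℕ.+ m))))
      (ℕ.≤-trans (ℕ.≤-reflexive (ℕ.^-*-assoc 2 (2 ℕ.+ m) C))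
    (ℕ.^-monoʳ-≤ 2 (ℕ.*-monoʳ-≤ (2 ℕ.+ m) C≤)))

  -- The exponents are inferred from the rules applied and have to come out as
  -- `formulationExponent`, whose nesting mirrors these terms.
  pairs≼ = *≼ (*≼ (2^≼ {e = suc m} J≤) (2^≼ {e = suc (m ℕ.+ m ℕ.* m)} κ≤))
    (^≼ {v = (2 ℕ.+ m) ℕ.* suc (m ℕ.* m)} {e = suc m} row≤ J≤)

  κ≼ = linear≼ {e = suc (m ℕ.+ m ℕ.* m)} κ≤

  system≼ = +≼ (+≼ T≼ (+≼ (*≼ T≼ T≼) (+≼ T≼ T≼)))
    (*≼ T≼ (+≼ (*≼ T≼ κ≼) (*≼ T≼ (*≼ κ≼ (const≼ (3 ℕ.+ m))))))

  formulation≼ = +≼ (+≼ T≼ (*≼ pairs≼ (+≼ T≼ (const≼ 1))))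
    (+≼ T≼ (+≼ (const≼ 1) (+≼ pairs≼ (*≼ pairs≼ system≼))))

private
  system-arithmetic : ∀ n T κ r → T ℕ.* n ℕ.+ (T ℕ.* (T ℕ.* n) ℕ.+ (T ℕ.* n ℕ.+ T ℕ.* n)) ℕ.+
    T ℕ.* (T ℕ.* (κ ℕ.* n) ℕ.+ T ℕ.* (κ ℕ.* ((n ℕ.+ (1 ℕ.+ r) ℕ.* n) ℕ.+ n))) ≡
    n ℕ.* ((T ℕ.+ (T ℕ.* T ℕ.+ (T ℕ.+ T))) ℕ.+ T ℕ.* (T ℕ.* κ ℕ.+ T ℕ.* (κ ℕ.* (3 ℕ.+ r))))
  system-arithmetic = solve-∀

  formulation-arithmetic : ∀ n T N A → (T ℕ.* n ℕ.+ N ℕ.* (T ℕ.* n ℕ.+ 1 ℕ.* n)) ℕ.+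
    (T ℕ.* n ℕ.+ (1 ℕ.* n ℕ.+ (N ℕ.* n ℕ.+ n ℕ.* (N ℕ.* A)))) ≡
    n ℕ.* ((T ℕ.+ N ℕ.* (T ℕ.+ 1)) ℕ.+ (T ℕ.+ (1 ℕ.+ (N ℕ.+ N ℕ.* A))))
  formulation-arithmetic = solve-∀

  *-swap : ∀ a b c → a ℕ.* (b ℕ.* c) ≡ b ℕ.* (a ℕ.* c)
  *-swap = solve-∀

  suc≤l*suc : ∀ {l x e} → 1 ℕ.≤ l → x ℕ.≤ l ℕ.* e → suc x ℕ.≤ l ℕ.* suc e
  suc≤l*suc {l} {e = e} 1≤l x≤ = ℕ.≤-trans (ℕ.+-mono-≤ 1≤l x≤) (ℕ.≤-reflexive (≡.sym (ℕ.*-suc l e)))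

  [l+m]*m≤ : ∀ {l} → 1 ℕ.≤ l → ∀ m → (l ℕ.+ m) ℕ.* m ℕ.≤ l ℕ.* (m ℕ.+ m ℕ.* m)
  [l+m]*m≤ {l} 1≤l m = ℕ.≤-trans (ℕ.≤-reflexive (ℕ.*-distribʳ-+ m l m))
    (ℕ.≤-trans (ℕ.+-monoʳ-≤ (l ℕ.* m) (ℕ.m≤n*m (m ℕ.* m) l ⦃ ℕ.>-nonZero 1≤l ⦄))
      (ℕ.≤-reflexive (≡.sym (ℕ.*-distribˡ-+ l m (m ℕ.* m)))))

-- Numbers of constraints

module Sizes {c ℓ₁ ℓ₂} (F : ArchimedeanField c ℓ₁ ℓ₂)
  (ε : ArchimedeanField.Carrier F) (0<ε : ArchimedeanField._<_ F (ArchimedeanField.0# F) ε)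
  {n T : ℕ} (I : Knapsack.Instance F n T) (σ : Permutation′ n) where

  open ArchimedeanField F
  open OrderedField F hiding (+-monoˡ-≤; *-monoˡ-≤; 0≤1; x≤x+y)
  open LinearForms F
  open LinearSystems F
  open Knapsack F
  open Scheme ε 0<ε I
  open Polytopes σ
  open Instance I
  open Soundness F ε 0<ε I σ
  open Enumeration F ε 0<ε I

  -- The normalisation provides an item of profit 1. Rows that come without a factor n, such as
  -- capacities and padding, can therefore be counted n times.
  1≤n : 1 ℕ.≤ n
  1≤n = ℕ.≤-trans (s≤s z≤n) (Fin.toℕ<n (proj₁ profit-max))

  length-++-≤ : ∀ {a} {A : Set a} {i j} (xs {ys} : List A) → length xs ℕ.≤ i → length ys ℕ.≤ j →
      length (xs ++ ys) ℕ.≤ i ℕ.+ j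
  length-++-≤ xs xs≤ ys≤ = ℕ.≤-trans (ℕ.≤-reflexive (length-++ xs)) (ℕ.+-mono-≤ xs≤ ys≤)

  length-allFin : ∀ m → length (allFin m) ≡ m
  length-allFin m = length-tabulate {n = m} id

  length-profitClass : ∀ k → length (profitClass k) ℕ.≤ n
  length-profitClass k = ℕ.≤-trans (length-filter (λ i → profit i ≟ (1+ε ^ toℕ k) ⁻¹) items)
    (ℕ.≤-reflexive (≡.trans (length-map (σ ⟨$⟩ʳ_) (allFin n)) (length-allFin n)))

  length-variables : length variables ≡ T ℕ.* n
  length-variables = ≡.trans (length-cartesianProductWith _,_ (allFin T) (allFin n))
    (≡.cong₂ ℕ._*_ (length-allFin T) (length-allFin n))

  length-filter-allFin : ∀ {p m} {P : Fin m → Set p} (P? : Decidable P) →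
      length (filter P? (allFin m)) ℕ.≤ m
  length-filter-allFin {m = m} P? =
      ℕ.≤-trans (length-filter P? (allFin m)) (ℕ.≤-reflexive (length-allFin m))

  concatMap-filter-≤ : ∀ {a p m} {A : Set a} {P : Fin m → Set p} (P? : Decidable P)
                       (f : Fin m → List A) {b} → (∀ i → length (f i) ℕ.≤ b) →
                       length (concatMap f (filter P? (allFin m))) ℕ.≤ m ℕ.* b
  concatMap-filter-≤ {m = m} P? f ≤b =
      ℕ.≤-trans (length-concatMap-≤ f (filter P? (allFin m)) ≤b)
      (ℕ.*-monoˡ-≤ _ (length-filter-allFin P?))

  length-map-allFin : ∀ {a m} {A : Set a} (f : Fin m → A) → length (map f (allFin m)) ℕ.≤ m
  length-map-allFin {m = m} f = ℕ.≤-reflexive (≡.trans (length-map f (allFin m)) (length-allFin m))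

  -- The chain rows are estimated through all pairs of times, which a polynomial bound can afford.
  length-common : length common ℕ.≤ T ℕ.+ (T ℕ.* (T ℕ.* n) ℕ.+ (T ℕ.* n ℕ.+ T ℕ.* n))
  length-common = length-++-≤ (map capacityRow (allFin T)) (length-map-allFin capacityRow)
    (length-++-≤ (concatMap later (allFin T))
      (ℕ.≤-trans (length-concatMap-≤ later (allFin T) length-later)
        (ℕ.≤-reflexive (≡.cong (ℕ._* (T ℕ.* n)) (length-allFin T))))
      (length-++-≤ (map above variables) (over-variables above) (over-variables below)))
    where
    capacityRow : Fin T → Constraint (Fin T × Fin n)
    capacityRow t = map (λ i → weight i , (t , i)) (allFin n) ⟨ leq ⟩ capacity t

    difference : Fin T → Fin T → Fin n → Constraint (Fin T × Fin n)
    difference t u i = ((1# , (t , i)) ∷ (- 1# , (u , i)) ∷ []) ⟨ leq ⟩ 0#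

    later : Fin T → System (Fin T × Fin n)
    later t = concatMap (λ u → map (difference t u) (allFin n))
        (filter (λ u → toℕ u ℕ.≟ suc (toℕ t)) (allFin T))

    length-later : ∀ t → length (later t) ℕ.≤ T ℕ.* n
    length-later t = concatMap-filter-≤ (λ u → toℕ u ℕ.≟ suc (toℕ t)) (λ u →
        map (difference t u) (allFin n))
      λ u → length-map-allFin (difference t u)

    above below : Fin T × Fin n → Constraint (Fin T × Fin n)
    above v = ((- 1# , v) ∷ []) ⟨ leq ⟩ 0#
    below v = ((1# , v) ∷ []) ⟨ leq ⟩ 1#

    over-variables : ∀ {a} {A : Set a} (f : Fin T × Fin n → A) →
        length (map f variables) ℕ.≤ T ℕ.* n
    over-variables f = ℕ.≤-reflexive (≡.trans (length-map f variables) length-variables)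

  length-early : ∀ q B → length (early q B) ℕ.≤ T ℕ.* (suc K ℕ.* n)
  length-early q B = concatMap-filter-≤ (λ t → t Fin.<? Block.tₕ B) classes λ t →
    concatMap-filter-≤ (λ k → toℕ k ℕ.<? Block.kₕ₊₁ B) (λ k → map (fix 0# t) (profitClass k)) λ k →
      ℕ.≤-trans (ℕ.≤-reflexive (length-map (fix 0# t) (profitClass k))) (length-profitClass k)
    where
    classes : Fin T → System (Fin T × Fin n)
    classes t = concatMap (λ k → map (fix 0# t) (profitClass k))
        (filter (λ k → toℕ k ℕ.<? Block.kₕ₊₁ B) (allFin (suc K)))

  length-packed : ∀ q t k → length (packed q t k) ℕ.≤ n ℕ.+ suc R
  length-packed q t k = length-++-≤ (map (fix 1# t) (take ρ (profitClass k)))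
    (ℕ.≤-trans (ℕ.≤-reflexive
        (≡.trans (length-map (fix 1# t) (take ρ (profitClass k))) (length-take ρ (profitClass k))))
      (ℕ.≤-trans (ℕ.m⊓n≤n ρ (length (profitClass k))) (length-profitClass k)))
    (ℕ.≤-trans (ℕ.≤-reflexive (length-replicate (ρ ∸ length (profitClass k))))
      (ℕ.≤-trans (ℕ.m∸n≤m ρ (length (profitClass k)))
          (ℕ.≤-pred (Fin.toℕ<n (Vec.lookup (Vec.lookup (Pair.ρ q) t) k)))))
    where
    ρ : ℕ
    ρ = Pair.ρ⟨_,_⟩ q t k

  length-excluded : ∀ q t k → length (excluded q t k) ℕ.≤ n
  length-excluded q t k = excluded-elim q t k (λ system → length system ℕ.≤ n) z≤n λ _ →
    ℕ.≤-trans (ℕ.≤-reflexive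
        (≡.trans (length-map (fix 0# t) (drop ρ (profitClass k))) (length-drop ρ (profitClass k))))
      (ℕ.≤-trans (ℕ.m∸n≤m (length (profitClass k)) ρ) (length-profitClass k))
    where
    ρ : ℕ
    ρ = Pair.ρ⟨_,_⟩ q t k

  length-block : ∀ q B → length (blockConstraints q B) ℕ.≤
                 T ℕ.* (suc K ℕ.* n) ℕ.+ T ℕ.* (suc K ℕ.* ((n ℕ.+ suc R) ℕ.+ n))
  length-block q B = length-++-≤ (early q B) (length-early q B)
    (concatMap-filter-≤ (Block.inTimes? B) classes λ t →
      concatMap-filter-≤ (Block.inClasses? B) (λ k → packed q t k ++ excluded q t k) λ k →
        length-++-≤ (packed q t k) (length-packed q t k) (length-excluded q t k))
    where
    classes : Fin T → System (Fin T × Fin n)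
    classes t = concatMap (λ k → packed q t k ++ excluded q t k)
        (filter (Block.inClasses? B) (allFin (suc K)))

  length-blocksFrom : ∀ τ S → length (blocksFrom τ S) ≡ length S
  length-blocksFrom τ []            = ≡.refl
  length-blocksFrom τ ((t , k) ∷ S) = ≡.cong suc (length-blocksFrom (toℕ t) S)

  length-skeleton : ∀ {S} → Linked Ordered S → length S ℕ.≤ T
  length-skeleton {S} linked = ≡.subst₂ ℕ._≤_ (length-map proj₁ S) (length-allFin T)
    (Unique-⊆⇒length-≤ (AllPairs.map⁺ (AllPairs.map distinct
      (Linked⇒AllPairs (λ {x} {y} {z} → Ordered-trans {x} {y} {z}) linked))) (λ {t} _ → ∈-allFin t))
    where
    distinct : ∀ {x y} → Ordered x y → proj₁ x ≢ proj₁ y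
    distinct (t′<t , _) ≡.refl = ℕ.<-irrefl ≡.refl t′<t

  length-P : ∀ {q} → Admissible q → length (P q) ℕ.≤ n ℕ.* systemBound T (suc K) R
  length-P {q} adm = ℕ.≤-trans (length-++-≤ common length-common
      (ℕ.≤-trans (length-concatMap-≤ (blockConstraints q) (blocks q) (length-block q))
        (ℕ.*-monoˡ-≤ _ (ℕ.≤-trans (ℕ.≤-reflexive (length-blocksFrom T (Pair.S q)))
            (length-skeleton (Admissible.ordered adm))))))
    (ℕ.≤-trans (ℕ.+-mono-≤
        (ℕ.+-monoˡ-≤ _ (m≤m*n T))
        (ℕ.*-monoʳ-≤ T (ℕ.+-monoʳ-≤ (T ℕ.* (suc K ℕ.* n)) (ℕ.*-monoʳ-≤ T (ℕ.*-monoʳ-≤ (suc K)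
          (ℕ.+-monoˡ-≤ n (ℕ.+-monoʳ-≤ n (m≤m*n (suc R)))))))))
      (ℕ.≤-reflexive (system-arithmetic n T (suc K) R)))
    where
    m≤m*n : ∀ m → m ℕ.≤ m ℕ.* n
    m≤m*n m = ℕ.m≤m*n m n ⦃ ℕ.>-nonZero 1≤n ⦄

  open Logarithms F ε 0<ε using (⌈log-fromℕ⌉≤; ⌈log-T/ε⌉≤; ⌈log-ε⁻¹⌉≤)

  bound≤power : 2 ℕ.≤ T →
      formulationBound T pairBound (systemBound T (suc K) R) ℕ.≤ T ℕ.^ (2 ℕ.* formulationExponent R)
  bound≤power 2≤T with log₂-approximation T (ℕ.≤-trans (s≤s z≤n) 2≤T)
  -- The calculus needs 1 ≤ l, and l = 0 would give T ≤ 1.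
  ... | zero  , T≤1 , _        = ⊥-elim (ℕ.<⇒≱ 2≤T T≤1)
  ... | suc l , T≤2^l , 2^l≤2T =
      formulationBound≤ {suc l} (s≤s z≤n) {T} {C = suc C} 2≤T T≤2^l 2^l≤2T
    (suc≤l*suc {suc l} (s≤s z≤n) (⌈log-fromℕ⌉≤ {T} {suc l} T≤2^l))
    (suc≤l*suc {suc l} (s≤s z≤n)
        (ℕ.≤-trans (⌈log-T/ε⌉≤ {T} {suc l} T≤2^l) ([l+m]*m≤ {suc l} (s≤s z≤n) R)))
    (s≤s ⌈log-ε⁻¹⌉≤)

  -- The left side is the last summand of `formulationBound`, so one exponent serves both size
  -- bounds.
  pairs*system≤ : n ℕ.* (pairBound ℕ.* systemBound T (suc K) R) ℕ.≤
                  n ℕ.* formulationBound T pairBound (systemBound T (suc K) R)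
  pairs*system≤ = ℕ.*-monoʳ-≤ n (ℕ.≤-trans (ℕ.m≤n+m _ pairBound) (ℕ.≤-trans (ℕ.m≤n+m _ 1)
    (ℕ.≤-trans (ℕ.m≤n+m _ T) (ℕ.m≤n+m _ (T ℕ.+ pairBound ℕ.* (T ℕ.+ 1))))))

-- The disjunctive formulation of the union

module Formulation {c ℓ₁ ℓ₂} (F : ArchimedeanField c ℓ₁ ℓ₂)
  (ε : ArchimedeanField.Carrier F) (0<ε : ArchimedeanField._<_ F (ArchimedeanField.0# F) ε)
  {n T : ℕ} (I : Knapsack.Instance F n T) (σ : Permutation′ n)
  (pairs : List (Knapsack.Scheme.Pair F ε 0<ε I))
  (∈-pairs : ∀ q → q ∈ pairs ⇔ Knapsack.Scheme.Admissible F ε 0<ε I q) where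

  open ArchimedeanField F
  open OrderedField F hiding (+-monoˡ-≤; *-monoˡ-≤; 0≤1; x≤x+y)
  open LinearForms F
  open LinearSystems F
  open Knapsack F
  open Scheme ε 0<ε I
  open Polytopes σ
  open Enumeration F ε 0<ε I using (pairBound)
  open Sizes F ε 0<ε I σ

  systems : List (System (Fin T × Fin n))
  systems = map P pairs

  ∈-variables : ∀ v → v ∈ variables
  ∈-variables (t , i) = ∈-cartesianProduct⁺ (∈-allFin t) (∈-allFin i)

  open Disjunctive F variables ∈-variables systems

  -- With right-hand sides scaled by 0, the rows 0 ≤ x ≤ 1 become 0 ≤ y ≤ 0.
  common-bounded : ∀ {y} → All (Scaled 0# y) common → ∀ v → y v ≈ 0#
  common-bounded {y} scaled v = ≤-antisym
    (≤-respˡ (evaluate-single y v)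
        (≤-respʳ (zeroʳ 1#) (lower
        (All.lookup (All.map⁻ {f = at-most-one} above) (∈-variables v)))))
    (-x≤0⇒0≤x (≤-respˡ (evaluate-negated y v) (≤-respʳ (zeroʳ 0#)
      (lower (All.lookup (All.map⁻ {f = nonNegative} below) (∈-variables v))))))
    where
    nonNegative at-most-one : Fin T × Fin n → Constraint (Fin T × Fin n)
    nonNegative v = ((- 1# , v) ∷ []) ⟨ leq ⟩ 0#
    at-most-one v = ((1# , v) ∷ []) ⟨ leq ⟩ 1#

    bounds : All (Scaled 0# y) (map nonNegative variables ++ map at-most-one variables)
    bounds = All.++⁻ʳ (concatMap _ (allFin T)) (All.++⁻ʳ (map _ (allFin T)) scaled)

    below = All.++⁻ˡ (map nonNegative variables) bounds
    above = All.++⁻ʳ (map nonNegative variables) bounds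

  system-of : ∀ r → ∃ λ q → q ∈ pairs × lookup systems r ≡ P q
  system-of r = ∈-map⁻ P (∈-lookup {xs = systems} r)

  systems-bounded : ∀ r y → All (Scaled 0# y) (lookup systems r) → ∀ v → y v ≈ 0#
  systems-bounded r y scaled =
      common-bounded (All.++⁻ˡ common
      (≡.subst (All (Scaled 0# y)) (proj₂ (proj₂ (system-of r))) scaled))

  ⋃P⇒⋃ : ∀ {y} → ⋃P y → ⋃ y
  ⋃P⇒⋃ {y} (q , adm , solves) = index P∈ , ≡.subst (Solves y) (lookup-index P∈) solves
    where
    P∈ : P q ∈ systems
    P∈ = ∈-map⁺ P (Equivalence.from (∈-pairs q) adm)

  ⋃⇒⋃P : ∀ {y} → ⋃ y → ⋃P y
  ⋃⇒⋃P {y} (r , solves) = proj₁ (system-of r) ,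
    Equivalence.to (∈-pairs (proj₁ (system-of r))) (proj₁ (proj₂ (system-of r))) ,
    ≡.subst (Solves y) (proj₂ (proj₂ (system-of r))) solves

  Extension : Point n T → Set _
  Extension x = ∃ λ z → Solves z (disjunctive variables systems) × (∀ v → z (original v) ≈ x v)

  hull⇒extension : ∀ x → ConvexHull ⋃P x → Extension x
  hull⇒extension x hull =
      Equivalence.to (hull⇔disjunctive systems-bounded x)
      (ConvexHull-mono {P = ⋃P} {Q = ⋃} ⋃P⇒⋃ x hull)

  extension⇒hull : ∀ x → Extension x → ConvexHull ⋃P x
  extension⇒hull x ext =
      ConvexHull-mono {P = ⋃} {Q =
      ⋃P} ⋃⇒⋃P x (Equivalence.from (hull⇔disjunctive systems-bounded x) ext)

  hull-⋃P : ∀ x → ConvexHull ⋃P x ⇔ Extension x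
  hull-⋃P x = mk⇔ (hull⇒extension x) (extension⇒hull x)

  module _ (length-pairs : length pairs ℕ.≤ pairBound) where

    length-systems : length systems ℕ.≤ pairBound
    length-systems = ℕ.≤-trans (ℕ.≤-reflexive (length-map P pairs)) length-pairs

    sum-lengths : sumℕ (map (length ∘ P) pairs) ℕ.≤ n ℕ.* (pairBound ℕ.* systemBound T (suc K) R)
    sum-lengths = ℕ.≤-trans
      (sum-map-≤ (length ∘ P) pairs λ {q} q∈ → length-P (Equivalence.to (∈-pairs q) q∈))
      (ℕ.≤-trans (ℕ.*-monoˡ-≤ _ length-pairs)
          (ℕ.≤-reflexive (*-swap pairBound n (systemBound T (suc K) R))))

    sum-lengths≤power : 2 ℕ.≤ T →
        sumℕ (map (length ∘ P) pairs) ℕ.≤ n ℕ.* T ℕ.^ (2 ℕ.* formulationExponent R)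
    sum-lengths≤power 2≤T =
        ℕ.≤-trans sum-lengths (ℕ.≤-trans pairs*system≤ (ℕ.*-monoʳ-≤ n (bound≤power 2≤T)))

    size≤power : 2 ℕ.≤ T →
        disjunctiveSize variables systems ℕ.≤ n ℕ.* T ℕ.^ (2 ℕ.* formulationExponent R)
    size≤power 2≤T = ℕ.≤-trans (ℕ.+-mono-≤
        (ℕ.+-mono-≤ (ℕ.≤-reflexive length-variables)
          (ℕ.*-mono-≤ length-systems (ℕ.+-mono-≤ (ℕ.≤-reflexive length-variables) 1≤1*n)))
        (ℕ.≤-trans (ℕ.≤-reflexive length-disjunctive)
          (ℕ.+-mono-≤ (ℕ.≤-reflexive length-variables) (ℕ.+-mono-≤ 1≤1*n
            (ℕ.+-mono-≤ (ℕ.≤-trans length-systems (ℕ.m≤m*n pairBound n ⦃ ℕ.>-nonZero 1≤n ⦄))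
              (ℕ.≤-trans (ℕ.≤-reflexive (≡.cong sumℕ (≡.sym (map-∘ pairs)))) sum-lengths))))))
      (ℕ.≤-trans (ℕ.≤-reflexive (formulation-arithmetic n T pairBound (systemBound T (suc K) R)))
        (ℕ.*-monoʳ-≤ n (bound≤power 2≤T)))
      where
      1≤1*n : 1 ℕ.≤ 1 ℕ.* n
      1≤1*n = ℕ.≤-trans 1≤n (ℕ.≤-reflexive (≡.sym (ℕ.*-identityˡ n)))

-- Optimal solutions

module Optimality {c ℓ₁ ℓ₂} (F : ArchimedeanField c ℓ₁ ℓ₂)
  (ε : ArchimedeanField.Carrier F) (0<ε : ArchimedeanField._<_ F (ArchimedeanField.0# F) ε)
  {n T : ℕ} (I : Knapsack.Instance F n T) (σ : Permutation′ n)
  (wellBehaved : Knapsack.Scheme.WellBehaved F ε 0<ε I) (byEfficiency : Knapsack.ByEfficiency F I σ)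
  {last : Fin T} (last≡ : suc (toℕ last) ≡ T) where

  open ArchimedeanField F
  open Knapsack F
  open Scheme ε 0<ε I
  open Polytopes σ
  open Soundness F ε 0<ε I σ

  -- Each competitor `y` is dominated by a binary point of the union, with which `x` is compared by
  -- maximality.
  maximiser-1-in : ∀ x → IsMaximiser (totalProfit I) (λ y → ⋃P y × Binary y) x →
                   IsMaximiser (totalProfit I) (λ y → Feasible I y × OneIn I y) x
  maximiser-1-in x ((x∈ , binary) , maximal) = ⋃P⇒feasible last≡ x∈ binary , best
    where
    best : ∀ y → Feasible I y × OneIn I y → totalProfit I y ≤ totalProfit I x
    best y (feasible , oneIn) = ≤-trans C.profit≤ (maximal C.x (C.x∈⋃P last≡ oneIn , C.x-binary))
      where
      module C = Completeness F ε 0<ε I σ wellBehaved byEfficiency y feasible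

open import Data.Nat.ListAction using (sum)

theorem4 : ∀ {c ℓ₁ ℓ₂} (F : ArchimedeanField c ℓ₁ ℓ₂) →
    let open ArchimedeanField F hiding (sum)
        open LinearSystems F
        open Knapsack F
    in
    (∀ ε (0<ε : 0# < ε) T → 2 ℕ.≤ T → ∀ n (I : Instance n T) →
      let open Scheme ε 0<ε I in
      WellBehaved → ∀ σ → ByEfficiency I σ →
      let open Polytopes σ in
      ∀ x → IsMaximiser (totalProfit I) (λ y → ⋃P y × Binary y) x →
            IsMaximiser (totalProfit I) (λ y → Feasible I y × OneIn I y) x)
    ×
    (Σ (Carrier → ℕ) λ f →
      (∀ ε → 0# < ε → 0 ℕ.< f ε) ×
      (∀ ε ε′ → 0# < ε → ε ≈ ε′ → f ε ≡ f ε′) ×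
      (∀ ε (0<ε : 0# < ε) T → 2 ℕ.≤ T → ∀ n (I : Instance n T) →
        let open Scheme ε 0<ε I in
        WellBehaved → ∀ σ → ByEfficiency I σ →
        let open Polytopes σ in
        Σ (List Pair) λ L →
          Unique L × (∀ q → q ∈ L ⇔ Admissible q) ×
          sum (map (λ q → length (P q)) L) ℕ.≤ n ℕ.* T ℕ.^ f ε ×
          disjunctiveSize variables (map P L) ℕ.≤ n ℕ.* T ℕ.^ f ε ×
          (∀ x → ConvexHull ⋃P x ⇔
            (∃ λ z → Solves z (disjunctive variables (map P L)) ×
                     (∀ v → z (original v) ≈ x v)))))
theorem4 F =
    -- T = 0 contradicts 2 ≤ T, so there is a last time.
    (λ { ε 0<ε (suc T) _ n I wellBehaved σ byEfficiency →
      Optimality.maximiser-1-in F ε 0<ε I σ wellBehaved byEfficiency {Fin.fromℕ T}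
          (≡.cong suc (Fin.toℕ-fromℕ T)) })
  -- ε enters only through ⌈1/ε⌉, in terms of which the bounds on K, C and the number of significant
  -- times are stated.
  , (λ ε → 2 ℕ.* formulationExponent ⌈ ε ⁻¹ ⌉)
  , (λ ε _ → s≤s z≤n)
  , (λ ε ε′ 0<ε ε≈ε′ → ≡.cong (λ m → 2 ℕ.* formulationExponent m)
      (⌈⌉-cong (⁻¹-cong (0<⇒≉0 0<ε) ε≈ε′)))
  , λ ε 0<ε T 2≤T n I wellBehaved σ byEfficiency →
      let open Enumeration F ε 0<ε I
          open Formulation F ε 0<ε I σ admissiblePairs ∈-admissiblePairs
      in admissiblePairs , admissiblePairs-unique , ∈-admissiblePairs
       , sum-lengths≤power length-admissiblePairs 2≤T , size≤power length-admissiblePairs 2≤T ,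
           hull-⋃P
  where
  open ArchimedeanField F
  open Rounding F
  open OrderedField F
  open NaturalEmbedding F
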